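{- Every lexicographic extension of a Euclidean oriented matroid is Euclidean.
   Context: An oriented matroid $\mathcal{O}$ on a finite ground set $E$ is given by its covectors in $\{+,-,0\}^E$; cocircuits are the minimal nonzero covectors. Notation: $X_e$ entry, $\mathrm{supp}(X)$, $z(X)=E\setminus\mathrm{supp}(X)$, composition $X\circ Y$, $\mathrm{sep}(X,Y)=\{e:X_e=-Y_e\neq0\}$, conformal means $\mathrm{sep}=\emptyset$. With $r$ the rank of $\mathcal{M}(\mathcal{O})$, cocircuits $X\neq\pm Y$ are comodular if $z(X\circ Y)$ is a flat of rank $r-2$; then elimination of $e\in\mathrm{sep}(X,Y)$ yields the unique cocircuit $Z$ with $Z_e=0$, $\mathrm{supp}(Z)\subseteq\mathrm{supp}(X\circ Y)\setminus\{e\}$. An oriented matroid program $(\mathcal{O},g,f)$: distinct $g,f\in E$, $g$ not a loop, $f$ not a coloop. For comodular cocircuits $X,Y$ with $X_g=Y_g\ne0$ let $Z$ be the elimination of $g$ between $-X$ and $Y$; $X\to Y$ if $Z_f=+$, $X\leftarrow Y$ if $Z_f=-$, undirected if $Z_f=0$. $G_f$ has vertices the cocircuits with $Y_g=+$ and edges between conformal comodular pairs, directed so. A directed cycle is a closed sequence of pairwise distinct vertices, consecutive ones adjacent, each edge forward or undirected and at least one forward. $(\mathcal{O},g,f)$ is Euclidean if $G_f$ has no directed cycle; $\mathcal{O}$ is Euclidean if all programs $(\mathcal{O},g,f)$ with $g\ne f$, $g$ not a loop, $f$ not a coloop, are Euclidean. For an ordered subset $[e_1,\dots,e_k]$ of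 $E$ and $\alpha\in\{+,-\}^k$, the lexicographic extension $\mathcal{O}[e_1^{\alpha_1},\dots,e_k^{\alpha_k}]=\mathcal{O}\cup p$ is the single-element extension by $p$ with localization $\sigma(Y)=\alpha_iY_{e_i}$ for cocircuits $Y$, $i$ the least index with $Y_{e_i}\neq0$, and $\sigma(Y)=0$ if no such index exists. -}

module Defs where

open import Data.Nat using (ℕ; zero; suc; _+_; _≤_)
open import Data.Fin using (Fin) renaming (zero to fzero; suc to fsuc)
open import Data.Fin.Subset using (Subset; _⊂_; inside; outside)
open import Data.Vec using (Vec; []; _∷_; lookup; map; zipWith; replicate)
open import Data.List using (List; []; _∷_) renaming (map to lmap)
open import Data.List.Relation.Unary.All using (All)
open import Data.List.Relation.Unary.Any using (Any)
open import Data.List.Relation.Unary.Unique.Propositional using (Unique)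
open import Data.Product using (Σ; ∃; _×_; _,_; proj₁; proj₂)
open import Data.Sum using (_⊎_)
open import Relation.Nullary using (¬_)
open import Relation.Binary.PropositionalEquality using (_≡_; _≢_)

data Sign : Set where
  pos neg zer : Sign

opp : Sign → Sign
opp pos = neg
opp neg = pos
opp zer = zer

comp : Sign → Sign → Sign
comp zer b = b
comp pos _ = pos
comp neg _ = neg

mul : Sign → Sign → Sign
mul pos s = s
mul neg s = opp s
mul zer _ = zer

SV : ℕ → Set
SV n = Vec Sign n

zeroV : ∀ {n} → SV n
zeroV = replicate _ zer

-_ᵛ : ∀ {n} → SV n → SV n
- X ᵛ = map opp X

_∘ᵛ_ : ∀ {n} → SV n → SV n → SV n
X ∘ᵛ Y = zipWith comp X Y

Opposite : Sign → Sign → Set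
Opposite a b = (a ≡ pos × b ≡ neg) ⊎ (a ≡ neg × b ≡ pos)

InSep : ∀ {n} → SV n → SV n → Fin n → Set
InSep X Y e = Opposite (lookup X e) (lookup Y e)

Conformal : ∀ {n} → SV n → SV n → Set
Conformal X Y = ∀ e → ¬ InSep X Y e

isZero : Sign → Data.Fin.Subset.Side
isZero zer = inside
isZero pos = outside
isZero neg = outside

z : ∀ {n} → SV n → Subset n
z X = map isZero X

_≼_ : ∀ {n} → SV n → SV n → Set
Y ≼ X = ∀ e → (lookup Y e ≡ zer) ⊎ (lookup Y e ≡ lookup X e)

record OM (n : ℕ) : Set₁ where
  field
    Cov : SV n → Set
    L0  : Cov zeroV
    L1  : ∀ {X} → Cov X → Cov (- X ᵛ)
    L2  : ∀ {X Y} → Cov X → Cov Y → Cov (X ∘ᵛ Y)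
    L3  : ∀ {X Y} e → Cov X → Cov Y → InSep X Y e →
          ∃ λ Z → Cov Z × lookup Z e ≡ zer ×
            (∀ f → ¬ InSep X Y f → lookup Z f ≡ lookup (X ∘ᵛ Y) f)

open OM public

module _ {n : ℕ} (O : OM n) where

  Cocircuit : SV n → Set
  Cocircuit X = Cov O X × X ≢ zeroV ×
    (∀ Y → Cov O Y → Y ≢ zeroV → Y ≼ X → Y ≡ X)

  IsFlat : Subset n → Set
  IsFlat F = ∃ λ W → Cov O W × z W ≡ F

  data Chain : Subset n → Subset n → ℕ → Set where
    done : ∀ {F} → IsFlat F → Chain F F 0
    step : ∀ {F G H k} → IsFlat F → F ⊂ G → Chain G H k → Chain F H (suc k)

  -- the flat F has rank k in M(O) (height in the lattice of flats)
  FlatRank : Subset n → ℕ → Set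
  FlatRank F k = IsFlat F × (∃ λ G → Chain G F k) ×
    (∀ G m → Chain G F m → m ≤ k)

  Comodular : SV n → SV n → Set
  Comodular X Y = Cocircuit X × Cocircuit Y × X ≢ Y × X ≢ - Y ᵛ ×
    ∃ λ k → FlatRank (z (X ∘ᵛ Y)) k × FlatRank Data.Fin.Subset.⊤ (2 + k)

  Elim : Fin n → SV n → SV n → SV n → Set
  Elim e X Y Z = Cocircuit Z × lookup Z e ≡ zer ×
    (∀ f → (lookup Z f ≡ pos → lookup X f ≡ pos ⊎ lookup Y f ≡ pos)
         × (lookup Z f ≡ neg → lookup X f ≡ neg ⊎ lookup Y f ≡ neg))

  IsLoop : Fin n → Set
  IsLoop e = ∀ X → Cov O X → lookup X e ≡ zer

  IsColoop : Fin n → Set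
  IsColoop e = ∃ λ X → Cocircuit X × (∀ f → lookup X f ≢ zer → f ≡ e)

  module _ (g f : Fin n) where

    Vertex : SV n → Set
    Vertex Y = Cocircuit Y × lookup Y g ≡ pos

    Adjacent : SV n → SV n → Set
    Adjacent X Y = Conformal X Y × Comodular X Y

    Forward : SV n → SV n → Set
    Forward X Y = ∃ λ Z → Elim g (- X ᵛ) Y Z × lookup Z f ≡ pos

    Undirected : SV n → SV n → Set
    Undirected X Y = ∃ λ Z → Elim g (- X ᵛ) Y Z × lookup Z f ≡ zer

cycleEdges : ∀ {A : Set} → List A → List (A × A)
cycleEdges [] = []
cycleEdges {A} (x ∷ xs) = go x xs
  where
  go : A → List A → List (A × A)
  go c [] = (c , x) ∷ []
  go c (y ∷ ys) = (c , y) ∷ go y ys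

module _ {n : ℕ} (O : OM n) (g f : Fin n) where

  DirectedCycle : List (SV n) → Set
  DirectedCycle vs =
    All (Vertex O g f) vs × Unique vs ×
    All (λ p → Adjacent O g f (proj₁ p) (proj₂ p) ×
               (Forward O g f (proj₁ p) (proj₂ p) ⊎ Undirected O g f (proj₁ p) (proj₂ p)))
        (cycleEdges vs) ×
    Any (λ p → Forward O g f (proj₁ p) (proj₂ p)) (cycleEdges vs)

  EuclideanProgram : Set
  EuclideanProgram = ∀ vs → ¬ DirectedCycle vs

Euclidean : ∀ {n} → OM n → Set
Euclidean {n} O = ∀ (g f : Fin n) → g ≢ f → ¬ IsLoop O g → ¬ IsColoop O f →
  EuclideanProgram O g f

-- Single-element extensions. The new element p is fzero of Fin (suc n);
-- e ∈ E corresponds to fsuc e, so (s ∷ X) is X extended by X_p = s.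

IsExtension : ∀ {n} → OM n → OM (suc n) → (SV n → Sign) → Set
IsExtension O O' σ =
  -- O' \ p = O
  (∀ X → Cov O X → ∃ λ s → Cov O' (s ∷ X)) ×
  (∀ X s → Cov O' (s ∷ X) → Cov O X) ×
  -- rank is preserved (p not a coloop)
  ¬ IsColoop O' fzero ×
  (∀ Y → Cocircuit O Y → Cov O' (σ Y ∷ Y))

lexσ : ∀ {n} → List (Fin n × Sign) → SV n → Sign
lexσ [] Y = zer
lexσ ((e , α) ∷ rest) Y with lookup Y e
... | zer = lexσ rest Y
... | s = mul α s

IsLexExtension : ∀ {n} → OM n → List (Fin n × Sign) → OM (suc n) → Set
IsLexExtension O es O' =
  Unique (lmap proj₁ es) × All (λ p → proj₂ p ≢ zer) es × IsExtension O O' (lexσ es)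

{-# OPTIONS --safe #-}
module Submission where

-- A new element p of O[a,b] behaves like a + εb with ε infinitesimal, and a lexicographic extension
-- by a longer list is O[a,q] with the auxiliary element q deleted, where q is the extension by the
-- tail of the list. So it suffices to treat O[a,b], for which the covectors can be written down.
--
-- For the program (g,f) a closed monotone walk in the extension is pushed into O. If f or g is p, the
-- vertices involved are cocircuits of O, and p = a + εb is compared first by a, then by b; the two
-- cases are exchanged by the duality f/g ↔ g/f. Otherwise a vertex y on p, on a line L of O, tends
-- to V = L ∩ a. Put D = L ∩ g. On the line L one has
--   f/g (y) = f/g (V) − ε (b/g)(V) · f(D) / (a(D) + ε b(D)),
-- so along a monotone walk f/g (V), sign of f(D), b/g (V), f/a (D), b/a (D) are monotone in this
-- lexicographic order. Apart from the sign each of them is a height in a program of O, and O being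
-- Euclidean none of them can change on a closed walk. If V lies on g, either f(V) ≠ 0, and f and g are exchanged, or
-- f(V) = 0, and V is replaced by the point L ∩ b, which has the same height as y.
--
-- Everything is negative, so membership in the finite set of covectors may be taken to be decidable.

-- The images in `O` of adjacent vertices, such as the directions `D` or the points `U`, are not
-- known to be conformal, and lifts of conformal vertices over a deleted element may be separated
-- there. So the induction carries `NoCycle`, which admits nonconformal edges and repeated vertices,
-- instead of `Euclidean`. Nothing is lost: a nonconformal edge can be subdivided at its separating
-- elements without changing its direction.
--
-- Ranks enter through upper bounds `Ht`, which pass to smaller supports and let an edge degenerate
-- to a point; exact ranks are recovered only when comodularity has to be produced.
--
-- The order of the five comparisons is forced. How a change of b/g (V) moves the height of y
-- depends on the signs of f(D) and of b at V, so these must be constant before b/g (V) can be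
-- compared; likewise the directions D of two vertices are compared only after the earlier heights
-- are known to be level.

open import Defs
open import Data.Nat using (ℕ; zero; suc; _+_; _≤_; _<_; z≤n; s≤s)
open import Data.Nat.Properties using (+-comm; +-suc; +-monoʳ-≤; +-cancelˡ-≤; m≤m+n; 1+n≰n; <⇒≱; <-≤-trans)
open import Data.Fin using (Fin) renaming (zero to fzero; suc to fsuc)
open import Data.Fin.Properties using (any?)
open import Data.Fin.Subset using (_⊂_; _∈_; inside; outside; ∣_∣) renaming (⊤ to full)
open import Data.Fin.Subset.Properties using (∈⊤; ∣p∣≤n; p⊂q⇒∣p∣<∣q∣)
open import Data.Vec using ([]; _∷_; lookup; tail)
open import Data.Vec.Properties using (≡-dec; lookup-map; lookup-zipWith; lookup-replicate; lookup⇒[]=; []=⇒lookup; map-replicate)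
open import Data.List using (List; []; _∷_; allFin)
import Data.List.Membership.Propositional as List
import Data.List.Membership.DecPropositional as DecList
open import Data.List.Membership.Propositional.Properties using (∈-allFin)
open import Data.List.Relation.Unary.Any using (Any; here; there)
open import Data.List.Relation.Unary.All using (All; []; _∷_)
open import Data.List.Relation.Unary.All.Properties using (¬Any⇒All¬)
open import Data.List.Relation.Unary.AllPairs using ([]; _∷_)
open import Data.List.Relation.Unary.Unique.Propositional using (Unique)
open import Data.Product using (∃; Σ; _×_; _,_; proj₁; proj₂)
open import Data.Sum using (_⊎_; inj₁; inj₂) renaming (swap to swap⊎)
open import Data.Empty using (⊥; ⊥-elim)
open import Function using (_∘_)
open import Relation.Nullary using (¬_; Dec; yes; no)
open import Relation.Nullary.Decidable using (_×-dec_; ¬?; _⊎-dec_)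
open import Relation.Binary.PropositionalEquality using (_≡_; _≢_; refl; sym; trans; cong; cong₂; subst)
open import Relation.Binary.Construct.Closure.ReflexiveTransitive using (Star; ε; _◅_; _◅◅_; gmap; reverse)

-- Signs

infix 4 _≟ₛ_
_≟ₛ_ : (s t : Sign) → Dec (s ≡ t)
pos ≟ₛ pos = yes refl
pos ≟ₛ neg = no λ ()
pos ≟ₛ zer = no λ ()
neg ≟ₛ pos = no λ ()
neg ≟ₛ neg = yes refl
neg ≟ₛ zer = no λ ()
zer ≟ₛ pos = no λ ()
zer ≟ₛ neg = no λ ()
zer ≟ₛ zer = yes refl

opp-opp : ∀ s → opp (opp s) ≡ s
opp-opp pos = refl
opp-opp neg = refl
opp-opp zer = refl

opp-zer⁻ : ∀ {s} → opp s ≡ zer → s ≡ zer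
opp-zer⁻ {zer} _ = refl

opp-fix : ∀ {s} → s ≡ opp s → s ≡ zer
opp-fix {zer} _ = refl

opp-inj : ∀ {s t} → opp s ≡ opp t → s ≡ t
opp-inj {s} {t} p = trans (sym (opp-opp s)) (trans (cong opp p) (opp-opp t))

opp-nz : ∀ {s} → s ≢ zer → opp s ≢ zer
opp-nz h = h ∘ opp-zer⁻

comp-zerʳ : ∀ s → comp s zer ≡ s
comp-zerʳ pos = refl
comp-zerʳ neg = refl
comp-zerʳ zer = refl

comp-zer⁻ : ∀ {s t} → comp s t ≡ zer → s ≡ zer × t ≡ zer
comp-zer⁻ {zer} h = refl , h

comp-nz : ∀ {s t} → s ≢ zer → comp s t ≡ s
comp-nz {pos} _ = refl
comp-nz {neg} _ = refl
comp-nz {zer} h = ⊥-elim (h refl)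

±-split : ∀ {s t} → s ≢ zer → t ≢ zer → s ≡ t ⊎ s ≡ opp t
±-split {pos} {pos} _ _ = inj₁ refl
±-split {pos} {neg} _ _ = inj₂ refl
±-split {neg} {pos} _ _ = inj₂ refl
±-split {neg} {neg} _ _ = inj₁ refl
±-split {zer} h _ = ⊥-elim (h refl)
±-split {pos} {zer} _ h = ⊥-elim (h refl)
±-split {neg} {zer} _ h = ⊥-elim (h refl)

mul-zerʳ : ∀ s → mul s zer ≡ zer
mul-zerʳ pos = refl
mul-zerʳ neg = refl
mul-zerʳ zer = refl

mul-oppʳ : ∀ s t → mul s (opp t) ≡ opp (mul s t)
mul-oppʳ pos t = refl
mul-oppʳ neg t = refl
mul-oppʳ zer t = refl

mul-oppˡ : ∀ s t → mul (opp s) t ≡ opp (mul s t)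
mul-oppˡ pos t = refl
mul-oppˡ neg t = sym (opp-opp t)
mul-oppˡ zer t = refl

mul-zer⁻ : ∀ {s t} → mul s t ≡ zer → s ≢ zer → t ≡ zer
mul-zer⁻ {pos} h _ = h
mul-zer⁻ {neg} h _ = opp-zer⁻ h
mul-zer⁻ {zer} _ h = ⊥-elim (h refl)

mul-nz : ∀ {s t} → s ≢ zer → t ≢ zer → mul s t ≢ zer
mul-nz s≢ t≢ h = t≢ (mul-zer⁻ h s≢)

mul-invˡ : ∀ {s} t → s ≢ zer → mul s (mul s t) ≡ t
mul-invˡ {pos} t _ = refl
mul-invˡ {neg} t _ = opp-opp t
mul-invˡ {zer} _ h = ⊥-elim (h refl)

mul-comm : ∀ s t → mul s t ≡ mul t s
mul-comm pos pos = refl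
mul-comm pos neg = refl
mul-comm pos zer = refl
mul-comm neg pos = refl
mul-comm neg neg = refl
mul-comm neg zer = refl
mul-comm zer t = sym (mul-zerʳ t)

mul-assoc : ∀ s t u → mul (mul s t) u ≡ mul s (mul t u)
mul-assoc pos t u = refl
mul-assoc neg t u = mul-oppˡ t u
mul-assoc zer t u = refl

mul-cancelˡ : ∀ {s t u} → s ≢ zer → mul s t ≡ mul s u → t ≡ u
mul-cancelˡ {s} {t} {u} h p = trans (sym (mul-invˡ t h)) (trans (cong (mul s) p) (mul-invˡ u h))

mul-cancelʳ : ∀ {s t u} → s ≢ zer → mul t s ≡ mul u s → t ≡ u
mul-cancelʳ {s} {t} {u} h p = mul-cancelˡ h (trans (mul-comm s t) (trans p (mul-comm u s)))

mul-opp-cancelʳ : ∀ {s t u} → s ≢ zer → mul t s ≡ mul u (opp s) → t ≡ opp u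
mul-opp-cancelʳ {s} {t} {u} h p = mul-cancelʳ h (trans p (trans (mul-oppʳ u s) (sym (mul-oppˡ u s))))

mul-fix : ∀ {τ s} → s ≢ zer → s ≡ mul τ s → τ ≡ pos
mul-fix {pos} _ _ = refl
mul-fix {neg} nz h = ⊥-elim (nz (opp-fix h))
mul-fix {zer} nz h = ⊥-elim (nz h)

Opposite? : ∀ s t → Dec (Opposite s t)
Opposite? s t = ((s ≟ₛ pos) ×-dec (t ≟ₛ neg)) ⊎-dec ((s ≟ₛ neg) ×-dec (t ≟ₛ pos))

Opposite-nzˡ : ∀ {s t} → Opposite s t → s ≢ zer
Opposite-nzˡ (inj₁ (refl , _)) ()
Opposite-nzˡ (inj₂ (refl , _)) ()

Opposite-nzʳ : ∀ {s t} → Opposite s t → t ≢ zer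
Opposite-nzʳ (inj₁ (_ , refl)) ()
Opposite-nzʳ (inj₂ (_ , refl)) ()

Opposite-irrefl : ∀ {s t} → s ≡ t → ¬ Opposite s t
Opposite-irrefl refl (inj₁ (refl , ()))
Opposite-irrefl refl (inj₂ (refl , ()))

opposite-opp : ∀ {s} → s ≢ zer → Opposite s (opp s)
opposite-opp {pos} _ = inj₁ (refl , refl)
opposite-opp {neg} _ = inj₂ (refl , refl)
opposite-opp {zer} h = ⊥-elim (h refl)

nosep⇒≡ : ∀ {s t} → ¬ Opposite s t → s ≢ zer → t ≢ zer → s ≡ t
nosep⇒≡ {s} {t} h p q with ±-split p q
... | inj₁ r = r
... | inj₂ refl = ⊥-elim (h (subst (Opposite (opp t)) (opp-opp t) (opposite-opp p)))

opposite-sym : ∀ {s t} → Opposite s t → Opposite t s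
opposite-sym (inj₁ (p , q)) = inj₂ (q , p)
opposite-sym (inj₂ (p , q)) = inj₁ (q , p)

opposite-mul⁻ : ∀ {α s t} → Opposite (mul α s) (mul α t) → Opposite s t
opposite-mul⁻ {pos} o = o
opposite-mul⁻ {neg} {pos} {neg} o = inj₁ (refl , refl)
opposite-mul⁻ {neg} {neg} {pos} o = inj₂ (refl , refl)
opposite-mul⁻ {neg} {zer} o = ⊥-elim (Opposite-nzˡ o refl)
opposite-mul⁻ {neg} {pos} {zer} o = ⊥-elim (Opposite-nzʳ o refl)
opposite-mul⁻ {neg} {neg} {zer} o = ⊥-elim (Opposite-nzʳ o refl)
opposite-mul⁻ {neg} {pos} {pos} o = ⊥-elim (Opposite-irrefl refl o)
opposite-mul⁻ {neg} {neg} {neg} o = ⊥-elim (Opposite-irrefl refl o)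
opposite-mul⁻ {zer} o = ⊥-elim (Opposite-nzˡ o refl)

opposite⇒opp : ∀ {s t} → Opposite s t → s ≡ opp t
opposite⇒opp (inj₁ (refl , refl)) = refl
opposite⇒opp (inj₂ (refl , refl)) = refl

opp⇒opposite : ∀ {s t} → s ≢ zer → s ≡ opp t → Opposite s t
opp⇒opposite {s} {t} nz refl = subst (Opposite (opp t)) (opp-opp t) (opposite-opp nz)

comp-comm : ∀ {s t} → ¬ Opposite s t → comp s t ≡ comp t s
comp-comm {pos} {pos} h = refl
comp-comm {pos} {neg} h = ⊥-elim (h (inj₁ (refl , refl)))
comp-comm {pos} {zer} h = refl
comp-comm {neg} {pos} h = ⊥-elim (h (inj₂ (refl , refl)))
comp-comm {neg} {neg} h = refl
comp-comm {neg} {zer} h = refl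
comp-comm {zer} {t} h = sym (comp-zerʳ t)

mul-comp : ∀ α s t → mul α (comp s t) ≡ comp (mul α s) (mul α t)
mul-comp pos s t = refl
mul-comp neg pos t = refl
mul-comp neg neg t = refl
mul-comp neg zer t = refl
mul-comp zer s t = refl

opp-comp : ∀ s t → opp (comp s t) ≡ comp (opp s) (opp t)
opp-comp pos t = refl
opp-comp neg t = refl
opp-comp zer t = refl

comp-absorbˡ : ∀ s t → comp (comp s t) s ≡ comp s t
comp-absorbˡ pos t = refl
comp-absorbˡ neg t = refl
comp-absorbˡ zer t = comp-zerʳ t

comp-absorbʳ : ∀ s t → comp (comp s t) t ≡ comp s t
comp-absorbʳ pos t = refl
comp-absorbʳ neg t = refl
comp-absorbʳ zer pos = refl
comp-absorbʳ zer neg = refl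
comp-absorbʳ zer zer = refl

swap-sign : ∀ {u d δ} → d ≡ zer ⊎ d ≡ δ → opp (mul u d) ≡ zer ⊎ opp (mul u d) ≡ opp (mul u δ)
swap-sign {u} (inj₁ refl) = inj₁ (cong opp (mul-zerʳ u))
swap-sign (inj₂ refl) = inj₂ refl

comp-idem : ∀ s → comp s s ≡ s
comp-idem pos = refl
comp-idem neg = refl
comp-idem zer = refl

-- Covectors, elimination and corank

module _ {n : ℕ} where

  infix 8 _!_
  _!_ : SV n → Fin n → Sign
  X ! e = lookup X e

  -! : ∀ (X : SV n) e → (- X ᵛ) ! e ≡ opp (X ! e)
  -! X e = lookup-map e opp X

  ∘! : ∀ (X Y : SV n) e → (X ∘ᵛ Y) ! e ≡ comp (X ! e) (Y ! e)
  ∘! X Y e = lookup-zipWith comp e X Y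

  zeroV! : ∀ e → zeroV {n} ! e ≡ zer
  zeroV! e = lookup-replicate e zer

ext : ∀ {n} {X Y : SV n} → (∀ e → X ! e ≡ Y ! e) → X ≡ Y
ext {X = []} {[]} h = refl
ext {X = x ∷ X} {y ∷ Y} h = cong₂ _∷_ (h fzero) (ext (λ e → h (fsuc e)))

neg-neg : ∀ {n} (X : SV n) → - (- X ᵛ) ᵛ ≡ X
neg-neg X = ext λ e → trans (-! (- X ᵛ) e) (trans (cong opp (-! X e)) (opp-opp _))

module _ {n : ℕ} where

  infix 4 _⊑_
  _⊑_ : SV n → SV n → Set
  U ⊑ W = ∀ e → W ! e ≡ zer → U ! e ≡ zer

  ⊑-∘ˡ : ∀ (X Y : SV n) → X ⊑ X ∘ᵛ Y
  ⊑-∘ˡ X Y e h = proj₁ (comp-zer⁻ (trans (sym (∘! X Y e)) h))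

  ⊑-∘ʳ : ∀ (X Y : SV n) → Y ⊑ X ∘ᵛ Y
  ⊑-∘ʳ X Y e h = proj₂ (comp-zer⁻ {X ! e} (trans (sym (∘! X Y e)) h))

  ∘-zer : ∀ {X Y : SV n} {e} → X ! e ≡ zer → Y ! e ≡ zer → (X ∘ᵛ Y) ! e ≡ zer
  ∘-zer {X} {Y} {e} p q = trans (∘! X Y e) (trans (cong₂ comp p q) refl)

  ∘-left : ∀ {X Y : SV n} {e} → X ! e ≡ zer → (X ∘ᵛ Y) ! e ≡ Y ! e
  ∘-left {X} {Y} {e} p = trans (∘! X Y e) (cong (λ s → comp s (Y ! e)) p)

  ∘-nzˡ : ∀ {X Y : SV n} {e} → X ! e ≢ zer → (X ∘ᵛ Y) ! e ≢ zer
  ∘-nzˡ {X} {Y} {e} h = h ∘ ⊑-∘ˡ X Y e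

  ∘-nzʳ : ∀ {X Y : SV n} {e} → Y ! e ≢ zer → (X ∘ᵛ Y) ! e ≢ zer
  ∘-nzʳ {X} {Y} {e} h = h ∘ ⊑-∘ʳ X Y e

  ∘-⊑ : ∀ {X Y T : SV n} → X ⊑ T → Y ⊑ T → X ∘ᵛ Y ⊑ T
  ∘-⊑ {X} {Y} p q e h = ∘-zer {X} {Y} (p e h) (q e h)

  ∘-comm-⊑ : ∀ (X Y : SV n) → X ∘ᵛ Y ⊑ Y ∘ᵛ X
  ∘-comm-⊑ X Y = ∘-⊑ {X} {Y} {Y ∘ᵛ X} (⊑-∘ʳ Y X) (⊑-∘ˡ Y X)

  neg-⊑ : ∀ (X : SV n) → - X ᵛ ⊑ X
  neg-⊑ X e h = trans (-! X e) (cong opp h)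

  ⊑-neg : ∀ (X : SV n) → X ⊑ - X ᵛ
  ⊑-neg X e h = opp-zer⁻ (trans (sym (-! X e)) h)

  ≼⇒⊑ : ∀ {X Y : SV n} → X ≼ Y → X ⊑ Y
  ≼⇒⊑ p e h with p e
  ... | inj₁ q = q
  ... | inj₂ q = trans q h

  ≼-nz : ∀ {X Y : SV n} {e} → X ≼ Y → X ! e ≢ zer → X ! e ≡ Y ! e
  ≼-nz {e = e} p h with p e
  ... | inj₁ q = ⊥-elim (h q)
  ... | inj₂ q = q

  -- Z is the result of eliminating g from −X and Y.
  record Diff (g : Fin n) (X Y Z : SV n) : Set where
    constructor mkDiff
    field
      at  : Z ! g ≡ zer
      off : ∀ e → X ! e ≢ Y ! e → Z ! e ≡ comp (opp (X ! e)) (Y ! e)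
      zz  : ∀ e → X ! e ≡ zer → Y ! e ≡ zer → Z ! e ≡ zer

    left : ∀ e → X ! e ≡ zer → Z ! e ≡ Y ! e
    left e h with X ! e ≟ₛ Y ! e
    ... | yes q = trans (zz e h (trans (sym q) h)) (trans (sym h) q)
    ... | no q = trans (off e q) (cong (λ s → comp (opp s) (Y ! e)) h)

    right : ∀ e → Y ! e ≡ zer → Z ! e ≡ opp (X ! e)
    right e h with X ! e ≟ₛ Y ! e
    ... | yes q = trans (zz e (trans q h) h) (sym (cong opp (trans q h)))
    ... | no q = trans (off e q) (trans (cong (comp (opp (X ! e))) h) (comp-zerʳ _))

    same : ∀ e → Z ! e ≡ zer → X ! e ≡ Y ! e
    same e h with X ! e ≟ₛ Y ! e
    ... | yes q = q
    ... | no q with comp-zer⁻ {opp (X ! e)} (trans (sym (off e q)) h)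
    ... | p₁ , p₂ = trans (opp-zer⁻ p₁) (sym p₂)

    below : Z ⊑ X ∘ᵛ Y
    below e h = zz e (⊑-∘ˡ X Y e h) (⊑-∘ʳ X Y e h)

  open Diff public

  Diff-rev : ∀ {g} {X Y Z : SV n} → Diff g X Y Z → Diff g Y X (- Z ᵛ)
  Diff-rev {g} {X} {Y} {Z} d = mkDiff
    (trans (-! Z g) (cong opp (at d)))
    (λ e h → trans (-! Z e) (trans (cong opp (off d e (h ∘ sym))) (swap (X ! e) (Y ! e) (h ∘ sym))))
    (λ e p q → trans (-! Z e) (cong opp (zz d e q p)))
    where
    swap : ∀ s t → s ≢ t → opp (comp (opp s) t) ≡ comp (opp t) s
    swap pos pos h = ⊥-elim (h refl)
    swap pos neg h = refl
    swap pos zer h = refl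
    swap neg pos h = refl
    swap neg neg h = ⊥-elim (h refl)
    swap neg zer h = refl
    swap zer pos h = refl
    swap zer neg h = refl
    swap zer zer h = refl

  Diff-neg : ∀ {g} {X Y Z : SV n} → Diff g X Y Z → Diff g (- X ᵛ) (- Y ᵛ) (- Z ᵛ)
  Diff-neg {g} {X} {Y} {Z} d = mkDiff
    (trans (-! Z g) (cong opp (at d)))
    (λ e h → trans (-! Z e) (trans (cong opp (off d e (λ q → h (trans (-! X e) (trans (cong opp q)
          (sym (-! Y e)))))))
      (trans (push (opp (X ! e)) (Y ! e)) (sym (cong₂ (λ s t → comp (opp s) t) (-! X e) (-! Y e))))))
    (λ e p q → trans (-! Z e) (cong opp (zz d e (⊑-neg X e p) (⊑-neg Y e q))))
    where
    push : ∀ s t → opp (comp s t) ≡ comp (opp s) (opp t)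
    push pos t = refl
    push neg t = refl
    push zer t = refl

  diff : ∀ (O : OM n) g {X Y} → Cov O X → Cov O Y → X ! g ≡ Y ! g → X ! g ≢ zer →
    ∃ λ Z → Cov O Z × Diff g X Y Z
  diff O g {X} {Y} cX cY p nz with L3 O g (L1 O cX) cY (subst (λ s → Opposite s (Y ! g)) (sym (-! X g))
        (opposite (X ! g) (Y ! g) p nz))
    where
    opposite : ∀ s t → s ≡ t → s ≢ zer → Opposite (opp s) t
    opposite pos _ refl _ = inj₂ (refl , refl)
    opposite neg _ refl _ = inj₁ (refl , refl)
    opposite zer _ _ h = ⊥-elim (h refl)
  ... | Z , cZ , Zg , rest = Z , cZ , mkDiff Zg
      (λ e h → trans (rest e (h ∘ unsep e)) (trans (∘! (- X ᵛ) Y e) (cong (λ s → comp s (Y ! e)) (-! X e))))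
      (λ e p q → trans (rest e (λ i → unsep-nz e i p))
                       (∘-zer {X = - X ᵛ} {Y} (neg-⊑ X e p) q))
    where
    unopp : ∀ s t → Opposite (opp s) t → s ≡ t × s ≢ zer
    unopp pos .neg (inj₁ (() , refl))
    unopp neg .neg (inj₁ (refl , refl)) = refl , λ ()
    unopp zer .neg (inj₁ (() , refl))
    unopp pos .pos (inj₂ (refl , refl)) = refl , λ ()
    unopp neg .pos (inj₂ (() , refl))
    unopp zer .pos (inj₂ (() , refl))
    unsep : ∀ e → InSep (- X ᵛ) Y e → X ! e ≡ Y ! e
    unsep e i = proj₁ (unopp _ _ (subst (λ s → Opposite s (Y ! e)) (-! X e) i))
    unsep-nz : ∀ e → InSep (- X ᵛ) Y e → X ! e ≢ zer
    unsep-nz e i = proj₂ (unopp _ _ (subst (λ s → Opposite s (Y ! e)) (-! X e) i))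

  -- Whichever sign `U` has at `g`, either `U` or its negative agrees there with `X`. Only the
  -- entries at zeros of `U` are recorded: they are independent of this choice, and they are what
  -- identifies a point on a line.
  cancel : ∀ (O : OM n) g {U X} → Cov O U → Cov O X → U ! g ≢ zer → X ! g ≢ zer →
    ∃ λ N → Cov O N × N ! g ≡ zer × (∀ e → U ! e ≡ zer → N ! e ≡ X ! e)
  cancel O g {U} {X} cU cX Ug Xg with ±-split Ug Xg
  ... | inj₁ eq with diff O g cU cX eq Ug
  ... | N , cN , d = N , cN , at d , left d
  cancel O g {U} {X} cU cX Ug Xg | inj₂ eq
    with diff O g (L1 O cU) cX (trans (-! U g) (trans (cong opp eq) (opp-opp _))) (λ h → Ug (⊑-neg U g h))
  ... | N , cN , d = N , cN , at d , λ e h → left d e (neg-⊑ U e h)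

  -- Ht O m W: a chain of covectors with strictly decreasing supports starting
  -- at W has at most m further members, i.e. z(W) has corank at most m.
  Ht : OM n → ℕ → SV n → Set
  Ht O zero W = ∀ e → W ! e ≡ zer
  Ht O (suc m) W = ∀ U → Cov O U → U ⊑ W → ∀ e → U ! e ≡ zer → W ! e ≢ zer → Ht O m U

  Ht-mono : ∀ (O : OM n) m U W → U ⊑ W → Ht O m W → Ht O m U
  Ht-mono O zero _ _ p h e = p e (h e)
  Ht-mono O (suc m) _ _ p h U c q e u w = h U c (λ i → q i ∘ p i) e u (w ∘ p e)

  Rank : OM n → ℕ → Set
  Rank O m = ∀ {X} → Cov O X → Ht O m X

  -- Contraction with the ground set kept: the elements of `A` become loops. All lines and planes
  -- thus live over the same `Fin n`, and covectors need no reindexing.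
  contract : OM n → (Fin n → Set) → OM n
  contract O A = record
    { Cov = λ X → Cov O X × (∀ e → A e → X ! e ≡ zer)
    ; L0 = L0 O , λ e _ → zeroV! e
    ; L1 = λ { {X} (c , h) → L1 O c , λ e i → neg-⊑ X e (h e i) }
    ; L2 = λ { {X} {Y} (c , h) (c' , h') → L2 O c c' , λ e i → ∘-zer {X} {Y} (h e i) (h' e i) }
    ; L3 = λ { {X} {Y} e (c , h) (c' , h') s → elim {X} {Y} e c h c' h' s } }
    where
    nosep : ∀ {s t} → s ≡ zer → ¬ Opposite s t
    nosep refl (inj₁ (() , _))
    nosep refl (inj₂ (() , _))
    elim : ∀ {X Y} e → Cov O X → (∀ i → A i → X ! i ≡ zer) → Cov O Y → (∀ i → A i → Y ! i ≡ zer) → InSep X Y e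
          →
      ∃ λ Z → (Cov O Z × (∀ i → A i → Z ! i ≡ zer)) × Z ! e ≡ zer × (∀ f → ¬ InSep X Y f → Z ! f ≡ (X ∘ᵛ Y) !
            f)
    elim {X} {Y} e c h c' h' s with L3 O e c c' s
    ... | Z , cZ , z , r = Z , (cZ , λ i ai → trans (r i (nosep (h i ai))) (∘-zer {X} {Y} (h i ai) (h' i ai)))
          , z , r

  infixl 7 _↓_ _/_
  -- Contracting the zero set of `T` leaves the covectors supported inside `T`. For `T` the
  -- composition of the two ends of an edge this is the line, or the plane, that carries the edge.
  _↓_ : OM n → SV n → OM n
  O ↓ T = contract O (λ e → T ! e ≡ zer)

  _/_ : OM n → Fin n → OM n
  O / a = contract O (_≡ a)

  in/ : ∀ (O : OM n) {a X} → Cov O X → X ! a ≡ zer → Cov (O / a) X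
  in/ O c h = c , λ { _ refl → h }

  Ht-contract⁺ : ∀ (O : OM n) A m {W} → Ht O m W → Ht (contract O A) m W
  Ht-contract⁺ O A zero h = h
  Ht-contract⁺ O A (suc m) h U (c , _) p e u w = Ht-contract⁺ O A m (h U c p e u w)

  Ht-contract⁻ : ∀ (O : OM n) A m {W} → (∀ e → A e → W ! e ≡ zer) → Ht (contract O A) m W → Ht O m W
  Ht-contract⁻ O A zero _ h = h
  Ht-contract⁻ O A (suc m) q h U c p e u w =
    Ht-contract⁻ O A m (λ e i → p e (q e i)) (h U (c , λ e i → p e (q e i)) p e u w)

  Rank-↓ : ∀ (O : OM n) m T → Ht O m T → Rank (O ↓ T) m
  Rank-↓ O m T h {X} (_ , p) = Ht-contract⁺ O _ m (Ht-mono O m X T p h)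

  Rank-/ : ∀ (O : OM n) m {C a} → Rank O (suc m) → Cov O C → C ! a ≢ zer → Rank (O / a) m
  Rank-/ O m {C} {a} rk cC nz {X} (cX , h) =
    Ht-contract⁺ O _ m (rk (L2 O cX cC) X cX (⊑-∘ˡ X C) a (h a refl) (∘-nzʳ {X} {C} nz))

  -- Eliminating `u` between `X` and `Y`, or its negative, leaves a covector below `T` that vanishes
  -- at `u`, where `T` does not; it is therefore zero, so nothing tells the two apart. The case `X`
  -- zero is the multiple `zer`.
  point-unique : ∀ (O : OM n) {T X Y u} → Ht O 1 T → Cov O X → X ⊑ T → Cov O Y → Y ⊑ T → Y ! u ≢ zer →
    ∃ λ τ → ∀ f → X ! f ≡ mul τ (Y ! f)
  point-unique O {T} {X} {Y} {u} ht cX pX cY pY nz with X ! u ≟ₛ zer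
  ... | yes z = zer , ht X cX pX u z (nz ∘ pY u)
  ... | no nz' with ±-split nz' nz
  ... | inj₁ eq = pos , equal cY pY eq
    where
    equal : ∀ {Y} → Cov O Y → Y ⊑ T → X ! u ≡ Y ! u → ∀ f → X ! f ≡ Y ! f
    equal {Y} cY pY eq with diff O u cX cY eq nz'
    ... | Z , cZ , d = λ f → same d f (ht Z cZ (λ e h → zz d e (pX e h) (pY e h)) u (at d)
          (λ h → nz' (pX u h)) f)
  ... | inj₂ eq = neg , λ f → trans (equal (trans eq (sym (-! Y u))) f) (-! Y f)
    where
    equal : X ! u ≡ (- Y ᵛ) ! u → ∀ f → X ! f ≡ (- Y ᵛ) ! f
    equal eq with diff O u cX (L1 O cY) eq nz'
    ... | Z , cZ , d = λ f → same d f (ht Z cZ (λ e h → zz d e (pX e h) (neg-⊑ Y e (pY e h))) u (at d)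
          (λ h → nz' (pX u h)) f)

  -- The covector `C` shows that `e` is no loop, so contracting `e` takes the line to rank 1: a line
  -- meets `e` in one point up to sign.
  line-unique : ∀ (K : OM n) {C X Y e u} → Rank K 2 → Cov K C → C ! e ≢ zer →
    Cov K X → X ! e ≡ zer → Cov K Y → Y ! e ≡ zer → Y ! u ≢ zer → ∃ λ τ → ∀ f → X ! f ≡ mul τ (Y ! f)
  line-unique K {C} {X} {Y} {e} rk cC nz cX zX cY zY =
    point-unique (K / e) {X ∘ᵛ Y} (Rank-/ K 1 rk cC nz (L2 (K / e) (in/ K cX zX) (in/ K cY zY)))
      (in/ K cX zX) (⊑-∘ˡ X Y) (in/ K cY zY) (⊑-∘ʳ X Y)

  -- On a line, two elements vanishing at a common point are proportional.
  cross : ∀ (K : OM n) {W u a f X Y} → Rank K 2 → Cov K W → W ! u ≢ zer → W ! a ≡ zer → W ! f ≡ zer →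
    Cov K X → Cov K Y → mul (X ! f) (Y ! a) ≡ mul (Y ! f) (X ! a)
  cross K {W} {u} {a} {f} {X} {Y} rk cW nz Wa Wf cX cY = go (X ! a ≟ₛ zer) (Y ! a ≟ₛ zer)
    where
    vanish : ∀ {C Q} → Cov K C → C ! a ≢ zer → Cov K Q → Q ! a ≡ zer → Q ! f ≡ zer
    vanish cC Ca cQ Qa with line-unique K rk cC Ca cQ Qa cW Wa nz
    ... | τ , h = trans (h f) (trans (cong (mul τ) Wf) (mul-zerʳ τ))
    equal : ∀ {Y} → Cov K Y → X ! a ≢ zer → X ! a ≡ Y ! a → X ! f ≡ Y ! f
    equal cY na eq with diff K a cX cY eq na
    ... | Z , cZ , d = same d f (vanish cX na cZ (at d))
    go : Dec (X ! a ≡ zer) → Dec (Y ! a ≡ zer) → mul (X ! f) (Y ! a) ≡ mul (Y ! f) (X ! a)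
    go (yes p) (yes q) = trans (cong (mul (X ! f)) q) (trans (mul-zerʳ (X ! f))
          (sym (trans (cong (mul (Y ! f)) p) (mul-zerʳ (Y ! f)))))
    go (yes p) (no q) = trans (cong (λ s → mul s (Y ! a)) (vanish cY q cX p))
          (sym (trans (cong (mul (Y ! f)) p) (mul-zerʳ (Y ! f))))
    go (no p) (yes q) = trans (trans (cong (mul (X ! f)) q) (mul-zerʳ (X ! f)))
          (sym (cong (λ s → mul s (X ! a)) (vanish cX p cY q)))
    go (no p) (no q) with ±-split p q
    ... | inj₁ eq = cong₂ mul (equal cY p eq) (sym eq)
    ... | inj₂ eq = trans (cong₂ mul (trans (equal (L1 K cY) p (trans eq (sym (-! Y a)))) (-! Y f))
          (trans (sym (opp-opp (Y ! a))) (cong opp (sym eq))))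
        (trans (mul-oppˡ (Y ! f) (opp (X ! a))) (trans (cong opp (mul-oppʳ (Y ! f) (X ! a))) (opp-opp _)))

-- Monotone walks

Up : {A : Set} → (Sign → A → A → Set) → Sign → A → A → Set
Up R δ u v = ∃ λ d → (d ≡ zer ⊎ d ≡ δ) × R d u v

-- The strict step is singled out as the one that closes the walk; a closed walk with a strict step
-- can always be rotated into this form.
Acyclic : {A : Set} → (Sign → A → A → Set) → Set
Acyclic R = ∀ {δ} → δ ≢ zer → ∀ {x y} → Star (Up R δ) x y → R δ y x → ⊥

-- A closed walk on which LE never drops is never strictly increasing.
refine : {A : Set} {R S : Sign → A → A → Set} {δ : Sign} (LE LT : A → A → Set) →
  (∀ {u} → LE u u) → (∀ {u v w} → LE u v → LE v w → LE u w) → (∀ {u v} → LT u v → LE u v) →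
  (∀ {u v} → LT u v → LE v u → ⊥) →
  (∀ {d u v} → d ≡ zer ⊎ d ≡ δ → R d u v → (LE u v × S d u v) ⊎ LT u v) →
  ∀ {x y} → Star (Up R δ) x y → R δ y x → Star (Up S δ) x y × S δ y x
refine {A} {R} {S} {δ} LE LT rfl tr lt⇒le irr cls {x} {y} p r = proj₁ (walk rfl p) , last (cls (inj₂ refl) r)
  where
  le : ∀ {d u v} → d ≡ zer ⊎ d ≡ δ → R d u v → LE u v
  le h s with cls h s
  ... | inj₁ (q , _) = q
  ... | inj₂ q = lt⇒le q
  walk : ∀ {u} → LE x u → Star (Up R δ) u y → Star (Up S δ) u y × LE u y
  walk q ε = ε , rfl
  walk q ((d , h , s) ◅ ss) with walk (tr q (le h s)) ss | cls h s
  ... | ss' , t | inj₁ (a , s') = (d , h , s') ◅ ss' , tr a t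
  ... | ss' , t | inj₂ a = ⊥-elim (irr a (tr t (tr (le (inj₂ refl) r) q)))
  last : (LE y x × S δ y x) ⊎ LT y x → S δ y x
  last (inj₁ (_ , s)) = s
  last (inj₂ a) = ⊥-elim (irr a (proj₂ (walk rfl p)))

-- The order −δ < 0 < δ on signs.
Le : Sign → Sign → Sign → Set
Le δ s t = s ≡ t ⊎ s ≡ opp δ ⊎ t ≡ δ

Le-trans : ∀ {δ s t u} → δ ≢ zer → Le δ s t → Le δ t u → Le δ s u
Le-trans _ (inj₁ refl) q = q
Le-trans _ (inj₂ (inj₁ p)) _ = inj₂ (inj₁ p)
Le-trans _ p@(inj₂ (inj₂ _)) (inj₁ refl) = p
Le-trans nz (inj₂ (inj₂ refl)) (inj₂ (inj₁ q)) = ⊥-elim (nz (opp-fix q))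
Le-trans _ (inj₂ (inj₂ _)) (inj₂ (inj₂ q)) = inj₂ (inj₂ q)

Le-antisym : ∀ {δ s t} → δ ≢ zer → Le δ s t → Le δ t s → s ≡ t
Le-antisym _ (inj₁ p) _ = p
Le-antisym _ _ (inj₁ q) = sym q
Le-antisym _ (inj₂ (inj₁ p)) (inj₂ (inj₁ q)) = trans p (sym q)
Le-antisym nz (inj₂ (inj₁ p)) (inj₂ (inj₂ q)) = ⊥-elim (nz (opp-fix (trans (sym q) p)))
Le-antisym nz (inj₂ (inj₂ p)) (inj₂ (inj₁ q)) = ⊥-elim (nz (opp-fix (trans (sym p) q)))
Le-antisym _ (inj₂ (inj₂ p)) (inj₂ (inj₂ q)) = trans q (sym p)

constant : {A : Set} {R : Sign → A → A → Set} {δ : Sign} → δ ≢ zer → (ψ : A → Sign) →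
  (∀ {d u v} → d ≡ zer ⊎ d ≡ δ → R d u v → Le δ (ψ u) (ψ v)) →
  ∀ {x y} → Star (Up R δ) x y → R δ y x →
  Star (Up (λ d u v → R d u v × ψ u ≡ ψ v) δ) x y × (R δ y x × ψ y ≡ ψ x)
constant {R = R} {δ} nz ψ mono = refine (λ u v → Le δ (ψ u) (ψ v)) (λ u v → Le δ (ψ u) (ψ v) × ψ u ≢ ψ v)
  (inj₁ refl) (Le-trans nz) proj₁ (λ { (p , ne) q → ne (Le-antisym nz p q) }) cls
  where
  cls : ∀ {d u v} → d ≡ zer ⊎ d ≡ δ → R d u v →
    (Le δ (ψ u) (ψ v) × R d u v × ψ u ≡ ψ v) ⊎ (Le δ (ψ u) (ψ v) × ψ u ≢ ψ v)
  cls {u = u} {v} h r with ψ u ≟ₛ ψ v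
  ... | yes p = inj₁ (mono h r , r , p)
  ... | no p = inj₂ (mono h r , p)

module _ {n : ℕ} where

  -- Where `X` and `Y` differ at `f`, the entry of `Z` is `opp (X ! f)` or, if that is zero,
  -- `Y ! f`. It is then nonzero, hence δ, which puts `X` at the bottom or `Y` at the top of the
  -- order.
  Diff-mono : ∀ {g} {X Y Z : SV n} {δ} f → Diff g X Y Z → Z ! f ≡ zer ⊎ Z ! f ≡ δ → Le δ (X ! f) (Y ! f)
  Diff-mono {X = X} {Y} {Z} {δ} f d h with X ! f ≟ₛ Y ! f
  ... | yes p = inj₁ p
  ... | no p = inj₂ (go (X ! f) (Y ! f) p (subst (λ s → s ≡ zer ⊎ s ≡ δ) (off d f p) h))
    where
    go : ∀ s t → s ≢ t → comp (opp s) t ≡ zer ⊎ comp (opp s) t ≡ δ → s ≡ opp δ ⊎ t ≡ δ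
    go pos t _ (inj₂ refl) = inj₁ refl
    go neg t _ (inj₂ refl) = inj₁ refl
    go zer t ne (inj₁ q) = ⊥-elim (ne (sym q))
    go zer t _ (inj₂ q) = inj₂ q

  line-same : ∀ (K : OM n) {C X Y e u} → Rank K 2 → Cov K C → C ! e ≢ zer →
    Cov K X → X ! e ≡ zer → Cov K Y → Y ! e ≡ zer → Y ! u ≢ zer → X ! u ≡ Y ! u → ∀ f → X ! f ≡ Y ! f
  line-same K {Y = Y} {u = u} rk cC nz cX zX cY zY nu eq with line-unique K rk cC nz cX zX cY zY nu
  ... | τ , h with mul-fix {τ} nu (trans (sym eq) (h u))
  ... | refl = h

  -- The edge from X to Y in the program (O,g,f) has direction d; X and Y need not be conformal.
  record Step (O : OM n) (g f : Fin n) (d : Sign) (X Y : SV n) : Set where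
    constructor mkStep
    field
      cX   : Cov O X
      cY   : Cov O Y
      hX   : Ht O 1 X
      hY   : Ht O 1 Y
      gX   : X ! g ≢ zer
      gXY  : X ! g ≡ Y ! g
      line : Ht O 2 (X ∘ᵛ Y)
      Z    : SV n
      cZ   : Cov O Z
      dZ   : Diff g X Y Z
      dir  : Z ! f ≡ d

    gY : Y ! g ≢ zer
    gY h = gX (trans gXY h)

  CStep : OM n → Fin n → Fin n → Sign → SV n → SV n → Set
  CStep O g f d X Y = Step O g f d X Y × Conformal X Y × X ≢ Y

  NoCycle : OM n → Set
  NoCycle O = ∀ g f → Acyclic (Step O g f)

  NoConformalCycle : OM n → Set
  NoConformalCycle O = ∀ g f → Acyclic (CStep O g f)

  Step-rev : ∀ {O g f d X Y} → Step O g f d X Y → Step O g f (opp d) Y X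
  Step-rev {O} {g} {f} {d} {X} {Y} s = mkStep cY cX hY hX gY (sym gXY)
      (Ht-mono O 2 (Y ∘ᵛ X) (X ∘ᵛ Y) (∘-comm-⊑ Y X) line) (- Z ᵛ) (L1 O cZ) (Diff-rev dZ)
      (trans (-! Z f) (cong opp dir))
    where open Step s

  Step-neg : ∀ {O g f d X Y} → Step O g f d X Y → Step O g f (opp d) (- X ᵛ) (- Y ᵛ)
  Step-neg {O} {g} {f} {d} {X} {Y} s = mkStep (L1 O cX) (L1 O cY)
      (Ht-mono O 1 (- X ᵛ) X (neg-⊑ X) hX) (Ht-mono O 1 (- Y ᵛ) Y (neg-⊑ Y) hY)
      (λ h → gX (⊑-neg X g h)) (trans (-! X g) (trans (cong opp gXY) (sym (-! Y g))))
      (Ht-mono O 2 (- X ᵛ ∘ᵛ - Y ᵛ) (X ∘ᵛ Y) (λ e h → ∘-zer {X = - X ᵛ} { - Y ᵛ} (neg-⊑ X e (⊑-∘ˡ X Y e h))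
            (neg-⊑ Y e (⊑-∘ʳ X Y e h))) line)
      (- Z ᵛ) (L1 O cZ) (Diff-neg dZ) (trans (-! Z f) (cong opp dir))
    where open Step s

  -- A support inside that of a point forces proportionality. The element `e` of the first
  -- alternative later fixes the signs of eliminants, since `Diff` prescribes their value at a zero
  -- of `X`.
  separate : ∀ (O : OM n) {X Y u} → Cov O X → Ht O 1 X → Cov O Y → X ! u ≢ zer →
    (∃ λ e → X ! e ≡ zer × Y ! e ≢ zer) ⊎ (∃ λ τ → ∀ e → Y ! e ≡ mul τ (X ! e))
  separate O {X} {Y} cX hX cY nz with any? (λ e → (X ! e ≟ₛ zer) ×-dec ¬? (Y ! e ≟ₛ zer))
  ... | yes p = inj₁ p
  ... | no np = inj₂ (point-unique O {X} {Y} {X} hX cY below' cX (λ _ h → h) nz)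
    where
    below' : Y ⊑ X
    below' e h with Y ! e ≟ₛ zer
    ... | yes q = q
    ... | no q = ⊥-elim (np (e , h , q))

  splitter : ∀ (O : OM n) {X Y g} → Cov O X → Ht O 1 X → Cov O Y → X ! g ≢ zer → X ! g ≡ Y ! g →
    (∃ λ e → X ! e ≡ zer × Y ! e ≢ zer) ⊎ (∀ e → X ! e ≡ Y ! e)
  splitter O {X} {Y} {g} cX hX cY nz eq with separate O {X} {Y} cX hX cY nz
  ... | inj₁ p = inj₁ p
  ... | inj₂ (τ , h) with mul-fix {τ} nz (trans eq (h g))
  ... | refl = inj₂ (λ e → sym (h e))

  module Line {O : OM n} {g f d X Y} (s : Step O g f d X Y) where
    open Step s

    K : OM n
    K = O ↓ (X ∘ᵛ Y)

    rkK : Rank K 2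
    rkK = Rank-↓ O 2 (X ∘ᵛ Y) line

    kX : Cov K X
    kX = cX , ⊑-∘ˡ X Y

    kY : Cov K Y
    kY = cY , ⊑-∘ʳ X Y

    kZ : Cov K Z
    kZ = cZ , below dZ

    split : (∃ λ e → X ! e ≡ zer × Y ! e ≢ zer) ⊎ (∀ e → X ! e ≡ Y ! e)
    split = splitter O cX hX cY gX gXY

    Z-unique : ∀ {N e} → Cov K N → N ! g ≡ zer → X ! e ≡ zer → Y ! e ≢ zer → N ! e ≡ Y ! e → ∀ i → N ! i ≡ Z !
          i
    Z-unique {e = e} kN Ng Xe Ye Ne = line-same K rkK kX gX kN Ng kZ (at dZ)
      (λ h → Ye (trans (sym (left dZ e Xe)) h)) (trans Ne (sym (left dZ e Xe)))

    Z-unique′ : ∀ {N e} → Cov K N → N ! g ≡ zer → Y ! e ≡ zer → X ! e ≢ zer → N ! e ≡ opp (X ! e) → ∀ i → N !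
          i ≡ Z ! i
    Z-unique′ {e = e} kN Ng Ye Xe Ne = line-same K rkK kX gX kN Ng kZ (at dZ)
      (λ h → opp-nz Xe (trans (sym (right dZ e Ye)) h)) (trans Ne (sym (right dZ e Ye)))

    Z-zero : (∀ e → X ! e ≡ Y ! e) → ∀ e → Z ! e ≡ zer
    Z-zero eq = hX Z cZ (λ e h → zz dZ e h (trans (sym (eq e)) h)) g (at dZ) gX

  -- The direction does not depend on the eliminant: both are points of one line on `g`, and a zero
  -- of `X` off `Y` gives them the same sign. If `X` and `Y` agree everywhere, both eliminants
  -- vanish.
  Step-dir : ∀ {O g f d X Y N} → Step O g f d X Y → Cov O N → Diff g X Y N → N ! f ≡ d
  Step-dir {O} {g} {f} {d} {X} {Y} {N} s cN dN with Line.split s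
  ... | inj₁ (e , p , q) = trans (Line.Z-unique s (cN , below dN) (at dN) p q (left dN e p) f) (Step.dir s)
  ... | inj₂ eq = trans (Step.hX s N cN (λ e h → zz dN e h (trans (sym (eq e)) h)) g (at dN) (Step.gX s) f)
                        (trans (sym (Line.Z-zero s eq f)) (Step.dir s))

  swap₀ : ∀ {O g f X Y} → Step O g f zer X Y → X ! f ≢ zer → X ! f ≡ Y ! f → Step O f g zer X Y
  swap₀ {O} {g} {f} {X} {Y} s nf eq with diff (Line.K s) f (Line.kX s) (Line.kY s) eq nf
  ... | Z' , kZ' , dZ' = mkStep cX cY hX hY nf eq line Z' (proj₁ kZ') dZ' (go split)
    where
    open Step s
    open Line s
    go : (∃ λ e → X ! e ≡ zer × Y ! e ≢ zer) ⊎ (∀ e → X ! e ≡ Y ! e) → Z' ! g ≡ zer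
    go (inj₁ (e , p , q)) with line-unique K rkK kX nf kZ' (at dZ') kZ dir (λ h → q (trans (sym (left dZ e p))
          h))
    ... | τ , h = trans (h g) (trans (cong (mul τ) (at dZ)) (mul-zerʳ τ))
    go (inj₂ eq') = hX Z' (proj₁ kZ') (λ e h → zz dZ' e h (trans (sym (eq' e)) h)) f (at dZ') nf g

  -- Here `X` and `Z` agree at `f`, so `f` can be eliminated between them. The resulting `N` has
  -- entry `opp (X ! g)` at `g`, where `Z` vanishes, and it equals `Z'` because both are points on
  -- `f` with the same entry at `e`.
  swap₁ : ∀ {O g f d X Y} → Step O g f d X Y → X ! f ≢ zer → X ! f ≡ Y ! f → d ≡ X ! f → Step O f g
        (opp (X ! g)) X Y
  swap₁ {O} {g} {f} {d} {X} {Y} s nf eq df with diff (Line.K s) f (Line.kX s) (Line.kY s) eq nf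
  ... | Z' , kZ' , dZ' = mkStep cX cY hX hY nf eq line Z' (proj₁ kZ') dZ' (go split)
    where
    open Step s
    open Line s
    go : (∃ λ e → X ! e ≡ zer × Y ! e ≢ zer) ⊎ (∀ e → X ! e ≡ Y ! e) → Z' ! g ≡ opp (X ! g)
    go (inj₂ eq') = ⊥-elim (nf (trans (sym df) (trans (sym dir) (Z-zero eq' f))))
    go (inj₁ (e , p , q)) with diff K f kX kZ (trans (sym df) (sym dir)) nf
    ... | N , kN , dN = trans (line-same K rkK kX nf kZ' (at dZ') kN (at dN)
            (λ h → q (trans (sym (trans (left dN e p) (left dZ e p))) h))
            (trans (left dZ' e p) (sym (trans (left dN e p) (left dZ e p)))) g)
          (right dN g (at dZ))

  -- Where f and g keep nonzero signs, f/g and g/f move in opposite directions, up to the product of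
  -- the two signs.
  swap : ∀ {O g f d X Y} → Step O g f d X Y → X ! f ≢ zer → X ! f ≡ Y ! f →
    Step O f g (opp (mul (mul (X ! g) (X ! f)) d)) X Y
  swap {O} {g} {f} {d} {X} {Y} s nf eq with d ≟ₛ zer
  ... | yes refl = subst (λ t → Step O f g t X Y) (sym (cong opp (mul-zerʳ (mul (X ! g) (X ! f)))))
        (swap₀ s nf eq)
  ... | no nd with ±-split nd nf
  ... | inj₁ p = subst (λ t → Step O f g t X Y)
          (cong opp (trans (sym (trans (cong (mul (X ! g)) (trans (cong (mul (X ! f)) p) (self nf)))
                (trans (mul-comm (X ! g) pos) refl)))
            (sym (mul-assoc (X ! g) (X ! f) d))))
          (swap₁ s nf eq p)
    where
    self : ∀ {s} → s ≢ zer → mul s s ≡ pos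
    self {pos} _ = refl
    self {neg} _ = refl
    self {zer} h = ⊥-elim (h refl)
  -- When `d` is opposite to `X ! f`, the reversed edge meets the hypothesis of `swap₁`.
  ... | inj₂ p = subst (λ t → Step O f g t X Y)
          (trans (opp-opp _) (trans (sym gXY) (calc (X ! g) (X ! f) d nf p)))
          (Step-rev (swap₁ (Step-rev s) (λ h → nf (trans eq h)) (sym eq) (trans (cong opp p)
                (trans (opp-opp _) eq))))
    where
    open Step s
    calc : ∀ u v d → v ≢ zer → d ≡ opp v → u ≡ opp (mul (mul u v) d)
    calc pos pos _ _ refl = refl
    calc pos neg _ _ refl = refl
    calc neg pos _ _ refl = refl
    calc neg neg _ _ refl = refl
    calc zer _ _ _ _ = refl
    calc _ zer _ h _ = ⊥-elim (h refl)

  -- Eliminating `e` gives a point `C` of the line between `X` and `Y`. Both halves meet `g` in the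
  -- same signed point as the whole edge, so its direction is inherited. Each half is separated only
  -- where the whole edge is, and no longer at `e`, which makes the subdivision terminate.
  bisect : ∀ {O g f d X Y} e → Step O g f d X Y → InSep X Y e →
    ∃ λ C → Step O g f d X C × Step O g f d C Y × C ! e ≡ zer ×
      (∀ i → InSep X C i → InSep X Y i × i ≢ e) × (∀ i → InSep C Y i → InSep X Y i × i ≢ e)
  bisect {O} {g} {f} {d} {X} {Y} e s sp with L3 O e (Step.cX s) (Step.cY s) sp
  ... | C , cC , Ce , offC = C , XC , CY , Ce , sepXC , sepCY
    where
    open Step s
    open Line s
    C⊑ : C ⊑ X ∘ᵛ Y
    C⊑ i h = trans (offC i (λ o → Opposite-nzˡ o (⊑-∘ˡ X Y i h))) h
    hC : Ht O 1 C
    hC = line C cC C⊑ e Ce (∘-nzˡ {X = X} {Y} (Opposite-nzˡ sp))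
    Cg : C ! g ≡ X ! g
    Cg = trans (offC g (Opposite-irrefl gXY)) (trans (∘! X Y g) (comp-nz gX))
    C-left : ∀ i → X ! i ≡ zer → C ! i ≡ Y ! i
    C-left i h = trans (offC i (λ o → Opposite-nzˡ o h)) (∘-left {X = X} {Y} h)
    C-right : ∀ i → Y ! i ≡ zer → C ! i ≡ X ! i
    C-right i h = trans (offC i (λ o → Opposite-nzʳ o h)) (trans (∘! X Y i) (trans (cong (comp (X ! i)) h)
          (comp-zerʳ _)))
    distinct : ¬ (∀ i → X ! i ≡ Y ! i)
    distinct eq = Opposite-irrefl (eq e) sp
    XC : Step O g f d X C
    XC with diff K g kX (cC , C⊑) (sym Cg) gX | split
    ... | N , kN , dN | inj₂ eq = ⊥-elim (distinct eq)
    ... | N , kN , dN | inj₁ (i , p , q) = mkStep cX cC hX hC gX (sym Cg)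
        (Ht-mono O 2 (X ∘ᵛ C) (X ∘ᵛ Y) (∘-⊑ {X = X} {C} {X ∘ᵛ Y} (⊑-∘ˡ X Y) C⊑) line) N (proj₁ kN) dN
        (trans (Z-unique kN (at dN) p q (trans (left dN i p) (C-left i p)) f) dir)
    CY : Step O g f d C Y
    CY with diff K g (cC , C⊑) kY (trans Cg gXY) (λ h → gX (trans (sym Cg) h)) | splitter O cY hY cX gY
          (sym gXY)
    ... | N , kN , dN | inj₂ eq = ⊥-elim (distinct (λ i → sym (eq i)))
    ... | N , kN , dN | inj₁ (i , p , q) = mkStep cC cY hC hY (λ h → gX (trans (sym Cg) h)) (trans Cg gXY)
        (Ht-mono O 2 (C ∘ᵛ Y) (X ∘ᵛ Y) (∘-⊑ {X = C} {Y} {X ∘ᵛ Y} C⊑ (⊑-∘ʳ X Y)) line) N (proj₁ kN) dN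
        (trans (Z-unique′ kN (at dN) p q (trans (right dN i p) (cong opp (C-right i p))) f) dir)
    sepXC : ∀ i → InSep X C i → InSep X Y i × i ≢ e
    sepXC i o with Opposite? (X ! i) (Y ! i)
    ... | yes o' = o' , λ { refl → Opposite-nzʳ o Ce }
    ... | no no' = ⊥-elim (Opposite-irrefl (sym (trans (offC i no') (trans (∘! X Y i)
          (comp-nz (Opposite-nzˡ o))))) o)
    sepCY : ∀ i → InSep C Y i → InSep X Y i × i ≢ e
    sepCY i o with Opposite? (X ! i) (Y ! i)
    ... | yes o' = o' , λ { refl → Opposite-nzˡ o Ce }
    ... | no no' with X ! i ≟ₛ zer
    ... | yes h = ⊥-elim (Opposite-irrefl (C-left i h) o)
    ... | no h = ⊥-elim (Opposite-irrefl (trans (trans (offC i no') (trans (∘! X Y i) (comp-nz h)))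
          (nosep⇒≡ no' h (Opposite-nzʳ o))) o)

  Edges⁺ : (SV n → SV n → Set) → SV n → SV n → Set
  Edges⁺ R X Y = ∃ λ W → R X W × Star R W Y

  conformal-path : ∀ {O g f d X Y} (es : List (Fin n)) → Step O g f d X Y → X ≢ Y → (∀ e → InSep X Y e → e
        List.∈ es) →
    Edges⁺ (CStep O g f d) X Y
  conformal-path {Y = Y} [] s ne h = Y , (s , (λ e o → ∉[] (h e o)) , ne) , ε
    where
    ∉[] : ∀ {e : Fin n} → ¬ (e List.∈ [])
    ∉[] ()
  conformal-path {O} {g} {f} {d} {X} {Y} (e ∷ es) s ne h with Opposite? (X ! e) (Y ! e)
  ... | no no' = conformal-path es s ne (λ i o → rest i o (h i o))
    where
    rest : ∀ i → InSep X Y i → i List.∈ e ∷ es → i List.∈ es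
    rest i o (here refl) = ⊥-elim (no' o)
    rest i o (there m) = m
  ... | yes o with bisect e s o
  ... | C , s₁ , s₂ , Ce , h₁ , h₂
    with conformal-path es s₁ (λ q → Opposite-nzˡ o (subst (λ X → X ! e ≡ zer) (sym q) Ce)) (λ i o' → rest i
          (h₁ i o'))
       | conformal-path es s₂ (λ q → Opposite-nzʳ o (subst (λ X → X ! e ≡ zer) q Ce)) (λ i o' → rest i
             (h₂ i o'))
    where
    rest : ∀ i → InSep X Y i × i ≢ e → i List.∈ es
    rest i (o' , ne) with h i o'
    ... | here eq = ⊥-elim (ne eq)
    ... | there m = m
  ... | W , a , p | W' , b , q = W , a , p ◅◅ (b ◅ q)

  NoConformalCycle⇒NoCycle : ∀ {O : OM n} → NoConformalCycle O → NoCycle O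
  NoConformalCycle⇒NoCycle {O} ncc g f {δ} nz p s with conformal-path (allFin n) s (distinct s)
        (λ e _ → ∈-allFin e)
    where
    distinct : ∀ {X Y} → Step O g f δ X Y → X ≢ Y
    distinct s refl = nz (trans (sym (Step.dir s)) (Line.Z-zero s (λ _ → refl) f))
  ... | W , a , q = ncc g f nz (gmap (λ X → X) (λ r → δ , inj₂ refl , r) q ◅◅ flatten p) a
    where
    flatten : ∀ {X Y} → Star (Up (Step O g f) δ) X Y → Star (Up (CStep O g f) δ) X Y
    flatten ε = ε
    flatten {X} (_◅_ {j = Y} (d , h , s) ss) with ≡-dec _≟ₛ_ X Y
    ... | yes refl = flatten ss
    ... | no ne with conformal-path (allFin n) s ne (λ e _ → ∈-allFin e)
    ... | _ , a , q = (d , h , a) ◅ (gmap (λ X → X) (λ r → d , h , r) q ◅◅ flatten ss)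

-- The extension O[a,b]

-- The entrywise reason why eliminating between M ≼ X and N ≼ Y gives, off the separation of X and
-- Y, a covector that agrees with X ∘ Y up to zeros.
part-comp : ∀ {m x k y} → m ≡ zer ⊎ m ≡ x → k ≡ zer ⊎ k ≡ y → ¬ Opposite x y →
  (¬ Opposite m k) × (comp m k ≡ zer ⊎ comp m k ≡ comp x y)
part-comp (inj₁ refl) (inj₁ refl) h = (λ o → Opposite-nzˡ o refl) , inj₁ refl
part-comp {y = zer} (inj₁ refl) (inj₂ refl) h = (λ o → Opposite-nzˡ o refl) , inj₁ refl
part-comp {x = x} {y = y} (inj₁ refl) (inj₂ refl) h with x ≟ₛ zer
... | yes refl = (λ o → Opposite-nzˡ o refl) , inj₂ refl
... | no nx with y ≟ₛ zer
... | yes q = (λ o → Opposite-nzˡ o refl) , inj₁ q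
... | no ny = (λ o → Opposite-nzˡ o refl) , inj₂ (trans (sym (nosep⇒≡ h nx ny)) (sym (comp-nz nx)))
part-comp {x = x} (inj₂ refl) (inj₁ refl) h with x ≟ₛ zer
... | yes refl = (λ o → Opposite-nzˡ o refl) , inj₁ refl
... | no nx = (λ o → Opposite-nzʳ o refl) , inj₂ (trans (comp-nz nx) (sym (comp-nz nx)))
part-comp (inj₂ refl) (inj₂ refl) h = h , inj₂ refl

module LexExtension {n : ℕ} (O : OM n) (a : Fin n) (α : Sign) (b : Fin n) (β : Sign) where

  A : SV n → Sign
  A X = mul α (X ! a)

  B : SV n → Sign
  B X = mul β (X ! b)

  -- X is infinitesimally close to V, and there a + εb takes every sign.
  record Wit (X : SV n) : Set where
    constructor wit
    field
      V   : SV n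
      cV  : Cov O V
      V≼X : V ≼ X
      AV  : A V ≡ zer
      BV  : B V ≢ zer
      BVX : B V ≡ opp (A X)

  -- Without a witness the lexicographic sign is forced. With one, a + εb has the sign of `A X` on
  -- one side and that of `B V`, its opposite, close to `V`, so p cuts the face of `X` and all three
  -- signs occur on it.
  Val : Sign → SV n → Set
  Val s X = s ≡ comp (A X) (B X) ⊎ Wit X

  Cov′ : SV (suc n) → Set
  Cov′ (s ∷ X) = Cov O X × Val s X

  private
    A∘ : ∀ X Y → A (X ∘ᵛ Y) ≡ comp (A X) (A Y)
    A∘ X Y = trans (cong (mul α) (∘! X Y a)) (mul-comp α (X ! a) (Y ! a))

    B∘ : ∀ X Y → B (X ∘ᵛ Y) ≡ comp (B X) (B Y)
    B∘ X Y = trans (cong (mul β) (∘! X Y b)) (mul-comp β (X ! b) (Y ! b))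

    A- : ∀ X → A (- X ᵛ) ≡ opp (A X)
    A- X = trans (cong (mul α) (-! X a)) (mul-oppʳ α (X ! a))

    B- : ∀ X → B (- X ᵛ) ≡ opp (B X)
    B- X = trans (cong (mul β) (-! X b)) (mul-oppʳ β (X ! b))

    ≼-refl : ∀ (X : SV n) → X ≼ X
    ≼-refl X e = inj₂ refl

    ≼-∘ : ∀ {V X : SV n} Y → V ≼ X → V ≼ (X ∘ᵛ Y)
    ≼-∘ {V} {X} Y p e with p e
    ... | inj₁ q = inj₁ q
    ... | inj₂ q with X ! e ≟ₛ zer
    ... | yes h = inj₁ (trans q h)
    ... | no h = inj₂ (trans q (sym (trans (∘! X Y e) (comp-nz h))))

    Wit-A : ∀ {X} → Wit X → A X ≢ zer
    Wit-A (wit V _ _ _ nz eq) h = nz (trans eq (cong opp h))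

    Wit-∘ : ∀ {X} Y → Wit X → Wit (X ∘ᵛ Y)
    Wit-∘ {X} Y w@(wit V c p q nz eq) =
      wit V c (≼-∘ {V} {X} Y p) q nz (trans eq (cong opp (sym (trans (A∘ X Y) (comp-nz (Wit-A w))))))

    Wit-self : ∀ {X} Y → Cov O X → A X ≡ zer → B X ≢ zer → B X ≡ opp (A Y) → Wit (X ∘ᵛ Y)
    Wit-self {X} Y c h nz eq = wit X c (≼-∘ {X} {X} Y (≼-refl X)) h nz
      (trans eq (cong opp (sym (trans (A∘ X Y) (cong (λ s → comp s (A Y)) h)))))

    Val-neg : ∀ {s X} → Val s X → Val (opp s) (- X ᵛ)
    Val-neg {s} {X} (inj₁ h) = inj₁ (trans (cong opp h) (trans (opp-comp (A X) (B X))
          (sym (cong₂ comp (A- X) (B- X)))))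
    Val-neg {s} {X} (inj₂ (wit V c p q nz eq)) = inj₂ (wit (- V ᵛ) (L1 O c) neg-≼ (trans (A- V) (cong opp q))
        (λ h → nz (opp-zer⁻ (trans (sym (B- V)) h))) (trans (B- V) (trans (cong opp eq)
              (sym (cong opp (A- X))))))
      where
      neg-≼ : (- V ᵛ) ≼ (- X ᵛ)
      neg-≼ e with p e
      ... | inj₁ r = inj₁ (neg-⊑ V e r)
      ... | inj₂ r = inj₂ (trans (-! V e) (trans (cong opp r) (sym (-! X e))))

    -- Three cases matter when `X` has no witness. If `A X` is nonzero it decides. If `X` is on a
    -- but off b, its sign survives, except that `X` becomes a witness when `B X` is opposed to
    -- `A Y`. If `X` is on both, a witness `V` of `Y` turns into `X ∘ᵛ V`.
    Val-comp : ∀ {s t X Y} → Cov O X → Val s X → Cov O Y → Val t Y → Val (comp s t) (X ∘ᵛ Y)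
    Val-comp {s} {t} {X} {Y} cX (inj₂ w) cY _ = inj₂ (Wit-∘ Y w)
    Val-comp {s} {t} {X} {Y} cX (inj₁ refl) cY v with A X ≟ₛ zer
    ... | no h = inj₁ (trans (trans (cong (λ u → comp u t) (comp-nz h)) (comp-nz h))
          (sym (trans (cong (λ u → comp u (B (X ∘ᵛ Y))) (trans (A∘ X Y) (comp-nz h))) (comp-nz h))))
    ... | yes h with B X ≟ₛ zer
    Val-comp {s} {t} {X} {Y} cX (inj₁ refl) cY (inj₁ refl) | yes h | yes k =
      inj₁ (trans (cong (λ u → comp u (comp (A Y) (B Y))) (cong₂ comp h k))
        (sym (cong₂ comp (trans (A∘ X Y) (cong (λ u → comp u (A Y)) h)) (trans (B∘ X Y)
              (cong (λ u → comp u (B Y)) k)))))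
    Val-comp {s} {t} {X} {Y} cX (inj₁ refl) cY (inj₂ (wit V cV p q nz eq)) | yes h | yes k =
      inj₂ (wit (X ∘ᵛ V) (L2 O cX cV) below′ (trans (A∘ X V) (trans (cong₂ comp h q) refl))
        (λ z → nz (trans (sym BV) z))
        (trans BV (trans eq (cong opp (sym (trans (A∘ X Y) (cong (λ u → comp u (A Y)) h)))))))
      where
      BV : B (X ∘ᵛ V) ≡ B V
      BV = trans (B∘ X V) (cong (λ u → comp u (B V)) k)
      below′ : (X ∘ᵛ V) ≼ (X ∘ᵛ Y)
      below′ e with X ! e ≟ₛ zer
      ... | no z = inj₂ (trans (∘! X V e) (trans (comp-nz z) (sym (trans (∘! X Y e) (comp-nz z)))))
      ... | yes z with p e
      ... | inj₁ r = inj₁ (trans (∘-left {X = X} {V} z) r)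
      ... | inj₂ r = inj₂ (trans (∘-left {X = X} {V} z) (trans r (sym (∘-left {X = X} {Y} z))))
    Val-comp {s} {t} {X} {Y} cX (inj₁ refl) cY v | yes h | no k with A Y ≟ₛ zer
    ... | yes ay = inj₁ (trans (cong (λ u → comp u t) (cong (λ u → comp u (B X)) h)) (trans (comp-nz k)
           (sym (trans (cong₂ comp (trans (A∘ X Y) (trans (cong₂ comp h ay) refl)) (trans (B∘ X Y)
                 (comp-nz k))) refl))))
    ... | no ay with ±-split k ay
    ... | inj₁ e = inj₁ (trans (cong (λ u → comp u t) (cong (λ u → comp u (B X)) h)) (trans (comp-nz k)
          (trans e
           (sym (trans (cong (λ u → comp u (B (X ∘ᵛ Y))) (trans (A∘ X Y) (cong (λ u → comp u (A Y)) h)))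
                 (comp-nz ay))))))
    ... | inj₂ e = inj₂ (Wit-self Y cX h k e)

    Fits : SV n → SV n → SV n → Set
    Fits X Y Q = ∀ f → ¬ InSep X Y f → Q ! f ≡ comp (X ! f) (Y ! f)

    -- A covector that fits up to zeros can be composed in front of an eliminant without spoiling
    -- the fit (`Fits-∘`). This is how a witness is planted in the result of an elimination.
    PFits : SV n → SV n → SV n → Set
    PFits X Y Q = ∀ f → ¬ InSep X Y f → Q ! f ≡ zer ⊎ Q ! f ≡ comp (X ! f) (Y ! f)

    Fits-∘ : ∀ {X Y N Z} → PFits X Y N → Fits X Y Z → Fits X Y (N ∘ᵛ Z)
    Fits-∘ {X} {Y} {N} {Z} p q f h with p f h
    ... | inj₁ r = trans (∘-left {X = N} {Z} r) (q f h)
    ... | inj₂ r = trans (∘! N Z f) (trans (cong₂ comp r (q f h)) (comp-idem _))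

    part-elim : ∀ {X Y M N Z} → M ≼ X → N ≼ Y → (∀ f → ¬ InSep M N f → Z ! f ≡ (M ∘ᵛ N) ! f) → PFits X Y Z
    part-elim {X} {Y} {M} {N} p q h f ns with part-comp (p f) (q f) ns
    ... | ns' , inj₁ r = inj₁ (trans (h f ns') (trans (∘! M N f) r))
    ... | ns' , inj₂ r = inj₂ (trans (h f ns') (trans (∘! M N f) r))

    part-left : ∀ {X Y M} → M ≼ X → PFits X Y M
    part-left {X} {Y} {M} p f ns with part-comp {k = zer} (p f) (inj₁ refl) ns
    ... | _ , inj₁ r = inj₁ (trans (sym (comp-zerʳ _)) r)
    ... | _ , inj₂ r = inj₂ (trans (sym (comp-zerʳ _)) r)

    part-right : ∀ {X Y M} → M ≼ Y → PFits X Y M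
    part-right {X} {Y} {M} p f ns with part-comp {m = zer} (inj₁ refl) (p f) ns
    ... | _ , inj₁ r = inj₁ r
    ... | _ , inj₂ r = inj₂ r

    record Res (e : Fin n) (s t : Sign) (X Y : SV n) : Set where
      constructor res
      field
        r   : Sign
        Q   : SV n
        cQ  : Cov O Q
        vQ  : Val r Q
        Qe  : Q ! e ≡ zer
        fit : Fits X Y Q
        rst : ¬ Opposite s t → r ≡ comp s t

    Fits-flip : ∀ {X Y Q} → Fits X Y Q → Fits Y X Q
    Fits-flip {X} {Y} {Q} h f ns = trans (h f (ns ∘ opposite-sym)) (comp-comm (ns ∘ opposite-sym))

    Res-flip : ∀ {e s t X Y} → Res e s t X Y → Res e t s Y X
    Res-flip {X = X} {Y} (res r Q c v z f h) =
      res r Q c v z (Fits-flip {X} {Y} {Q} f) (λ ns → trans (h (ns ∘ opposite-sym))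
            (comp-comm (ns ∘ opposite-sym)))

    AFits : ∀ {X Y Q} → Fits X Y Q → ¬ Opposite (A X) (A Y) → A Q ≡ comp (A X) (A Y)
    AFits {X} {Y} h ns with Opposite? (X ! a) (Y ! a)
    ... | no no' = trans (cong (mul α) (h a no')) (mul-comp α _ _)
    ... | yes o with α ≟ₛ zer
    ... | yes refl = refl
    ... | no nz = ⊥-elim (ns (opp⇒opposite (mul-nz nz (Opposite-nzˡ o))
                    (trans (cong (mul α) (opposite⇒opp o)) (mul-oppʳ α _))))

    BFits : ∀ {X Y Q} → Fits X Y Q → ¬ Opposite (B X) (B Y) → B Q ≡ comp (B X) (B Y)
    BFits {X} {Y} h ns with Opposite? (X ! b) (Y ! b)
    ... | no no' = trans (cong (mul β) (h b no')) (mul-comp β _ _)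
    ... | yes o with β ≟ₛ zer
    ... | yes refl = refl
    ... | no nz = ⊥-elim (ns (opp⇒opposite (mul-nz nz (Opposite-nzˡ o))
                    (trans (cong (mul β) (opposite⇒opp o)) (mul-oppʳ β _))))

    elim : ∀ {X Y} e → Cov O X → Cov O Y → InSep X Y e → ∃ λ Z → Cov O Z × Z ! e ≡ zer × Fits X Y Z
    elim {X} {Y} e cX cY o with L3 O e cX cY o
    ... | Z , cZ , z , h = Z , cZ , z , λ f ns → trans (h f ns) (∘! X Y f)

    -- Any eliminant works with its canonical sign: if the canonical signs of `X` and `Y` are not
    -- opposed, then neither are their `A` signs, nor, when these vanish, their `B` signs.
    elim-lex : ∀ {X Y} e → Cov O X → Cov O Y → InSep X Y e → Res e (comp (A X) (B X)) (comp (A Y) (B Y)) X Y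
    elim-lex {X} {Y} e cX cY o with elim e cX cY o
    ... | Z , cZ , z , fit = res _ Z cZ (inj₁ refl) z fit
        (signs (A X) (B X) (A Y) (B Y) (AFits {X} {Y} {Z} fit) (BFits {X} {Y} {Z} fit))
      where
      signs : ∀ ax bx ay by {az bz} → (¬ Opposite ax ay → az ≡ comp ax ay) → (¬ Opposite bx by → bz ≡ comp bx
            by) →
        ¬ Opposite (comp ax bx) (comp ay by) → comp az bz ≡ comp (comp ax bx) (comp ay by)
      signs pos bx pos by p q ns rewrite p ns = refl
      signs pos bx neg by p q ns = ⊥-elim (ns (inj₁ (refl , refl)))
      signs pos bx zer by p q ns rewrite p (λ o → Opposite-nzʳ o refl) = refl
      signs neg bx pos by p q ns = ⊥-elim (ns (inj₂ (refl , refl)))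
      signs neg bx neg by p q ns rewrite p ns = refl
      signs neg bx zer by p q ns rewrite p (λ o → Opposite-nzʳ o refl) = refl
      signs zer pos pos by p q ns rewrite p (λ o → Opposite-nzˡ o refl) = refl
      signs zer neg pos by p q ns = ⊥-elim (ns (inj₂ (refl , refl)))
      signs zer zer pos by p q ns rewrite p (λ o → Opposite-nzˡ o refl) = refl
      signs zer pos neg by p q ns = ⊥-elim (ns (inj₁ (refl , refl)))
      signs zer neg neg by p q ns rewrite p (λ o → Opposite-nzˡ o refl) = refl
      signs zer zer neg by p q ns rewrite p (λ o → Opposite-nzˡ o refl) = refl
      signs zer bx zer by p q ns rewrite p (λ o → Opposite-nzˡ o refl) = q ns

    -- The witness `V` of `Y` is composed in front of the eliminant if it vanishes at `e`. Otherwise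
    -- `e` is eliminated between `X` and `V` as well, and that eliminant takes its place.
    elim-lex-wit : ∀ {t X Y} e → Cov O X → Cov O Y → Wit Y → InSep X Y e → Res e (comp (A X) (B X)) t X Y
    elim-lex-wit {t} {X} {Y} e cX cY w@(wit V cV p AV BV eq) o with elim e cX cY o
    ... | Z , cZ , Ze , fit with V ! e ≟ₛ zer
    ... | yes Ve with A Z ≟ₛ A Y
    ... | yes az = res (comp (comp (A X) (B X)) t) (V ∘ᵛ Z) (L2 O cV cZ)
          (inj₂ (Wit-self Z cV AV BV (trans eq (cong opp (sym az))))) (∘-zer {X = V} {Z} Ve Ze)
          (Fits-∘ {X} {Y} {V} {Z} (part-right {X} {Y} {V} p) fit) (λ _ → refl)
    ... | no az with Opposite? (A X) (A Y)
    -- With `A X` opposed to `A Y` the sign to be reached is `A X`. The eliminant has `A` either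
    -- zero, and then `B V` decides, or opposite to `A Y`; both give `opp (A Y)`.
    ... | yes oa = res (opp (A Y)) (V ∘ᵛ Z) (L2 O cV cZ) (inj₁ value)
          (∘-zer {X = V} {Z} Ve Ze) (Fits-∘ {X} {Y} {V} {Z} (part-right {X} {Y} {V} p) fit)
          (λ _ → sym (trans (cong (λ u → comp u t) (comp-nz (Opposite-nzˡ oa)))
                (trans (comp-nz (Opposite-nzˡ oa)) (opposite⇒opp oa))))
      where
      value : opp (A Y) ≡ comp (A (V ∘ᵛ Z)) (B (V ∘ᵛ Z))
      value with A Z ≟ₛ zer
      ... | yes h = sym (trans (cong₂ comp (trans (A∘ V Z) (trans (cong₂ comp AV h) refl)) (trans (B∘ V Z)
            (comp-nz BV))) eq)
      ... | no h with ±-split h (Wit-A w)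
      ... | inj₁ q = ⊥-elim (az q)
      ... | inj₂ q = sym (trans (cong (λ u → comp u (B (V ∘ᵛ Z))) (trans (A∘ V Z) (cong (λ u → comp u (A Z))
            AV))) (trans (comp-nz h) q))
    ... | no noa = ⊥-elim (az (trans (AFits {X} {Y} {Z} fit noa) (merge (A X) (A Y) noa (Wit-A w))))
      where
      merge : ∀ s t → ¬ Opposite s t → t ≢ zer → comp s t ≡ t
      merge s t ns nz with s ≟ₛ zer
      ... | yes refl = refl
      ... | no ns' = trans (comp-nz ns') (nosep⇒≡ ns ns' nz)
    elim-lex-wit {t} {X} {Y} e cX cY w@(wit V cV p AV BV eq) o | Z , cZ , Ze , fit | no Ve
      with elim {X} {V} e cX cV (subst (Opposite (X ! e)) (sym (≼-nz {X = V} {Y} p Ve)) o)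
    ... | N , cN , Ne , fitN = go (A X ≟ₛ zer)
      where
      Q : SV n
      Q = N ∘ᵛ Z
      cQ : Cov O Q
      cQ = L2 O cN cZ
      Qe : Q ! e ≡ zer
      Qe = ∘-zer {X = N} {Z} Ne Ze
      fitQ : Fits X Y Q
      fitQ = Fits-∘ {X} {Y} {N} {Z} (part-elim {X} {Y} {X} {V} {N} (≼-refl X) p (λ f ns → trans (fitN f ns)
            (sym (∘! X V f)))) fit
      AN : A N ≡ A X
      AN = trans (AFits {X} {V} {N} fitN (λ o → Opposite-nzʳ o AV)) (trans (cong (comp (A X)) AV)
            (comp-zerʳ _))
      go : Dec (A X ≡ zer) → Res e (comp (A X) (B X)) t X Y
      go (no h) = res (A X) Q cQ
        (inj₁ (sym (trans (cong (λ u → comp u (B Q)) (trans (A∘ N Z) (trans (cong (λ u → comp u (A Z)) AN)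
              (comp-nz h)))) (comp-nz h)))) Qe fitQ
        (λ _ → sym (trans (cong (λ u → comp u t) (comp-nz h)) (comp-nz h)))
      go (yes h) = go′ (Opposite? (B X) (B V))
        where
        AZ : A Z ≡ A Y
        AZ = trans (AFits {X} {Y} {Z} fit (λ o → Opposite-nzˡ o h)) (cong (λ u → comp u (A Y)) h)
        go′ : Dec (Opposite (B X) (B V)) → Res e (comp (A X) (B X)) t X Y
        go′ (yes ob) = res (A Y) Q cQ
          (inj₁ (sym (trans (cong (λ u → comp u (B Q)) (trans (A∘ N Z) (trans (cong₂ comp (trans AN h) AZ)
                refl))) (comp-nz (Wit-A w))))) Qe fitQ
          (λ _ → trans (sym BX) (sym (trans (cong (λ u → comp u t) (cong (λ u → comp u (B X)) h))
                (comp-nz (Opposite-nzˡ ob)))))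
          where
          BX : B X ≡ A Y
          BX = trans (opposite⇒opp ob) (trans (cong opp eq) (opp-opp _))
        go′ (no nob) = res (comp (comp (A X) (B X)) t) Q cQ
          (inj₂ (Wit-self {N} Z cN (trans AN h) (λ z → BV (trans (sym BN) z))
                (trans BN (trans eq (cong opp (sym AZ)))))) Qe fitQ (λ _ → refl)
          where
          BN : B N ≡ B V
          BN with B X ≟ₛ zer
          ... | yes z = trans (BFits {X} {V} {N} fitN nob) (cong (λ u → comp u (B V)) z)
          ... | no z = trans (BFits {X} {V} {N} fitN nob) (trans (comp-nz z) (nosep⇒≡ nob z BV))

    -- A composition suffices as soon as it has a witness, for then p may be zero. Elimination in
    -- `O` is called for only when both signs are decided by b, or both by a. In the latter case, if
    -- b does not vanish on the eliminant, it is followed by whichever of `X` and `Y` makes it a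
    -- witness.
    elim-p : ∀ {s t X Y} → Cov O X → Val s X → Cov O Y → Val t Y → Opposite s t →
      ∃ λ Q → Cov O Q × Val zer Q × Fits X Y Q
    elim-p {s} {t} {X} {Y} cX (inj₂ w) cY _ o = X ∘ᵛ Y , L2 O cX cY , inj₂ (Wit-∘ Y w) , λ f _ → ∘! X Y f
    elim-p {s} {t} {X} {Y} cX _ cY (inj₂ w) o =
      Y ∘ᵛ X , L2 O cY cX , inj₂ (Wit-∘ X w) , Fits-flip {Y} {X} {Y ∘ᵛ X} (λ f _ → ∘! Y X f)
    elim-p {s} {t} {X} {Y} cX (inj₁ refl) cY (inj₁ refl) o with A X ≟ₛ zer | A Y ≟ₛ zer
    ... | yes h | yes k with elim {X} {Y} b cX cY (opposite-mul⁻ {β} (subst₂′ (cong (λ u → comp u (B X)) h)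
          (cong (λ u → comp u (B Y)) k) o))
      where
      subst₂′ : ∀ {s s' t t'} → s ≡ s' → t ≡ t' → Opposite s t → Opposite s' t'
      subst₂′ refl refl o = o
    ... | Z , cZ , Zb , fit = Z , cZ , inj₁ (sym (trans (cong₂ comp AZ (trans (cong (mul β) Zb) (mul-zerʳ β)))
          refl)) , fit
      where
      AZ : A Z ≡ zer
      AZ = trans (AFits {X} {Y} {Z} fit (λ o → Opposite-nzˡ o h)) (trans (cong₂ comp h k) refl)
    elim-p {s} {t} {X} {Y} cX (inj₁ refl) cY (inj₁ refl) o | yes h | no k =
      X ∘ᵛ Y , L2 O cX cY , inj₂ (Wit-self {X} Y cX h (λ z → Opposite-nzˡ o (trans (cong₂ comp h z) refl))
        (trans (sym (cong (λ u → comp u (B X)) h)) (trans (opposite⇒opp o) (cong opp (comp-nz k))))) , λ f _ →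
              ∘! X Y f
    elim-p {s} {t} {X} {Y} cX (inj₁ refl) cY (inj₁ refl) o | no h | yes k =
      Y ∘ᵛ X , L2 O cY cX , inj₂ (Wit-self {Y} X cY k (λ z → Opposite-nzʳ o (trans (cong₂ comp k z) refl))
        (trans (sym (cong (λ u → comp u (B Y)) k)) (trans (opposite⇒opp (opposite-sym o))
              (cong opp (comp-nz h))))) ,
        Fits-flip {Y} {X} {Y ∘ᵛ X} (λ f _ → ∘! Y X f)
    elim-p {s} {t} {X} {Y} cX (inj₁ refl) cY (inj₁ refl) o | no h | no k
      with elim {X} {Y} a cX cY (opposite-mul⁻ {α} (opp⇒opposite h (trans (sym (comp-nz h))
            (trans (opposite⇒opp o) (cong opp (comp-nz k))))))
    ... | Z , cZ , Za , fit = go (B Z ≟ₛ zer)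
      where
      AZ : A Z ≡ zer
      AZ = trans (cong (mul α) Za) (mul-zerʳ α)
      AXY : A X ≡ opp (A Y)
      AXY = trans (sym (comp-nz h)) (trans (opposite⇒opp o) (cong opp (comp-nz k)))
      go : Dec (B Z ≡ zer) → ∃ λ Q → Cov O Q × Val zer Q × Fits X Y Q
      go (yes z) = Z , cZ , inj₁ (sym (trans (cong₂ comp AZ z) refl)) , fit
      go (no z) with ±-split z h
      ... | inj₂ q = Z ∘ᵛ X , L2 O cZ cX , inj₂ (Wit-self {Z} X cZ AZ z q) ,
              λ f ns → trans (∘! Z X f) (trans (cong (λ u → comp u (X ! f)) (fit f ns)) (comp-absorbˡ (X ! f)
                    (Y ! f)))
      ... | inj₁ q = Z ∘ᵛ Y , L2 O cZ cY , inj₂ (Wit-self {Z} Y cZ AZ z (trans q AXY)) ,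
              λ f ns → trans (∘! Z Y f) (trans (cong (λ u → comp u (Y ! f)) (fit f ns)) (comp-absorbʳ (X ! f)
                    (Y ! f)))

    elim-wit-wit : ∀ {s t X Y} e → Cov O X → Wit X → Cov O Y → Wit Y → InSep X Y e → Res e s t X Y
    elim-wit-wit {s} {t} {X} {Y} e cX wX@(wit V cV p AV BV eqV) cY wY@(wit U cU q AU BU eqU) o
      with ±-split (Wit-A wX) (Wit-A wY)
    ... | inj₁ ae with elim e cX cY o
    ... | Z , cZ , Ze , fit = go (V ! e ≟ₛ zer) (U ! e ≟ₛ zer)
      where
      AZ : A Z ≡ A X
      AZ = trans (AFits {X} {Y} {Z} fit (Opposite-irrefl ae)) (comp-nz (Wit-A wX))
      make : ∀ N → Cov O N → N ! e ≡ zer → A N ≡ zer → B N ≡ B V → PFits X Y N → Res e s t X Y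
      make N cN Ne AN BN pf = res (comp s t) (N ∘ᵛ Z) (L2 O cN cZ)
        (inj₂ (Wit-self {N} Z cN AN (λ z → BV (trans (sym BN) z)) (trans BN (trans eqV (cong opp (sym AZ))))))
        (∘-zer {X = N} {Z} Ne Ze) (Fits-∘ {X} {Y} {N} {Z} pf fit) (λ _ → refl)
      BUV : B U ≡ B V
      BUV = trans eqU (trans (cong opp (sym ae)) (sym eqV))
      go : Dec (V ! e ≡ zer) → Dec (U ! e ≡ zer) → Res e s t X Y
      go (yes z) _ = make V cV z AV refl (part-left {X} {Y} {V} p)
      go _ (yes z) = make U cU z AU BUV (part-right {X} {Y} {U} q)
      go (no z) (no z') with elim {V} {U} e cV cU
          (subst (λ u → Opposite u (U ! e)) (sym (≼-nz {X = V} {X} p z)) (subst (Opposite (X ! e))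
                (sym (≼-nz {X = U} {Y} q z')) o))
      ... | N , cN , Ne , fitN = make N cN Ne (trans (AFits {V} {U} {N} fitN (λ o → Opposite-nzˡ o AV))
            (trans (cong₂ comp AV AU) refl))
              (trans (BFits {V} {U} {N} fitN (Opposite-irrefl (sym BUV))) (comp-nz BV))
              (part-elim {X} {Y} {V} {U} {N} p q (λ f ns → trans (fitN f ns) (sym (∘! V U f))))
    -- Both `s` and `t` are arbitrary here. Giving one side its canonical sign at a time yields
    -- eliminants with p-signs `A X` and `A Y`, which are opposite; eliminating p between these two
    -- reaches the remaining sign zero.
    elim-wit-wit {s} {t} {X} {Y} e cX wX cY wY o | inj₂ ae =
        go (elim-lex-wit {A X} e cX cY wY o) (elim-lex-wit {A Y} e cY cX wX (opposite-sym o))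
      where
      go : Res e (comp (A X) (B X)) (A X) X Y → Res e (comp (A Y) (B Y)) (A Y) Y X → Res e s t X Y
      go (res r₁ Q₁ c₁ v₁ z₁ f₁ h₁) (res r₂ Q₂ c₂ v₂ z₂ f₂ h₂) = pick (comp s t ≟ₛ zer)
        where
        r₁≡ : r₁ ≡ A X
        r₁≡ = trans (h₁ (Opposite-irrefl (comp-nz (Wit-A wX)))) (trans (cong (λ u → comp u (A X))
              (comp-nz (Wit-A wX))) (comp-nz (Wit-A wX)))
        r₂≡ : r₂ ≡ A Y
        r₂≡ = trans (h₂ (Opposite-irrefl (comp-nz (Wit-A wY)))) (trans (cong (λ u → comp u (A Y))
              (comp-nz (Wit-A wY))) (comp-nz (Wit-A wY)))
        f₂′ : Fits X Y Q₂
        f₂′ = Fits-flip {Y} {X} {Q₂} f₂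
        pick : Dec (comp s t ≡ zer) → Res e s t X Y
        pick (yes z) with elim-p c₁ v₁ c₂ v₂ (opp⇒opposite (λ h → Wit-A wX (trans (sym r₁≡) h))
              (trans r₁≡ (trans ae (cong opp (sym r₂≡)))))
        ... | Q , cQ , vQ , fQ = res zer Q cQ vQ
                (trans (fQ e (λ o → Opposite-nzˡ o z₁)) (trans (cong₂ comp z₁ z₂) refl))
                (λ f ns → trans (fQ f (Opposite-irrefl (trans (f₁ f ns) (sym (f₂′ f ns)))))
                      (trans (cong₂ comp (f₁ f ns) (f₂′ f ns)) (comp-idem _)))
                (λ _ → sym z)
        pick (no z) with ±-split z (Wit-A wX)
        ... | inj₁ q = res r₁ Q₁ c₁ v₁ z₁ f₁ (λ _ → trans r₁≡ (sym q))
        ... | inj₂ q = res r₂ Q₂ c₂ v₂ z₂ f₂′ (λ _ → trans r₂≡ (trans (sym (opp-opp _))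
              (trans (cong opp (sym ae)) (sym q))))

    elim-res : ∀ {s t X Y} e → Cov O X → Val s X → Cov O Y → Val t Y → InSep X Y e → Res e s t X Y
    elim-res e cX (inj₁ refl) cY (inj₁ refl) o = elim-lex e cX cY o
    elim-res e cX (inj₁ refl) cY (inj₂ w) o = elim-lex-wit e cX cY w o
    elim-res {X = X} {Y} e cX (inj₂ w) cY (inj₁ refl) o = Res-flip {X = Y} {X} (elim-lex-wit e cY cX w
          (opposite-sym o))
    elim-res e cX (inj₂ w) cY (inj₂ w') o = elim-wit-wit e cX w cY w' o

  canon : SV n → Sign
  canon X = comp (A X) (B X)

  lex : OM (suc n)
  lex = record
    { Cov = Cov′
    ; L0 = L0 O , inj₁ (sym (trans (cong₂ comp (trans (cong (mul α) (zeroV! a)) (mul-zerʳ α))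
          (trans (cong (mul β) (zeroV! b)) (mul-zerʳ β))) refl))
    ; L1 = λ { {s ∷ X} (c , v) → L1 O c , Val-neg {s} {X} v }
    ; L2 = λ { {s ∷ X} {t ∷ Y} (c , v) (c' , v') → L2 O c c' , Val-comp {s} {t} {X} {Y} c v c' v' }
    ; L3 = λ { {s ∷ X} {t ∷ Y} e (c , v) (c' , v') o → l3 {s} {t} {X} {Y} e c v c' v' o } }
    where
    l3 : ∀ {s t X Y} (e : Fin (suc n)) → Cov O X → Val s X → Cov O Y → Val t Y → InSep (s ∷ X) (t ∷ Y) e →
      ∃ λ Z → Cov′ Z × Z ! e ≡ zer × (∀ f → ¬ InSep (s ∷ X) (t ∷ Y) f → Z ! f ≡ ((s ∷ X) ∘ᵛ (t ∷ Y)) ! f)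
    l3 {s} {t} {X} {Y} fzero c v c' v' o with elim-p c v c' v' o
    ... | Q , cQ , vQ , fit = zer ∷ Q , (cQ , vQ) , refl ,
            λ { fzero ns → ⊥-elim (ns o) ; (fsuc f) ns → trans (fit f ns) (sym (∘! X Y f)) }
    l3 {s} {t} {X} {Y} (fsuc e) c v c' v' o with elim-res e c v c' v' o
    ... | res r Q cQ vQ Qe fit rst = r ∷ Q , (cQ , vQ) , Qe ,
            λ { fzero ns → rst ns ; (fsuc f) ns → trans (fit f ns) (sym (∘! X Y f)) }

-- A plane of O cut by p

mul-swap-cancel : ∀ γ {x u y v} → γ ≢ zer → mul x (mul γ u) ≡ mul y (mul γ v) → mul x u ≡ mul y v
mul-swap-cancel γ {x} {u} {y} {v} nz h = mul-cancelˡ nz (trans (sym (move x u)) (trans h (move y v)))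
  where
  move : ∀ x u → mul x (mul γ u) ≡ mul γ (mul x u)
  move x u = trans (sym (mul-assoc x γ u)) (trans (cong (λ t → mul t u) (mul-comm x γ)) (mul-assoc γ x u))

module Extension {n : ℕ} (O : OM n) (a b : Fin n) (γ : Sign) (γ≢ : γ ≢ zer) where

  -- A covector y of O that lies on p; V is the limit of y as p tends to a,
  -- and γ V_b = y_a records on which side of V it lies.
  record OnP (y : SV n) : Set where
    field
      cy   : Cov O y
      V    : SV n
      cV   : Cov O V
      V≼y  : V ≼ y
      Va   : V ! a ≡ zer
      ya   : y ! a ≡ mul γ (V ! b)
      old  : y ! a ≡ zer → ∀ e → V ! e ≡ y ! e

    V⊑y : V ⊑ y
    V⊑y = ≼⇒⊑ {X = V} {y} V≼y

    Vb-nz : y ! a ≢ zer → V ! b ≢ zer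
    Vb-nz h q = h (trans ya (trans (cong (mul γ) q) (mul-zerʳ γ)))

    Vb-zer : y ! a ≡ zer → V ! b ≡ zer
    Vb-zer h = mul-zer⁻ (trans (sym ya) h) γ≢

    V-nz : ∀ {u} → y ! u ≢ zer → ∃ λ w → V ! w ≢ zer
    V-nz {u} h with y ! a ≟ₛ zer
    ... | yes q = u , λ z → h (trans (sym (old q u)) z)
    ... | no q = b , Vb-nz q

    Vg≡ : ∀ {g} → V ! g ≢ zer → V ! g ≡ y ! g
    Vg≡ = ≼-nz {X = V} {y} V≼y

  -- V is an affine limit point and D the direction from V to y. In the expansion
  --   f/g (y) = f/g (V) − ε (b/g)(V) · f(D) / (a(D) + ε b(D))
  -- the second factor changes along a moved edge and the last one along a fixed edge.
  data Compare (g f : Fin n) (d : Sign) (V₁ D₁ V₂ D₂ : SV n) : Set where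
    moved : ∀ {d₂} → Step O g b d₂ V₁ V₂ → mul d (V₁ ! b) ≡ mul (D₁ ! f) d₂ → D₁ ! f ≡ D₂ ! f →
      Step O a f zer D₁ D₂ → (d₂ ≡ zer → Step O a b zer D₁ D₂) → Compare g f d V₁ D₁ V₂ D₂
    fixed : ∀ {d₃ d₄} → V₁ ≡ V₂ → Step O a f d₃ D₁ D₂ → Step O a b d₄ D₁ D₂ → d₃ ≡ zer ⊎ d₃ ≡ d →
      (d₃ ≡ zer → mul d (V₁ ! b) ≡ mul (D₁ ! f) d₄) → Compare g f d V₁ D₁ V₂ D₂

  -- An edge with both ends on p lives in a plane of `O`. There a and g are lines: `V₁`, `V₂` and
  -- `W` lie on a, `Z` and `W` on g, so `W` is their intersection. By `new` the element a is no loop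
  -- of the plane. The identities below come from uniqueness of points on such lines.
  module Plane (g : Fin n) {y₁ y₂ Z : SV n} (P₁ : OnP y₁) (P₂ : OnP y₂) (PZ : OnP Z)
    (ht : Ht O 3 (y₁ ∘ᵛ y₂)) (dZ : Diff g y₁ y₂ Z) (g≢ : y₁ ! g ≢ zer) (g≡ : y₁ ! g ≡ y₂ ! g)
    (conf : ¬ Opposite (y₁ ! a) (y₂ ! a)) (new : y₁ ! a ≢ zer ⊎ y₂ ! a ≢ zer)
    (sp₁ : ∃ λ e → y₁ ! e ≡ zer × y₂ ! e ≢ zer) (sp₂ : ∃ λ e → y₂ ! e ≡ zer × y₁ ! e ≢ zer) where

    open OnP P₁ using () renaming (V to V₁; Va to Va₁; cy to cy₁)
    open OnP P₂ using () renaming (V to V₂; Va to Va₂; cy to cy₂)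
    open OnP PZ using () renaming (V to W; Va to Wa; cy to cZ)

    K : OM n
    K = O ↓ (y₁ ∘ᵛ y₂)

    rk : Rank K 3
    rk = Rank-↓ O 3 (y₁ ∘ᵛ y₂) ht

    k₁ : Cov K y₁
    k₁ = cy₁ , ⊑-∘ˡ y₁ y₂

    k₂ : Cov K y₂
    k₂ = cy₂ , ⊑-∘ʳ y₁ y₂

    kZ : Cov K Z
    kZ = cZ , below dZ

    inK : ∀ {X y} → Cov O X → X ⊑ y → Cov K y → Cov K X
    inK c p (_ , q) = c , λ e h → p e (q e h)

    kV₁ : Cov K V₁
    kV₁ = inK (OnP.cV P₁) (OnP.V⊑y P₁) k₁

    kV₂ : Cov K V₂
    kV₂ = inK (OnP.cV P₂) (OnP.V⊑y P₂) k₂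

    kW : Cov K W
    kW = inK (OnP.cV PZ) (OnP.V⊑y PZ) kZ

    Wg : W ! g ≡ zer
    Wg = OnP.V⊑y PZ g (at dZ)

    rkg : Rank (K / g) 2
    rkg = Rank-/ K 2 rk k₁ g≢

    rka : Rank (K / a) 2
    rka = nonloop new
      where
      nonloop : y₁ ! a ≢ zer ⊎ y₂ ! a ≢ zer → Rank (K / a) 2
      nonloop (inj₁ h) = Rank-/ K 2 rk k₁ h
      nonloop (inj₂ h) = Rank-/ K 2 rk k₂ h

    a∋V₁ : Cov (K / a) V₁
    a∋V₁ = in/ K kV₁ Va₁

    a∋V₂ : Cov (K / a) V₂
    a∋V₂ = in/ K kV₂ Va₂

    a∋W : Cov (K / a) W
    a∋W = in/ K kW Wa

    g∋W : Cov (K / g) W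
    g∋W = in/ K kW Wg

    g∋Z : Cov (K / g) Z
    g∋Z = in/ K kZ (at dZ)

    e₁ : Fin n
    e₁ = proj₁ sp₁

    Z-e₁ : Z ! e₁ ≡ y₂ ! e₁
    Z-e₁ = left dZ e₁ (proj₁ (proj₂ sp₁))

    V₁-e₁ : V₁ ! e₁ ≡ zer
    V₁-e₁ = OnP.V⊑y P₁ e₁ (proj₁ (proj₂ sp₁))

    Z-nz : ∃ λ u → Z ! u ≢ zer
    Z-nz = e₁ , λ h → proj₂ (proj₂ sp₁) (trans (sym Z-e₁) h)

    W-nz : ∃ λ u → W ! u ≢ zer
    W-nz = OnP.V-nz PZ (proj₂ Z-nz)

    V₂-nz : ∃ λ u → V₂ ! u ≢ zer
    V₂-nz = OnP.V-nz P₂ (λ h → g≢ (trans g≡ h))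

    Wf : ∀ f → W ! f ≡ zer ⊎ W ! f ≡ Z ! f
    Wf = OnP.V≼y PZ

    τ-nz : ∀ {X N : SV n} {τ u} → (∀ i → X ! i ≡ mul τ (N ! i)) → X ! u ≢ zer → τ ≢ zer
    τ-nz {N = N} {u = u} h nz refl = nz (h u)

    -- A multiple of `N` vanishing at `e` would be zero, which `W` is not. So W ≼ Z forces `W` to
    -- share the entry of `Z` at `e`, and the multiple is positive.
    W-multiple : ∀ {N e} → (∃ λ τ → ∀ i → W ! i ≡ mul τ (N ! i)) → N ! e ≡ Z ! e → N ! e ≢ zer → ∀ i → W ! i ≡
          N ! i
    W-multiple {N} {e} (τ , h) eq nz with Wf e
    ... | inj₁ z = ⊥-elim (τ-nz {W} {N} h (proj₂ W-nz) (zero-τ (trans (sym (h e)) z)))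
      where
      zero-τ : mul τ (N ! e) ≡ zer → τ ≡ zer
      zero-τ p = mul-zer⁻ (trans (mul-comm (N ! e) τ) p) nz
    ... | inj₂ z with mul-fix {τ} nz (trans eq (trans (sym z) (h e)))
    ... | refl = h

    W-is : ∀ {C N e} → Cov (K / a) C → C ! g ≢ zer → Cov (K / a) N → N ! g ≡ zer → N ! e ≡ Z ! e → N ! e ≢ zer
          →
      ∀ i → W ! i ≡ N ! i
    W-is {N = N} cC Cg cN Ng eq nz = W-multiple {N} (line-unique (K / a) rka cC Cg a∋W Wg cN Ng nz) eq nz

    W-is′ : ∀ {C N e} → Cov (K / g) C → C ! a ≢ zer → Cov (K / g) N → N ! a ≡ zer → N ! e ≡ Z ! e → N ! e ≢
          zer →
      ∀ i → W ! i ≡ N ! i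
    W-is′ {N = N} cC Ca cN Na eq nz = W-multiple {N} (line-unique (K / g) rkg cC Ca g∋W Wa cN Na nz) eq nz

    up : ∀ {m X} → Cov K X → Ht K m X → Ht O m X
    up {m} (_ , p) = Ht-contract⁻ O _ m p

    up/ : ∀ {m X} c → Cov (K / c) X → Ht (K / c) m X → Ht O m X
    up/ {m} {X} c (k , p) h = up {m} {X} k (Ht-contract⁻ K _ m p h)

    lineStep : ∀ c k {X Y} → Rank (K / c) 2 → Cov (K / c) X → Cov (K / c) Y → Ht O 1 X → Ht O 1 Y →
      X ! k ≢ zer → X ! k ≡ Y ! k →
      ∃ λ N → Cov (K / c) N × Diff k X Y N × (∀ h → Step O k h (N ! h) X Y)
    lineStep c k {X} {Y} r cX cY hX hY nz eq with diff (K / c) k cX cY eq nz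
    ... | N , cN , dN = N , cN , dN , λ h → mkStep (proj₁ (proj₁ cX)) (proj₁ (proj₁ cY)) hX hY nz eq
            (up/ {2} {X ∘ᵛ Y} c (L2 (K / c) cX cY) (r (L2 (K / c) cX cY))) N (proj₁ (proj₁ cN)) dN refl

    crossW : ∀ {f X} → W ! f ≡ zer → Cov (K / g) X → mul (Z ! f) (X ! a) ≡ mul (X ! f) (Z ! a)
    crossW h cX = cross (K / g) rkg g∋W (proj₂ W-nz) Wa h g∋Z cX

    a-swap : y₁ ! a ≢ zer → y₂ ! a ≢ zer → y₁ ! a ≡ y₂ ! a
    a-swap = nosep⇒≡ conf

    -- A zero of `y` off the limit of `y′` fixes the sign of `W`. If `y` is on a, then b is such a
    -- zero. Otherwise, when the given `e` fails, both limits are points on `e` of the line a, hence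
    -- proportional.
    choice : ∀ {y y′} (P : OnP y) (P′ : OnP y′) → Cov K y → Cov K y′ → y ! g ≢ zer → y ! a ≢ zer ⊎ y′ ! a ≢
          zer →
      (∃ λ e → y ! e ≡ zer × y′ ! e ≢ zer) →
      (∃ λ e → y ! e ≡ zer × OnP.V P′ ! e ≢ zer) ⊎ (∃ λ τ → ∀ i → OnP.V P′ ! i ≡ mul τ (OnP.V P ! i))
    choice {y} {y′} P P′ k k′ yg nw (e , p , q) with OnP.V P′ ! e ≟ₛ zer
    ... | no h = inj₁ (e , p , h)
    ... | yes h with y ! a ≟ₛ zer
    ... | yes z = inj₁ (b , trans (sym (OnP.old P z b)) (OnP.Vb-zer P z) , OnP.Vb-nz P′ (other nw))
      where
      other : y ! a ≢ zer ⊎ y′ ! a ≢ zer → y′ ! a ≢ zer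
      other (inj₁ n) = ⊥-elim (n z)
      other (inj₂ n) = n
    ... | no z = inj₂ (line-unique (K / a) {proj₁ C} {e = e} rka (proj₁ (proj₂ C)) (proj₂ (proj₂ C))
            (in/ K (inK (OnP.cV P′) (OnP.V⊑y P′) k′) (OnP.Va P′)) h
            (in/ K (inK (OnP.cV P) (OnP.V⊑y P) k) (OnP.Va P)) (OnP.V⊑y P e p) (proj₂ (OnP.V-nz P yg)))
      where
      -- This certifies that `e` is no loop on a: either `y′` is on a already, or a is eliminated
      -- between `y` and `y′`, which keeps the entry of `y′` at `e`.
      C : ∃ λ C → Cov (K / a) C × C ! e ≢ zer
      C with y′ ! a ≟ₛ zer
      ... | yes z' = y′ , in/ K k′ z' , q
      ... | no z' with cancel K a k k′ z z'
      ... | N , cN , Na , left = N , in/ K cN Na , λ n → q (trans (sym (left e p)) n)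

    choice₁ : (∃ λ e → y₁ ! e ≡ zer × V₂ ! e ≢ zer) ⊎ (∃ λ τ → ∀ i → V₂ ! i ≡ mul τ (V₁ ! i))
    choice₁ = choice P₁ P₂ k₁ k₂ g≢ new sp₁

    choice₂ : (∃ λ e → y₂ ! e ≡ zer × V₁ ! e ≢ zer) ⊎ (∃ λ τ → ∀ i → V₁ ! i ≡ mul τ (V₂ ! i))
    choice₂ = choice P₂ P₁ k₂ k₁ (λ h → g≢ (trans g≡ h)) (swap⊎ new) sp₂

    Z-left : ∀ {e} → y₁ ! e ≡ zer → V₂ ! e ≢ zer → V₂ ! e ≡ Z ! e
    Z-left {e} p q = trans (OnP.Vg≡ P₂ q) (sym (left dZ e p))

    module _ (hV₁ : Ht O 1 V₁) (hV₂ : Ht O 1 V₂) (V₁g : V₁ ! g ≢ zer) where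

      V-step : V₂ ! g ≢ zer → V₁ ≢ V₂ → ∀ h → Step O g h (W ! h) V₁ V₂
      V-step V₂g ne h with choice₁
      ... | inj₂ (τ , m) = ⊥-elim (ne (ext λ i → sym (equal i)))
        where
        V≡ : V₁ ! g ≡ V₂ ! g
        V≡ = trans (OnP.Vg≡ P₁ V₁g) (trans g≡ (sym (OnP.Vg≡ P₂ V₂g)))
        equal : ∀ i → V₂ ! i ≡ V₁ ! i
        equal with mul-fix {τ} V₁g (trans V≡ (m g))
        ... | refl = m
      ... | inj₁ (e , p , q) with lineStep a g rka a∋V₁ a∋V₂ hV₁ hV₂ V₁g
                 (trans (OnP.Vg≡ P₁ V₁g) (trans g≡ (sym (OnP.Vg≡ P₂ V₂g))))
      ... | N , cN , dN , st = subst (λ t → Step O g h t V₁ V₂) (sym (same-W h)) (st h)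
        where
        Ne : N ! e ≡ V₂ ! e
        Ne = left dN e (OnP.V⊑y P₁ e p)
        same-W : ∀ i → W ! i ≡ N ! i
        same-W = W-is a∋V₁ V₁g cN (at dN) (trans Ne (Z-left p q)) (λ z → q (trans (sym Ne) z))

    -- The line carrying `y₂` meets g in `V₂`, which lies on f, so the height is constant along it
    -- and `U` can stand for `y₂`. The route runs along a from `V₁` to a point `B` on b, then along
    -- b to `U`. Its first part heads for `V₂` and is therefore flat.
    module ToInfinity (f : Fin n) {U : SV n} (hV₁ : Ht O 1 V₁) (V₁g : V₁ ! g ≢ zer)
      (V₂g : V₂ ! g ≡ zer) (V₂f : V₂ ! f ≡ zer) (y₂a : y₂ ! a ≢ zer)
      (cU : Cov O U) (hU : Ht O 1 U) (dU : Diff b V₂ y₂ U) where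

      private
        V₂b : V₂ ! b ≢ zer
        V₂b = OnP.Vb-nz P₂ y₂a

        kU : Cov K U
        kU = cU , λ e h → zz dU e (proj₂ kV₂ e h) (proj₂ k₂ e h)

        Ua : U ! a ≡ y₂ ! a
        Ua = left dU a Va₂

        Ug : U ! g ≡ y₂ ! g
        Ug = left dU g V₂g

        W≡V₂ : ∀ i → W ! i ≡ V₂ ! i
        W≡V₂ with choice₁
        ... | inj₁ (e , p , q) = W-is a∋V₁ V₁g a∋V₂ V₂g (Z-left p q) q
        ... | inj₂ (τ , m) = ⊥-elim (τ-nz {V₂} {V₁} m V₂b (mul-zer⁻ (trans (mul-comm (V₁ ! g) τ)
              (trans (sym (m g)) V₂g)) V₁g))

        Za : Z ! a ≡ y₂ ! a
        Za = trans (OnP.ya PZ) (trans (cong (mul γ) (W≡V₂ b)) (sym (OnP.ya P₂)))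

        rkb : Rank (K / b) 2
        rkb = Rank-/ K 2 rk kV₂ V₂b

        base : ∃ λ B → Cov (K / a) B × B ! b ≡ zer × B ! g ≡ V₁ ! g
        base with V₁ ! b ≟ₛ zer
        ... | yes h = V₁ , a∋V₁ , h , refl
        ... | no h with cancel (K / a) b a∋V₂ a∋V₁ V₂b h
        ... | N , cN , Nb , left = N , cN , Nb , left g V₂g

        B : SV n
        B = proj₁ base

        a∋B : Cov (K / a) B
        a∋B = proj₁ (proj₂ base)

        Bb : B ! b ≡ zer
        Bb = proj₁ (proj₂ (proj₂ base))

        Bg : B ! g ≡ V₁ ! g
        Bg = proj₂ (proj₂ (proj₂ base))

        Bg-nz : B ! g ≢ zer
        Bg-nz h = V₁g (trans (sym Bg) h)

        hB : Ht O 1 B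
        hB = up/ {1} {B} a a∋B (Ht-contract⁻ (K / a) _ 1 {B} (proj₂ (in/ (K / a) a∋B Bb)) (Rank-/ (K / a) 1
              rka a∋V₂ V₂b (in/ (K / a) a∋B Bb)))

        first : Step O g f zer V₁ B
        first with lineStep a g rka a∋V₁ a∋B hV₁ hB V₁g (sym Bg)
        ... | N , cN , dN , st = subst (λ t → Step O g f t V₁ B) Nf (st f)
          where
          Nf : N ! f ≡ zer
          Nf with line-unique (K / a) rka a∋V₁ V₁g cN (at dN) a∋V₂ V₂g V₂b
          ... | τ , m = trans (m f) (trans (cong (mul τ) V₂f) (mul-zerʳ τ))

        second : Step O g f (Z ! f) B U
        second with lineStep b g rkb (in/ K (proj₁ a∋B) Bb) (in/ K kU (at dU)) hB hU Bg-nz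
                      (trans Bg (trans (OnP.Vg≡ P₁ V₁g) (trans g≡ (sym Ug))))
        ... | N , cN , dN , st = subst (λ t → Step O g f t B U) (mul-cancelʳ y₂a eq) (st f)
          where
          Na : N ! a ≡ y₂ ! a
          Na = trans (left dN a (proj₂ a∋B a refl)) Ua
          -- On g the elements f and a are proportional, as both vanish at `V₂`; equal entries at a
          -- therefore give equal entries at f.
          eq : mul (N ! f) (y₂ ! a) ≡ mul (Z ! f) (y₂ ! a)
          eq = trans (cong (mul (N ! f)) (sym Za)) (trans
                 (cross (K / g) rkg (in/ K kV₂ V₂g) V₂b Va₂ V₂f (in/ K (proj₁ cN) (at dN)) g∋Z)
                       (cong (mul (Z ! f)) Na))

      to-infinity : ∃ λ B → Step O g f zer V₁ B × Step O g f (Z ! f) B U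
      to-infinity = B , first , second

      flat : ∀ {D} → Cov O D → Diff g V₁ y₁ D → Z ! f ≡ zer → D ! f ≡ zer
      flat {D} cD dD h = mul-zer⁻ (trans (mul-comm (y₂ ! a) (D ! f)) (trans (cong (mul (D ! f)) (sym Za))
          (trans (cross (K / g) rkg (in/ K kV₂ V₂g) V₂b Va₂ V₂f (in/ K kD (at dD)) g∋Z)
                (cong (λ t → mul t (D ! a)) h)))) y₂a
        where
        kD : Cov K D
        kD = cD , λ e h → zz dD e (proj₂ kV₁ e h) (proj₂ k₁ e h)

    both-infinite : ∀ f {U₁ U₂} → V₁ ! g ≡ zer → V₁ ! f ≡ zer → V₂ ! g ≡ zer → V₂ ! f ≡ zer →
      y₁ ! a ≢ zer → y₂ ! a ≢ zer → Cov O U₁ → Ht O 1 U₁ → Diff b V₁ y₁ U₁ → Cov O U₂ → Ht O 1 U₂ → Diff b V₂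
            y₂ U₂ →
      Step O g f (Z ! f) U₁ U₂
    both-infinite f {U₁} {U₂} V₁g V₁f V₂g V₂f y₁a y₂a c₁ h₁ d₁ c₂ h₂ d₂
      with lineStep b g (Rank-/ K 2 rk kV₁ (OnP.Vb-nz P₁ y₁a)) (in/ K ku₁ (at d₁)) (in/ K ku₂ (at d₂)) h₁ h₂
             (λ h → g≢ (trans (sym (left d₁ g V₁g)) h)) (trans (left d₁ g V₁g)
                   (trans g≡ (sym (left d₂ g V₂g))))
      where
      ku₁ : Cov K U₁
      ku₁ = c₁ , λ e h → zz d₁ e (proj₂ kV₁ e h) (proj₂ k₁ e h)
      ku₂ : Cov K U₂
      ku₂ = c₂ , λ e h → zz d₂ e (proj₂ kV₂ e h) (proj₂ k₂ e h)
    ... | N , cN , dN , st = subst (λ t → Step O g f t U₁ U₂) (sym dirs) (st f)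
      where
      g∋N : Cov (K / g) N
      g∋N = in/ K (proj₁ cN) (at dN)
      limit : ∀ {X} → Cov (K / g) X → X ! f ≢ zer → ∀ i → V₂ ! i ≡ V₁ ! i
      limit cX nz = line-same (K / g) rkg cX nz (in/ K kV₂ V₂g) V₂f (in/ K kV₁ V₁g) V₁f (OnP.Vb-nz P₁ y₁a)
        (sym (mul-cancelˡ γ≢ (trans (sym (OnP.ya P₁)) (trans (a-swap y₁a y₂a) (OnP.ya P₂)))))
      equal : (∀ i → V₂ ! i ≡ V₁ ! i) → Z ! f ≡ N ! f
      equal eq = mul-cancelʳ {Z ! e₁} (proj₂ Z-nz)
          (trans (cong (mul (Z ! f)) (sym Ne)) (cross (K / g) rkg (in/ K kV₁ V₁g) (OnP.Vb-nz P₁ y₁a) V₁-e₁ V₁f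
                g∋Z g∋N))
        where
        Ne : N ! e₁ ≡ Z ! e₁
        Ne = trans (left dN e₁ (trans (left d₁ e₁ V₁-e₁) (proj₁ (proj₂ sp₁))))
               (trans (left d₂ e₁ (trans (eq e₁) V₁-e₁)) (sym Z-e₁))
      -- If one of the signs is nonzero, f is no loop on g, so `V₁` and `V₂`, both on f and g,
      -- coincide. Then f and `e₁` are proportional on g, and equality at `e₁` gives equality at f.
      dirs : Z ! f ≡ N ! f
      dirs with Z ! f ≟ₛ zer | N ! f ≟ₛ zer
      ... | yes p | yes q = trans p (sym q)
      ... | no p | _ = equal (limit g∋Z p)
      ... | yes _ | no q = equal (limit g∋N q)

    -- The height of `y₁` is infinite with the sign of f at `V₁`, while `y₂` is finite, or is at the
    -- limit on f; so every such edge leaves `y₁` against that sign.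
    escape : ∀ f → V₁ ! g ≡ zer → V₁ ! f ≢ zer → (V₂ ! g ≡ zer → V₂ ! f ≡ zer) → Z ! f ≡ opp (V₁ ! f)
    escape f V₁g V₁f h with choice₂ | V₂ ! g ≟ₛ zer
    ... | inj₁ (e , p , q) | no V₂g = trans (sym (fromW (Wf f))) (trans (W≡ f) (-! V₁ f))
      where
      W≡ : ∀ i → W ! i ≡ (- V₁ ᵛ) ! i
      W≡ = W-is {e = e} a∋V₂ V₂g (L1 (K / a) a∋V₁) (neg-⊑ V₁ g V₁g)
             (trans (-! V₁ e) (trans (cong opp (OnP.Vg≡ P₁ q)) (sym (right dZ e p)))) (λ k → q (⊑-neg V₁ e k))
      fromW : W ! f ≡ zer ⊎ W ! f ≡ Z ! f → W ! f ≡ Z ! f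
      fromW (inj₁ z) = ⊥-elim (V₁f (⊑-neg V₁ f (trans (sym (W≡ f)) z)))
      fromW (inj₂ z) = z
    ... | inj₁ (e , p , q) | yes V₂g = mul-opp-cancelʳ {V₁ ! e} q
        (trans (cross (K / g) rkg (in/ K kV₂ V₂g) (proj₂ V₂-nz) (OnP.V⊑y P₂ e p) (h V₂g) g∋Z (in/ K kV₁ V₁g))
          (cong (mul (V₁ ! f)) (trans (right dZ e p) (cong opp (sym (OnP.Vg≡ P₁ q))))))
    ... | inj₂ (τ , m) | no V₂g = ⊥-elim (V₁f (trans (m f) (cong (λ t → mul t (V₂ ! f))
          (mul-zer⁻ (trans (mul-comm (V₂ ! g) τ) (trans (sym (m g)) V₁g)) V₂g))))
    ... | inj₂ (τ , m) | yes V₂g = ⊥-elim (V₁f (trans (m f) (trans (cong (mul τ) (h V₂g)) (mul-zerʳ τ))))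

    module Directions (f : Fin n) {D₁ D₂ : SV n} (cD₁ : Cov O D₁) (dD₁ : Diff g V₁ y₁ D₁)
      (cD₂ : Cov O D₂) (dD₂ : Diff g V₂ y₂ D₂) where

      private
        kD₁ : Cov (K / g) D₁
        kD₁ = in/ K (cD₁ , λ e h → zz dD₁ e (proj₂ kV₁ e h) (proj₂ k₁ e h)) (at dD₁)

        kD₂ : Cov (K / g) D₂
        kD₂ = in/ K (cD₂ , λ e h → zz dD₂ e (proj₂ kV₂ e h) (proj₂ k₂ e h)) (at dD₂)

        Da₁ : D₁ ! a ≡ y₁ ! a
        Da₁ = left dD₁ a Va₁

        Da₂ : D₂ ! a ≡ y₂ ! a
        Da₂ = left dD₂ a Va₂

      from-old : W ! f ≡ zer → y₁ ! a ≡ zer → Z ! f ≡ D₂ ! f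
      from-old h z = mul-cancelʳ {y₂ ! a} (other new) (trans (cong (mul (Z ! f)) (sym Da₂))
                       (trans (crossW h kD₂) (cong (mul (D₂ ! f)) (left dZ a z))))
        where
        other : y₁ ! a ≢ zer ⊎ y₂ ! a ≢ zer → y₂ ! a ≢ zer
        other (inj₁ k) = ⊥-elim (k z)
        other (inj₂ k) = k

      private
        -- On g the elements f and a are proportional, both vanishing at `W`. The entries at a of
        -- `D₁` and `Z` are γ times the entries at b of `V₁` and `W`, and γ cancels.
        weigh : W ! f ≡ zer → mul (Z ! f) (V₁ ! b) ≡ mul (D₁ ! f) (W ! b)
        weigh h = mul-swap-cancel γ {Z ! f} {V₁ ! b} {D₁ ! f} {W ! b} γ≢ (trans (cong (mul (Z ! f))
              (sym (trans Da₁ (OnP.ya P₁))))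
                    (trans (crossW h kD₁) (cong (mul (D₁ ! f)) (OnP.ya PZ))))

      compare : Ht O 1 V₁ → Ht O 1 V₂ → Ht O 1 D₁ → Ht O 1 D₂ → V₁ ! g ≢ zer → V₂ ! g ≢ zer →
        y₁ ! a ≢ zer → y₂ ! a ≢ zer → V₁ ≡ V₂ ⊎ (V₁ ≢ V₂ × W ! f ≡ zer) → Compare g f (Z ! f) V₁ D₁ V₂ D₂
      compare hV₁ hV₂ hD₁ hD₂ V₁g V₂g y₁a y₂a c
        with lineStep g a rkg kD₁ kD₂ hD₁ hD₂ (λ h → y₁a (trans (sym Da₁) h))
              (trans Da₁ (trans (a-swap y₁a y₂a) (sym Da₂)))
      ... | N , cN , dN , st = go c
        where
        D₁a : D₁ ! a ≢ zer
        D₁a h = y₁a (trans (sym Da₁) h)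
        go : V₁ ≡ V₂ ⊎ (V₁ ≢ V₂ × W ! f ≡ zer) → Compare g f (Z ! f) V₁ D₁ V₂ D₂
        go (inj₂ (ne , h)) = moved (V-step hV₁ hV₂ V₁g V₂g ne b) (weigh h)
            (mul-cancelʳ {D₂ ! a} (λ k → y₂a (trans (sym Da₂) k))
              (trans (cross (K / g) rkg g∋W (proj₂ W-nz) Wa h kD₁ kD₂) (cong (mul (D₂ ! f))
                    (trans Da₁ (trans (a-swap y₁a y₂a) (sym Da₂))))))
            (subst (λ t → Step O a f t D₁ D₂) (vanish f h) (st f))
            (λ h' → subst (λ t → Step O a b t D₁ D₂) (vanish b h') (st b))
          where
          vanish : ∀ i → W ! i ≡ zer → N ! i ≡ zer
          vanish i k with line-unique (K / g) rkg kD₁ D₁a cN (at dN) g∋W Wa (proj₂ W-nz)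
          ... | τ , m = trans (m i) (trans (cong (mul τ) k) (mul-zerʳ τ))
        go (inj₁ eq) = fixed eq (st f) (st b) (d₃ (Wf f)) (λ h → trans (weigh (trans (same-W f) h))
              (cong (mul (D₁ ! f)) (same-W b)))
          where
          same-W : ∀ i → W ! i ≡ N ! i
          same-W = W-is′ {e = e₁} kD₁ D₁a cN (at dN) (trans Ne (sym Z-e₁)) (λ h → proj₂ (proj₂ sp₁)
                (trans (sym Ne) h))
            where
            Ne : N ! e₁ ≡ y₂ ! e₁
            Ne = trans (left dN e₁ (trans (left dD₁ e₁ V₁-e₁) (proj₁ (proj₂ sp₁)))) (left dD₂ e₁
                  (subst (λ V → V ! e₁ ≡ zer) eq V₁-e₁))
          d₃ : W ! f ≡ zer ⊎ W ! f ≡ Z ! f → N ! f ≡ zer ⊎ N ! f ≡ Z ! f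
          d₃ (inj₁ h) = inj₁ (trans (sym (same-W f)) h)
          d₃ (inj₂ h) = inj₂ (trans (sym (same-W f)) h)

-- Closed walks in the extension

Restrict : {A : Set} (P : A → Set) → (Sign → A → A → Set) → Sign → Σ A P → Σ A P → Set
Restrict P R d u v = R d (proj₁ u) (proj₁ v)

-- Making the property part of the vertex lets later maps use its proof. The proofs are chosen once
-- along the walk, so consecutive edges still meet in the same vertex.
restrict : {A : Set} {R : Sign → A → A → Set} {δ : Sign} (P : A → Set) → (∀ {d u v} → R d u v → P u → P v) →
  ∀ {x y} (px : P x) → Star (Up R δ) x y → ∃ λ (py : P y) → Star (Up (Restrict P R) δ) (x , px) (y , py)
restrict P inv px ε = px , ε
restrict P inv px ((d , h , r) ◅ rs) with restrict P inv (inv r px) rs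
... | py , ss = py , (d , h , r) ◅ ss

module _ {n : ℕ} where

  -- At most one step carries the direction and a second one is flat; the two-step forms serve the
  -- route through `B` on the way to a point `U`.
  data Conn (O : OM n) (g f : Fin n) : Sign → SV n → SV n → Set where
    none : ∀ {X} → Conn O g f zer X X
    one  : ∀ {d X Y} → Step O g f d X Y → Conn O g f d X Y
    pre  : ∀ {d X Y Z} → Step O g f zer X Y → Step O g f d Y Z → Conn O g f d X Z
    post : ∀ {d X Y Z} → Step O g f d X Y → Step O g f zer Y Z → Conn O g f d X Z

  Conn-rev : ∀ {O g f d X Y} → Conn O g f d X Y → Conn O g f (opp d) Y X
  Conn-rev none = none
  Conn-rev (one s) = one (Step-rev s)
  Conn-rev (pre s t) = post (Step-rev t) (Step-rev s)
  Conn-rev (post s t) = pre (Step-rev t) (Step-rev s)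

  module _ (O : OM n) (g f : Fin n) (δ : Sign) where

    Below : SV n → SV n → Set
    Below = Star (Up (Step O g f) δ)

    Strict : SV n → SV n → Set
    Strict X Y = ∃ λ P → ∃ λ Q → Below X P × Step O g f δ P Q × Below Q Y

    private
      flat : ∀ {X Y} → Step O g f zer X Y → Below X Y
      flat s = (zer , inj₁ refl , s) ◅ ε

    Conn-below : ∀ {X Y} → Conn O g f zer X Y → Below X Y
    Conn-below none = ε
    Conn-below (one s) = flat s
    Conn-below (pre s t) = flat s ◅◅ flat t
    Conn-below (post s t) = flat s ◅◅ flat t

    Conn-strict : ∀ {X Y} → δ ≢ zer → Conn O g f δ X Y → Strict X Y
    Conn-strict nz none = ⊥-elim (nz refl)
    Conn-strict nz (one s) = _ , _ , ε , s , ε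
    Conn-strict nz (pre s t) = _ , _ , flat s , t , ε
    Conn-strict nz (post s t) = _ , _ , ε , s , flat t

  -- One round of the lexicographic comparison. A strict step in the image would close up to a
  -- directed cycle of `O`, so the image is level all along and every edge satisfies the finer
  -- relation `S`.
  phase : ∀ {A : Set} {R S : Sign → A → A → Set} {δ : Sign} {O : OM n} → NoCycle O → ∀ k h {δ′} → δ′ ≢ zer →
        (ψ : A → SV n) →
    (∀ {d u v} → d ≡ zer ⊎ d ≡ δ → R d u v → ∃ λ d′ → Conn O k h d′ (ψ u) (ψ v) × ((d′ ≡ zer × S d u v) ⊎ d′ ≡
          δ′)) →
    ∀ {x y} → Star (Up R δ) x y → R δ y x → Star (Up S δ) x y × S δ y x
  phase {A} {R} {S} {δ} {O} nc k h {δ′} nz ψ cls = refine (λ u v → Below O k h δ′ (ψ u) (ψ v)) (λ u v → Strict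
        O k h δ′ (ψ u) (ψ v))
      ε _◅◅_ (λ { (_ , _ , p , s , q) → p ◅◅ ((δ′ , inj₂ refl , s) ◅ q) })
      (λ { (_ , _ , p , s , q) r → nc k h nz (q ◅◅ (r ◅◅ p)) s }) cls′
    where
    cls′ : ∀ {d u v} → d ≡ zer ⊎ d ≡ δ → R d u v → (Below O k h δ′ (ψ u) (ψ v) × S d u v) ⊎ Strict O k h δ′
          (ψ u) (ψ v)
    cls′ e r with cls e r
    ... | _ , c , inj₁ (refl , s) = inj₁ (Conn-below O k h δ′ c , s)
    ... | _ , c , inj₂ refl = inj₂ (Conn-strict O k h δ′ nz c)

module Lexicographic {n : ℕ} (O : OM n) (a : Fin n) (α : Sign) (b : Fin n) (β : Sign) (α≢ : α ≢ zer)
      (β≢ : β ≢ zer) where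

  open LexExtension O a α b β public

  -- For y close to V, the vanishing of αa + εβb at y says that a at y has the sign of -αβ times b
  -- at V.
  γ : Sign
  γ = opp (mul α β)

  γ≢ : γ ≢ zer
  γ≢ = opp-nz (mul-nz α≢ β≢)

  open Extension O a b γ γ≢ public

  A-zer⁻ : ∀ {X} → A X ≡ zer → X ! a ≡ zer
  A-zer⁻ h = mul-zer⁻ h α≢

  B-zer⁻ : ∀ {X} → B X ≡ zer → X ! b ≡ zer
  B-zer⁻ h = mul-zer⁻ h β≢

  canon-zer : ∀ {X} → X ! a ≡ zer → X ! b ≡ zer → canon X ≡ zer
  canon-zer p q = cong₂ comp (trans (cong (mul α) p) (mul-zerʳ α)) (trans (cong (mul β) q) (mul-zerʳ β))

  canon-zer⁻ : ∀ {X} → canon X ≡ zer → X ! a ≡ zer × X ! b ≡ zer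
  canon-zer⁻ {X} h with comp-zer⁻ {A X} h
  ... | p , q = A-zer⁻ {X} p , B-zer⁻ {X} q

  lift : ∀ {X} → Cov O X → Cov′ (canon X ∷ X)
  lift c = c , inj₁ refl

  Ht-old : ∀ m {t X} → (t ≡ zer → X ! a ≡ zer × X ! b ≡ zer) → Ht lex m (t ∷ X) → Ht O m X
  Ht-old zero _ h e = h (fsuc e)
  Ht-old (suc m) {t} {X} c h U cU p e u w =
      Ht-old m (λ q → canon-zer⁻ {U} q) (h (canon U ∷ U) (lift cU) below′ (fsuc e) u w)
    where
    below′ : canon U ∷ U ⊑ t ∷ X
    below′ fzero q = canon-zer {U} (p a (proj₁ (c q))) (p b (proj₂ (c q)))
    below′ (fsuc i) q = p i q

  -- If `U` is off p, it is moved onto p by eliminating p against `U₃`. The entries at zeros of `U₃`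
  -- stay those of `U`, which keeps the drops of a chain strict.
  section : ∀ {U U₃} → Cov O U → Cov O U₃ → canon U₃ ≢ zer → U₃ ⊑ U →
    ∃ λ U′ → Cov′ (zer ∷ U′) × U′ ⊑ U × (∀ x → U₃ ! x ≡ zer → U′ ! x ≡ U ! x)
  section {U} {U₃} cU cU₃ nz p with canon U ≟ₛ zer
  ... | yes q = U , subst (λ t → Cov′ (t ∷ U)) q (lift cU) , (λ _ h → h) , λ _ _ → refl
  ... | no q with cancel lex fzero (lift cU₃) (lift cU) nz q
  ... | t ∷ N , cN , refl , left = N , cN , (λ e h → trans (left (fsuc e) (p e h)) h) , λ x → left (fsuc x)

  cons-⊑ : ∀ {X Y : SV n} {s t} → (t ≡ zer → s ≡ zer) → X ⊑ Y → s ∷ X ⊑ t ∷ Y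
  cons-⊑ h p fzero = h
  cons-⊑ h p (fsuc e) = p e

  -- Cutting with p costs at most one dimension: a chain of covectors of `O` that is too long would,
  -- pushed onto p by `section`, give one on p that is too long.
  Ht-point : ∀ {T} → Ht lex 1 (zer ∷ T) → Ht O 2 T
  Ht-point {T} h U cU p e u w U₂ cU₂ p₂ e₂ u₂ w₂ with canon U₂ ≟ₛ zer
  ... | yes q = λ i → h (zer ∷ U₂) (subst (λ t → Cov′ (t ∷ U₂)) q (lift cU₂)) (cons-⊑ {U₂} {T} (λ _ → refl)
        (λ i r → p₂ i (p i r))) (fsuc e) (p₂ e u) w (fsuc i)
  ... | no q with section cU cU₂ q p₂
  ... | U′ , c′ , p′ , h′ = ⊥-elim (w₂ (trans (sym (h′ e₂ u₂)) (h (zer ∷ U′) c′ (cons-⊑ {U′} {T} (λ _ → refl)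
        (λ i r → p′ i (p i r))) (fsuc e) (p′ e u) w (fsuc e₂))))

  Ht-line : ∀ {T} → Ht lex 2 (zer ∷ T) → Ht O 3 T
  Ht-line {T} h U cU p e u w U₂ cU₂ p₂ e₂ u₂ w₂ U₃ cU₃ p₃ e₃ u₃ w₃ = go (canon U₃ ≟ₛ zer) (canon U₂ ≟ₛ zer)
    where
    chain : ∀ {M N} i → Cov′ (zer ∷ N) → N ⊑ U → Cov′ (zer ∷ M) → M ⊑ N → M ! i ≡ zer → N ! i ≢ zer → ∀ x → M
          ! x ≡ zer
    chain {M} {N} i cN pN cM pM m nz x =
      h (zer ∷ N) cN (cons-⊑ {N} {T} (λ _ → refl) (λ i r → pN i (p i r))) (fsuc e) (pN e u) w
        (zer ∷ M) cM (cons-⊑ {M} {N} (λ _ → refl) pM) (fsuc i) m nz (fsuc x)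
    flat : ∀ {X} → Cov O X → canon X ≡ zer → Cov′ (zer ∷ X)
    flat {X} c q = subst (λ t → Cov′ (t ∷ X)) q (lift c)
    go : Dec (canon U₃ ≡ zer) → Dec (canon U₂ ≡ zer) → ∀ x → U₃ ! x ≡ zer
    go (yes q₃) (yes q₂) = chain e₃ (flat cU₂ q₂) p₂ (flat cU₃ q₃) p₃ u₃ w₃
    go (yes q₃) (no q₂) with section cU cU₂ q₂ p₂
    ... | U′ , c′ , p′ , h′ = chain e₂ (L2 lex {zer ∷ U₃} {zer ∷ U′} (flat cU₃ q₃) c′)
            (∘-⊑ {X = U₃} {U′} {U} (λ i r → p₃ i (p₂ i r)) p′) (flat cU₃ q₃) (⊑-∘ˡ U₃ U′) (p₃ e₂ u₂)
            (∘-nzʳ {X = U₃} {U′} (λ r → w₂ (trans (sym (h′ e₂ u₂)) r)))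
    go (no q₃) _ with section cU cU₃ q₃ (λ i r → p₃ i (p₂ i r)) | section cU₂ cU₃ q₃ p₃
    ... | U′ , c′ , p′ , h′ | N , cN , pN , hN = ⊥-elim (w₃ (trans (sym (hN e₃ u₃))
            (chain e₂ (L2 lex {zer ∷ N} {zer ∷ U′} cN c′) (∘-⊑ {X = N} {U′} {U} (λ i r → pN i (p₂ i r)) p′) cN
                  (⊑-∘ˡ N U′) (pN e₂ u₂)
              (∘-nzʳ {X = N} {U′} (λ r → w₂ (trans (sym (h′ e₂ (p₃ e₂ u₂))) r))) e₃)))

  onP-old : ∀ {y} → Cov O y → y ! a ≡ zer → y ! b ≡ zer → OnP y
  onP-old {y} c p q = record
    { cy = c ; V = y ; cV = c ; V≼y = λ _ → inj₂ refl ; Va = p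
    ; ya = trans p (sym (trans (cong (mul γ) q) (mul-zerʳ γ))) ; old = λ _ _ → refl }

  Wit-nz : ∀ {y} → Wit y → y ! a ≢ zer
  Wit-nz (wit V cV V≼X AV BV BVX) h = BV (trans BVX (cong opp (trans (cong (mul α) h) (mul-zerʳ α))))

  onP-wit : ∀ {y} → Cov O y → Wit y → OnP y
  onP-wit {y} c w@(wit V cV V≼X AV BV BVX) = record
    { cy = c ; V = V ; cV = cV ; V≼y = V≼X ; Va = A-zer⁻ {V} AV ; ya = side ; old = λ h → ⊥-elim (Wit-nz w h)
          }
    where
    side : y ! a ≡ mul γ (V ! b)
    side = trans (sym (mul-invˡ (y ! a) α≢)) (trans (cong (mul α) (trans (sym (opp-opp _))
          (cong opp (sym BVX))))
             (trans (mul-oppʳ α (B V)) (trans (cong opp (sym (mul-assoc α β (V ! b))))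
                   (sym (mul-oppˡ (mul α β) (V ! b))))))

  onP : ∀ {y} → Cov′ (zer ∷ y) → OnP y
  onP {y} (c , inj₁ h) = onP-old c (proj₁ (canon-zer⁻ {y} (sym h))) (proj₂ (canon-zer⁻ {y} (sym h)))
  onP {y} (c , inj₂ w) = onP-wit c w

  record New (s : Sign) (y : SV n) : Set where
    field
      s≡  : s ≡ zer
      on  : OnP y
      a≢  : y ! a ≢ zer
      hV  : Ht O 1 (OnP.V on)
      hy  : Ht O 2 y
    open OnP on public

    V-b : V ! b ≢ zer
    V-b = Vb-nz a≢

  record Old (s : Sign) (y : SV n) : Set where
    field
      cy  : Cov O y
      hy  : Ht O 1 y
      s≡  : s ≡ canon y

  classify : ∀ s y → Cov′ (s ∷ y) → Ht lex 1 (s ∷ y) → Old s y ⊎ New s y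
  classify s y (c , inj₁ h) ht = inj₁ record
    { cy = c ; hy = Ht-old 1 {s} {y} (λ q → canon-zer⁻ {y} (trans (sym h) q)) ht ; s≡ = h }
  classify s y (c , inj₂ w) ht with s ≟ₛ zer
  ... | yes refl = inj₂ record { s≡ = refl ; on = onP-wit c w ; a≢ = Wit-nz w ; hV = hV ; hy = Ht-point {y} ht
        }
    where
    hV : Ht O 1 (Wit.V w)
    hV = Ht-point {y} ht (Wit.V w) (Wit.cV w) (≼⇒⊑ {X = Wit.V w} {y} (Wit.V≼X w)) a (A-zer⁻ {Wit.V w}
          (Wit.AV w)) (Wit-nz w)
  -- A witness also permits the sign zero, so `zer ∷ y` would be a nonzero covector of strictly
  -- smaller support.
  ... | no s≢ = ⊥-elim (Wit-nz w (ht (zer ∷ y) (c , inj₂ w) (cons-⊑ {y} {y} (λ _ → refl) (λ _ r → r)) fzero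
        refl s≢ (fsuc a)))

-- Edges of the extension and their images in `O`

module Program {n : ℕ} (O : OM n) (a : Fin n) (α : Sign) (b : Fin n) (β : Sign) (α≢ : α ≢ zer) (β≢ : β ≢ zer)
  (g f : Fin n) where

  open Lexicographic O a α b β α≢ β≢

  record Edge (d s : Sign) (y : SV n) (s′ : Sign) (y′ : SV n) : Set where
    field
      zp   : Sign
      Z    : SV n
      cZ   : Cov′ (zp ∷ Z)
      dZ   : Diff g y y′ Z
      zp≡  : s ≡ zer → s′ ≡ zer → zp ≡ zer
      dir  : Z ! f ≡ d
      ht   : Ht lex 2 (comp s s′ ∷ (y ∘ᵛ y′))
      g≢   : y ! g ≢ zer
      g≡   : y ! g ≡ y′ ! g
      conf : Conformal (s ∷ y) (s′ ∷ y′)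
      sp₁  : ∃ λ e → (s ∷ y) ! e ≡ zer × (s′ ∷ y′) ! e ≢ zer
      sp₂  : ∃ λ e → (s′ ∷ y′) ! e ≡ zer × (s ∷ y) ! e ≢ zer

  toEdge : ∀ {d s y s′ y′} → CStep lex (fsuc g) (fsuc f) d (s ∷ y) (s′ ∷ y′) → Edge d s y s′ y′
  toEdge {d} {s} {y} {s′} {y′} (mkStep cX cY hX hY gX gXY line (zp ∷ Z) cZ dZ dir , conf , ne) = record
    { zp = zp ; Z = Z ; cZ = cZ
    ; dZ = mkDiff (at dZ) (λ e → off dZ (fsuc e)) (λ e → zz dZ (fsuc e))
    ; zp≡ = zz dZ fzero ; dir = dir ; ht = line ; g≢ = gX ; g≡ = gXY ; conf = conf
    ; sp₁ = sp (splitter lex {s ∷ y} {s′ ∷ y′} {fsuc g} cX hX cY gX gXY) ne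
    ; sp₂ = sp (splitter lex {s′ ∷ y′} {s ∷ y} {fsuc g} cY hY cX (λ h → gX (trans gXY h)) (sym gXY))
          (ne ∘ sym) }
    where
    sp : ∀ {X Y : SV (suc n)} → (∃ λ e → X ! e ≡ zer × Y ! e ≢ zer) ⊎ (∀ e → X ! e ≡ Y ! e) → X ≢ Y →
      ∃ λ e → X ! e ≡ zer × Y ! e ≢ zer
    sp (inj₁ p) _ = p
    sp (inj₂ p) ne = ⊥-elim (ne (ext p))

  Edge-rev : ∀ {d s y s′ y′} → Edge d s y s′ y′ → Edge (opp d) s′ y′ s y
  Edge-rev {d} {s} {y} {s′} {y′} E = record
    { zp = opp zp ; Z = - Z ᵛ ; cZ = L1 lex {zp ∷ Z} cZ ; dZ = Diff-rev dZ
    ; zp≡ = λ p q → cong opp (zp≡ q p) ; dir = trans (-! Z f) (cong opp dir)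
    ; ht = Ht-mono lex 2 ((s′ ∷ y′) ∘ᵛ (s ∷ y)) ((s ∷ y) ∘ᵛ (s′ ∷ y′)) (∘-comm-⊑ (s′ ∷ y′) (s ∷ y)) ht
    ; g≢ = λ h → g≢ (trans g≡ h) ; g≡ = sym g≡ ; conf = λ e o → conf e (opposite-sym o)
    ; sp₁ = sp₂ ; sp₂ = sp₁ }
    where open Edge E

  drop-p : ∀ {y y′ : SV n} → (∃ λ e → (zer ∷ y) ! e ≡ zer × (zer ∷ y′) ! e ≢ zer) → ∃ λ e → y ! e ≡ zer × y′ !
        e ≢ zer
  drop-p (fzero , _ , q) = ⊥-elim (q refl)
  drop-p (fsuc e , p , q) = e , p , q

  module OnPlane {d y₁ y₂} (E : Edge d zer y₁ zer y₂) (P₁ : OnP y₁) (P₂ : OnP y₂) (new : y₁ ! a ≢ zer ⊎ y₂ ! a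
        ≢ zer) where
    open Edge E public
    PZ : OnP Z
    PZ = onP (subst (λ t → Cov′ (t ∷ Z)) (zp≡ refl refl) cZ)
    open Plane g P₁ P₂ PZ (Ht-line {y₁ ∘ᵛ y₂} ht) dZ g≢ g≡ (conf (fsuc a)) new (drop-p sp₁) (drop-p sp₂)
          public
      using (V-step; module ToInfinity; both-infinite; escape; module Directions; Wf)

    W : SV n
    W = OnP.V PZ

  -- y₁ is off p, so the edge runs along the line of O that carries the new vertex y₂.
  module OldNew {d s y₁ s₂ y₂} (E : Edge d s y₁ s₂ y₂) (s≢ : s ≢ zer) (o : Old s y₁) (N : New s₂ y₂) where
    open Edge E
    open New N using (V; V-b; a≢; hV; Va) renaming (cV to cV₂; V⊑y to V⊑)
    open Old o renaming (cy to cy₁; hy to hy₁)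

    line : Ht O 2 (y₁ ∘ᵛ y₂)
    line = Ht-old 2 {comp s s₂} {y₁ ∘ᵛ y₂} (λ h → ⊥-elim (s≢ (proj₁ (comp-zer⁻ {s} h)))) ht

    K : OM n
    K = O ↓ (y₁ ∘ᵛ y₂)

    rk : Rank K 2
    rk = Rank-↓ O 2 (y₁ ∘ᵛ y₂) line

    k₁ : Cov K y₁
    k₁ = cy₁ , ⊑-∘ˡ y₁ y₂

    inK : ∀ {X} → Cov O X → X ⊑ y₂ → Cov K X
    inK c p = c , λ e h → p e (⊑-∘ʳ y₁ y₂ e h)

    kV : Cov K V
    kV = inK cV₂ V⊑

    kZ : Cov K Z
    kZ = proj₁ cZ , below dZ

    mkLine : ∀ {X} → Cov O X → X ⊑ y₂ → Ht O 1 X → y₁ ! g ≡ X ! g → ∃ λ N → Cov K N × Diff g y₁ X N ×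
          (∀ h → Step O g h (N ! h) y₁ X)
    mkLine {X} c p hX eq with diff K g k₁ (inK c p) eq g≢
    ... | N , cN , dN = N , cN , dN , λ h → mkStep cy₁ c hy₁ hX g≢ eq
           (Ht-mono O 2 (y₁ ∘ᵛ X) (y₁ ∘ᵛ y₂) (∘-⊑ {X = y₁} {X} {y₁ ∘ᵛ y₂} (⊑-∘ˡ y₁ y₂) (λ e h → p e
                 (⊑-∘ʳ y₁ y₂ e h))) line) N (proj₁ cN) dN refl

    -- `Z` is nonzero, hence it spans the only point on g of the line; where it lies on f, every
    -- covector of the line on g does.
    at-infinity : ∀ {X} → Cov K X → X ! g ≡ zer → Z ! f ≡ zer → X ! f ≡ zer
    at-infinity {X} cX Xg h with Z-nonzero
      where
      Z-nonzero : ∃ λ u → Z ! u ≢ zer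
      Z-nonzero with y₁ ! a ≟ₛ zer
      ... | yes p = a , λ q → a≢ (trans (sym (left dZ a p)) q)
      ... | no p with separate O {y₁} {V} cy₁ hy₁ cV₂ g≢
      ... | inj₁ (e , q , r) = e , λ z → r (V⊑ e (trans (sym (left dZ e q)) z))
      ... | inj₂ (τ , m) = ⊥-elim (V-b (trans (m b) (cong (λ t → mul t (y₁ ! b))
            (mul-zer⁻ (trans (mul-comm (y₁ ! a) τ) (trans (sym (m a)) Va)) p))))
    ... | u , nz with line-unique K rk k₁ g≢ cX Xg kZ (at dZ) nz
    ... | τ , m = trans (m f) (trans (cong (mul τ) h) (mul-zerʳ τ))

    to-limit : y₁ ≢ V → V ! g ≢ zer → Step O g f (Z ! f) y₁ V
    to-limit ne Vg with mkLine cV₂ V⊑ hV (trans g≡ (sym (New.Vg≡ N Vg))) | splitter O {y₁} {V} cy₁ hy₁ cV₂ g≢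
          (trans g≡ (sym (New.Vg≡ N Vg)))
    ... | _ | inj₂ eq = ⊥-elim (ne (ext eq))
    ... | N′ , cN , dN , st | inj₁ (e , p , q) = subst (λ t → Step O g f t y₁ V)
            (line-same K rk k₁ g≢ cN (at dN) kZ (at dZ) (λ h → q (trans (New.Vg≡ N q)
                  (trans (sym (left dZ e p)) h)))
              (trans (left dN e p) (trans (New.Vg≡ N q) (sym (left dZ e p)))) f) (st f)

    at-limit : ∀ {D} → y₁ ≡ V → Cov O D → Diff g V y₂ D → Z ! f ≡ D ! f
    at-limit {D} eq cD dD = line-same K rk k₁ g≢ kZ (at dZ) (inK cD (λ e h → zz dD e (V⊑ e h) h)) (at dD)
        (λ h → a≢ (trans (sym (left dD a Va)) h)) (trans (left dZ a (trans (cong (_! a) eq) Va))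
              (sym (left dD a Va))) f

    to-U : ∀ {U} → V ! g ≡ zer → V ! f ≡ zer → Cov O U → Ht O 1 U → Diff b V y₂ U → Step O g f zer y₁ U
    to-U {U} Vg Vf cU hU dU with mkLine cU (λ e h → zz dU e (V⊑ e h) h) hU (trans g≡ (sym (left dU g Vg)))
    ... | N′ , cN , dN , st = subst (λ t → Step O g f t y₁ U) zero′ (st f)
      where
      zero′ : N′ ! f ≡ zer
      zero′ with line-unique K rk k₁ g≢ cN (at dN) kV Vg V-b
      ... | τ , m = trans (m f) (trans (cong (mul τ) Vf) (mul-zerʳ τ))

    flat : V ! g ≡ zer → V ! f ≡ zer → Z ! f ≡ zer
    flat Vg Vf with line-unique K rk k₁ g≢ kZ (at dZ) kV Vg V-b
    ... | τ , m = trans (m f) (trans (cong (mul τ) Vf) (mul-zerʳ τ))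

    out : V ! g ≡ zer → Z ! f ≡ V ! f
    out Vg with separate O {y₁} {V} cy₁ hy₁ cV₂ g≢
    ... | inj₁ (e , p , q) = line-same K rk k₁ g≢ kZ (at dZ) kV Vg q (trans (left dZ e p) (sym (New.Vg≡ N q)))
          f
    ... | inj₂ (τ , m) = ⊥-elim (V-b (trans (m b) (cong (λ t → mul t (y₁ ! b))
          (mul-zer⁻ (trans (mul-comm (y₁ ! g) τ) (trans (sym (m g)) Vg)) g≢))))

  -- The limit V of a new vertex is an affine point (A), a point at infinity on f (B),
  -- or a point at infinity off f (C). In case B the height of y is that of U = L ∩ b.
  record AData (s : Sign) (y : SV n) : Set where
    field
      new : New s y
    open New new public
    field
      Vg  : V ! g ≢ zer
      D   : SV n
      cD  : Cov O D
      hD  : Ht O 1 D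
      dD  : Diff g V y D

  record BData (s : Sign) (y : SV n) : Set where
    field
      new : New s y
    open New new public
    field
      Vg  : V ! g ≡ zer
      Vf  : V ! f ≡ zer
      U   : SV n
      cU  : Cov O U
      hU  : Ht O 1 U
      dU  : Diff b V y U

  record CData (s : Sign) (y : SV n) : Set where
    field
      new : New s y
    open New new public
    field
      Vg  : V ! g ≡ zer
      Vf  : V ! f ≢ zer

  data Finite (s : Sign) (y : SV n) : Set where
    kO : Old s y → Finite s y
    kA : AData s y → Finite s y
    kB : BData s y → Finite s y

  affine : ∀ {s y} (N : New s y) → y ! g ≢ zer → New.V N ! g ≢ zer → AData s y
  affine {s} {y} N g≢ Vg with diff O g {New.V N} {y} (New.cV N) (New.cy N) (New.Vg≡ N Vg) Vg
  ... | D , cD , dD = record { new = N ; Vg = Vg ; D = D ; cD = cD ; dD = dD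
        ; hD = New.hy N D cD (λ e h → zz dD e (New.V⊑y N e h) h) g (at dD) g≢ }

  kind : ∀ s y → Cov′ (s ∷ y) → Ht lex 1 (s ∷ y) → y ! g ≢ zer → Finite s y ⊎ CData s y
  kind s y c h g≢ with classify s y c h
  ... | inj₁ o = inj₁ (kO o)
  ... | inj₂ N with New.V N ! g ≟ₛ zer | New.V N ! f ≟ₛ zer
  ... | no p | _ = inj₁ (kA (affine N g≢ p))
  ... | yes p | no q = inj₂ record { new = N ; Vg = p ; Vf = q }
  ... | yes p | yes q with diff O b {New.V N} {y} (New.cV N) (New.cy N) (New.Vg≡ N (New.V-b N)) (New.V-b N)
  ... | U , cU , dU = inj₁ (kB record { new = N ; Vg = p ; Vf = q ; U = U ; cU = cU ; dU = dU
        ; hU = New.hy N U cU (λ e h → zz dU e (New.V⊑y N e h) h) b (at dU) (λ h → New.V-b N (New.V⊑y N b h))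
              })

  limit : ∀ {s y} → Finite s y → SV n
  limit {y = y} (kO _) = y
  limit (kA A) = AData.V A
  limit (kB B) = BData.V B

  -- A zero slope records that the vertex and its image `φ` have exactly the same height. For a
  -- vertex with affine limit, f at `D` is the sign of the infinitesimal offset between them.
  slope : ∀ {s y} → Finite s y → SV n
  slope (kO _) = zeroV
  slope (kA A) = AData.D A
  slope (kB _) = zeroV

  θ : ∀ {s y} → Finite s y → Sign
  θ k = slope k ! f

  φ : ∀ {s y} → Finite s y → SV n
  φ {y = y} (kO _) = y
  φ (kA A) = AData.V A
  φ (kB B) = BData.U B

  -- The tie-break between images of equal height: if one offset vanishes, the sign of the other
  -- decides; two nonzero offsets need the finer comparison.
  data Good (d : Sign) {s y s′ y′} (k : Finite s y) (k′ : Finite s′ y′) : Set where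
    fromZero : θ k ≡ zer → d ≡ θ k′ → Good d k k′
    toZero   : θ k′ ≡ zer → d ≡ opp (θ k) → Good d k k′
    compared : Compare g f d (limit k) (slope k) (limit k′) (slope k′) →
      limit k ! b ≢ zer → limit k ! b ≡ limit k′ ! b → Good d k k′

  record Collapse (d : Sign) {s y s′ y′} (k : Finite s y) (k′ : Finite s′ y′) : Set where
    constructor collapse
    field
      d₀   : Sign
      conn : Conn O g f d₀ (φ k) (φ k′)
      d₀≡  : d₀ ≡ zer ⊎ d₀ ≡ d
      good : d₀ ≡ zer → Good d k k′

  oldOn : ∀ {y} → Old zer y → OnP y
  oldOn {y} o = onP-old (Old.cy o) (proj₁ (canon-zer⁻ {y} (sym (Old.s≡ o))))
        (proj₂ (canon-zer⁻ {y} (sym (Old.s≡ o))))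

  old-a : ∀ {y} → Old zer y → y ! a ≡ zer
  old-a {y} o = proj₁ (canon-zer⁻ {y} (sym (Old.s≡ o)))

  old-b : ∀ {y} → Old zer y → y ! b ≡ zer
  old-b {y} o = proj₂ (canon-zer⁻ {y} (sym (Old.s≡ o)))

  exact : ∀ {d s y s′ y′} {k : Finite s y} {k′ : Finite s′ y′} → Conn O g f d (φ k) (φ k′) → (d ≡ zer → Good d
        k k′) → Collapse d k k′
  exact c h = collapse _ c (inj₂ refl) h

  collapse-OO : ∀ {d s y s′ y′} → Edge d s y s′ y′ → (o : Old s y) (o′ : Old s′ y′) → Collapse d (kO o)
        (kO o′)
  collapse-OO {d} {s} {y} {s′} {y′} E o o′ = exact (one (mkStep (Old.cy o) (Old.cy o′) (Old.hy o) (Old.hy o′)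
        g≢ g≡
      (Ht-old 2 {comp s s′} {y ∘ᵛ y′} both ht) Z (proj₁ cZ) dZ dir)) (λ h → fromZero (zeroV! f)
            (trans h (sym (zeroV! f))))
    where
    open Edge E
    both : comp s s′ ≡ zer → (y ∘ᵛ y′) ! a ≡ zer × (y ∘ᵛ y′) ! b ≡ zer
    both h with comp-zer⁻ {s} h
    ... | p , q with canon-zer⁻ {y} (trans (sym (Old.s≡ o)) p) | canon-zer⁻ {y′} (trans (sym (Old.s≡ o′)) q)
    ... | p₁ , p₂ | q₁ , q₂ = ∘-zer {X = y} {y′} p₁ q₁ , ∘-zer {X = y} {y′} p₂ q₂

  collapse-OA : ∀ {d s y s′ y′} → Edge d s y s′ y′ → (o : Old s y) (A : AData s′ y′) → Collapse d (kO o)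
        (kA A)
  collapse-OA {d} {s} {y} {s′} {y′} E o A with s ≟ₛ zer
  ... | no s≢ = go (≡-dec _≟ₛ_ y (AData.V A))
    where
    open OldNew E s≢ o (AData.new A)
    go : Dec (y ≡ AData.V A) → Collapse d (kO o) (kA A)
    go (yes eq) = collapse zer (subst (Conn O g f zer y) eq none) (inj₁ refl)
      (λ _ → fromZero (zeroV! f) (trans (sym (Edge.dir E)) (at-limit eq (AData.cD A) (AData.dD A))))
    go (no ne) = exact (one (subst (λ t → Step O g f t y (AData.V A)) (Edge.dir E) (to-limit ne
          (AData.Vg A))))
      (λ h → fromZero (zeroV! f) (trans h (sym (at-infinity (inK (AData.cD A) (λ e h → zz (AData.dD A) e
            (AData.V⊑y A e h) h))
                (at (AData.dD A)) (trans (Edge.dir E) h)))))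
  ... | yes refl with AData.s≡ A
  ... | refl = collapse (W ! f) (one (V-step (Old.hy o) (AData.hV A) (Edge.g≢ E) (AData.Vg A) ne f)) d₀≡
      (λ h → fromZero (zeroV! f) (trans (sym (Edge.dir E)) (Dirs.from-old h (old-a o))))
    where
    open OnPlane E (oldOn o) (AData.on A) (inj₂ (AData.a≢ A)) using (V-step; W; Wf; module Directions)
    ne : y ≢ AData.V A
    ne eq = AData.V-b A (trans (cong (_! b) (sym eq)) (old-b o))
    d₀≡ : W ! f ≡ zer ⊎ W ! f ≡ d
    d₀≡ with Wf f
    ... | inj₁ h = inj₁ h
    ... | inj₂ h = inj₂ (trans h (Edge.dir E))
    self : ∃ λ D → Cov O D × Diff g y y D
    self = diff O g (Old.cy o) (Old.cy o) refl (Edge.g≢ E)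
    module Dirs = Directions f (proj₁ (proj₂ self)) (proj₂ (proj₂ self)) (AData.cD A) (AData.dD A)

  collapse-AA : ∀ {d s y s′ y′} → Edge d s y s′ y′ → (A : AData s y) (A′ : AData s′ y′) → Collapse d (kA A)
        (kA A′)
  collapse-AA {d} {s} {y} {s′} {y′} E A A′ with AData.s≡ A | AData.s≡ A′
  ... | refl | refl = go (≡-dec _≟ₛ_ (AData.V A) (AData.V A′))
    where
    open OnPlane E (AData.on A) (AData.on A′) (inj₁ (AData.a≢ A)) using (V-step; W; Wf; module Directions)
    module Dirs = Directions f (AData.cD A) (AData.dD A) (AData.cD A′) (AData.dD A′)
    Vb≡ : AData.V A ! b ≡ AData.V A′ ! b
    Vb≡ = mul-cancelˡ γ≢ (trans (sym (AData.ya A)) (trans (nosep⇒≡ (Edge.conf E (fsuc a)) (AData.a≢ A)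
          (AData.a≢ A′)) (AData.ya A′)))
    cmp : AData.V A ≡ AData.V A′ ⊎ (AData.V A ≢ AData.V A′ × W ! f ≡ zer) → Good d (kA A) (kA A′)
    cmp c = compared (subst (λ t → Compare g f t (AData.V A) (AData.D A) (AData.V A′) (AData.D A′))
          (Edge.dir E)
      (Dirs.compare (AData.hV A) (AData.hV A′) (AData.hD A) (AData.hD A′) (AData.Vg A) (AData.Vg A′)
            (AData.a≢ A) (AData.a≢ A′) c))
      (AData.V-b A) Vb≡
    go : Dec (AData.V A ≡ AData.V A′) → Collapse d (kA A) (kA A′)
    go (yes eq) = collapse zer (subst (Conn O g f zer (AData.V A)) eq none) (inj₁ refl) (λ _ → cmp (inj₁ eq))
    go (no ne) = collapse (W ! f) (one (V-step (AData.hV A) (AData.hV A′) (AData.Vg A) (AData.Vg A′) ne f))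
          d₀≡ (λ h → cmp (inj₂ (ne , h)))
      where
      d₀≡ : W ! f ≡ zer ⊎ W ! f ≡ d
      d₀≡ with Wf f
      ... | inj₁ h = inj₁ h
      ... | inj₂ h = inj₂ (trans h (Edge.dir E))

  collapse-OB : ∀ {d s y s′ y′} → Edge d s y s′ y′ → (o : Old s y) (B : BData s′ y′) → Collapse d (kO o)
        (kB B)
  collapse-OB {d} {s} {y} {s′} {y′} E o B with s ≟ₛ zer
  ... | no s≢ = subst (λ t → Collapse t (kO o) (kB B)) (sym (trans (sym (Edge.dir E)) (flat (BData.Vg B)
        (BData.Vf B))))
      (exact (one (to-U (BData.Vg B) (BData.Vf B) (BData.cU B) (BData.hU B) (BData.dU B))) (λ _ → fromZero
            (zeroV! f) (sym (zeroV! f))))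
    where open OldNew E s≢ o (BData.new B)
  ... | yes refl with BData.s≡ B
  ... | refl = exact (subst (λ t → Conn O g f t y (BData.U B)) (Edge.dir E) (pre (proj₁ (proj₂ path))
        (proj₂ (proj₂ path))))
      (λ h → fromZero (zeroV! f) (trans h (sym (zeroV! f))))
    where
    open OnPlane E (oldOn o) (BData.on B) (inj₂ (BData.a≢ B)) using (module ToInfinity)
    path = ToInfinity.to-infinity f (Old.hy o) (Edge.g≢ E) (BData.Vg B) (BData.Vf B) (BData.a≢ B) (BData.cU B)
          (BData.hU B) (BData.dU B)

  collapse-AB : ∀ {d s y s′ y′} → Edge d s y s′ y′ → (A : AData s y) (B : BData s′ y′) → Collapse d (kA A)
        (kB B)
  collapse-AB {d} {s} {y} {s′} {y′} E A B with AData.s≡ A | BData.s≡ B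
  ... | refl | refl = exact (subst (λ t → Conn O g f t (AData.V A) (BData.U B)) (Edge.dir E)
        (pre (proj₁ (proj₂ to-infinity)) (proj₂ (proj₂ to-infinity))))
      (λ h → fromZero (flat (AData.cD A) (AData.dD A) (trans (Edge.dir E) h)) (trans h (sym (zeroV! f))))
    where
    open OnPlane E (AData.on A) (BData.on B) (inj₁ (AData.a≢ A)) using (module ToInfinity)
    open ToInfinity f (AData.hV A) (AData.Vg A) (BData.Vg B) (BData.Vf B) (BData.a≢ B) (BData.cU B)
          (BData.hU B) (BData.dU B)

  collapse-BB : ∀ {d s y s′ y′} → Edge d s y s′ y′ → (B : BData s y) (B′ : BData s′ y′) → Collapse d (kB B)
        (kB B′)
  collapse-BB {d} {s} {y} {s′} {y′} E B B′ with BData.s≡ B | BData.s≡ B′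
  ... | refl | refl = exact (one (subst (λ t → Step O g f t (BData.U B) (BData.U B′)) (Edge.dir E)
        (both-infinite f (BData.Vg B) (BData.Vf B) (BData.Vg B′) (BData.Vf B′) (BData.a≢ B) (BData.a≢ B′)
          (BData.cU B) (BData.hU B) (BData.dU B) (BData.cU B′) (BData.hU B′) (BData.dU B′))))
      (λ h → fromZero (zeroV! f) (trans h (sym (zeroV! f))))
    where open OnPlane E (BData.on B) (BData.on B′) (inj₁ (BData.a≢ B)) using (both-infinite)

  -- A slope vanishing at a rules out `compared`, whose edges between directions live in programs
  -- with a in the place of g. The other two constructors are exchanged by reversal.
  Collapse-rev : ∀ {d s y s′ y′} {k : Finite s y} {k′ : Finite s′ y′} → slope k ! a ≡ zer ⊎ slope k′ ! a ≡ zer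
        →
    Collapse (opp d) k k′ → Collapse d k′ k
  Collapse-rev {d} {k = k} {k′} ex (collapse d₀ c h good) = collapse (opp d₀) (Conn-rev c) (h′ h)
        (λ q → rev ex (good (opp-zer⁻ q)))
    where
    h′ : d₀ ≡ zer ⊎ d₀ ≡ opp d → opp d₀ ≡ zer ⊎ opp d₀ ≡ d
    h′ (inj₁ refl) = inj₁ refl
    h′ (inj₂ refl) = inj₂ (opp-opp d)
    rev : slope k ! a ≡ zer ⊎ slope k′ ! a ≡ zer → Good (opp d) k k′ → Good d k′ k
    rev _ (fromZero p q) = toZero p (trans (sym (opp-opp d)) (cong opp q))
    rev _ (toZero p q) = fromZero p (opp-inj q)
    rev (inj₁ r) (compared (moved _ _ _ s _) _ _) = ⊥-elim (Step.gX s r)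
    rev (inj₁ r) (compared (fixed _ s _ _ _) _ _) = ⊥-elim (Step.gX s r)
    rev (inj₂ r) (compared (moved _ _ _ s _) _ _) = ⊥-elim (Step.gY s r)
    rev (inj₂ r) (compared (fixed _ s _ _ _) _ _) = ⊥-elim (Step.gY s r)

  collapses : ∀ {d s y s′ y′} → Edge d s y s′ y′ → (k : Finite s y) (k′ : Finite s′ y′) → Collapse d k k′
  collapses E (kO o) (kO o′) = collapse-OO E o o′
  collapses E (kO o) (kA A) = collapse-OA E o A
  collapses E (kO o) (kB B) = collapse-OB E o B
  collapses E (kA A) (kA A′) = collapse-AA E A A′
  collapses E (kA A) (kB B) = collapse-AB E A B
  collapses E (kB B) (kB B′) = collapse-BB E B B′
  collapses E (kA A) (kO o) = Collapse-rev (inj₁ (zeroV! a)) (collapse-OA (Edge-rev E) o A)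
  collapses E (kB B) (kO o) = Collapse-rev (inj₁ (zeroV! a)) (collapse-OB (Edge-rev E) o B)
  collapses E (kB B) (kA A) = Collapse-rev (inj₂ (zeroV! a)) (collapse-AB (Edge-rev E) A B)

  record FVertex : Set where
    field
      {s}  : Sign
      {y}  : SV n
      fkind : Finite s y

  FStep : Sign → FVertex → FVertex → Set
  FStep d u v = Edge d (FVertex.s u) (FVertex.y u) (FVertex.s v) (FVertex.y v)

  private
    fk : (u : FVertex) → Finite (FVertex.s u) (FVertex.y u)
    fk = FVertex.fkind

    GStep : Sign → FVertex → FVertex → Set
    GStep d u v = Good d (fk u) (fk v)

    Good-mono : ∀ {d δ} u v → d ≡ zer ⊎ d ≡ δ → GStep d u v → Le δ (θ (fk u)) (θ (fk v))
    Good-mono u v (inj₁ refl) (fromZero p q) = inj₁ (trans p q)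
    Good-mono u v (inj₂ refl) (fromZero p q) = inj₂ (inj₂ (sym q))
    Good-mono u v (inj₁ refl) (toZero p q) = inj₁ (trans (opp-zer⁻ (sym q)) (sym p))
    Good-mono u v (inj₂ refl) (toZero p q) = inj₂ (inj₁ (trans (sym (opp-opp _)) (cong opp (sym q))))
    Good-mono u v h (compared (moved _ _ eq _ _) _ _) = inj₁ eq
    Good-mono {d} {δ} u v h (compared (fixed {d₃} _ st _ h₃ _) _ _) = Diff-mono f (Step.dZ st)
          (subst (λ t → t ≡ zer ⊎ t ≡ δ) (sym (Step.dir st)) (narrow h₃ h))
      where
      narrow : d₃ ≡ zer ⊎ d₃ ≡ d → d ≡ zer ⊎ d ≡ δ → d₃ ≡ zer ⊎ d₃ ≡ δ
      narrow (inj₁ p) _ = inj₁ p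
      narrow (inj₂ refl) h = h

    Good-flat : ∀ {d} u v → GStep d u v → θ (fk u) ≡ zer → θ (fk v) ≡ zer → d ≡ zer
    Good-flat u v (fromZero _ q) _ h = trans q h
    Good-flat u v (toZero _ q) h _ = trans q (cong opp h)
    Good-flat {d} u v (compared (moved {d₂} _ eq _ _ _) nz _) h _ = mul-zer⁻
          (trans (mul-comm (limit (fk u) ! b) d) (trans eq (cong (λ t → mul t d₂) h))) nz
    Good-flat {d} u v (compared (fixed {d₃} {d₄} _ st _ _ eq) nz _) h h′ =
      mul-zer⁻ (trans (mul-comm (limit (fk u) ! b) d) (trans (eq (trans (sym (Step.dir st)) (zz (Step.dZ st) f
            h h′))) (cong (λ t → mul t d₄) h))) nz

  module _ (nc : NoCycle O) where

    private
      module Slanted {s ν : Sign} (s≢ : s ≢ zer) (ν≢ : ν ≢ zer) {δ : Sign} (δ≢ : δ ≢ zer) where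

        C : FVertex → Set
        C u = θ (fk u) ≡ s × limit (fk u) ! b ≡ ν

        CV : Set
        CV = Σ FVertex C

        V D : CV → SV n
        V u = limit (fk (proj₁ u))
        D u = slope (fk (proj₁ u))

        R₁ R₂ R₃ : Sign → CV → CV → Set
        R₁ d u v = Compare g f d (V u) (D u) (V v) (D v)
        R₂ d u v = (d ≡ zer × Step O a f zer (D u) (D v) × Step O a b zer (D u) (D v)) ⊎
          (∃ λ d₃ → ∃ λ d₄ → Step O a f d₃ (D u) (D v) × Step O a b d₄ (D u) (D v) × (d₃ ≡ zer ⊎ d₃ ≡ d) ×
                (d₃ ≡ zer → mul d ν ≡ mul s d₄))
        R₃ d u v = ∃ λ d₄ → Step O a b d₄ (D u) (D v) × mul d ν ≡ mul s d₄

        -- The solution d₂ of δ · ν = s · d₂: the direction in which b/g (V), and later b/a (D), has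
        -- to move for the height to move in direction δ.
        δ₂ : Sign
        δ₂ = mul s (mul δ ν)

        δ₂≢ : δ₂ ≢ zer
        δ₂≢ = mul-nz s≢ (mul-nz δ≢ ν≢)

        scale : ∀ {d d₂} → mul d ν ≡ mul s d₂ → d ≡ zer ⊎ d ≡ δ → (d₂ ≡ zer × d ≡ zer) ⊎ d₂ ≡ δ₂
        scale eq (inj₁ refl) = inj₁ (mul-zer⁻ (sym eq) s≢ , refl)
        scale {d₂ = d₂} eq (inj₂ refl) = inj₂ (trans (sym (mul-invˡ d₂ s≢)) (cong (mul s) (sym eq)))

        cls₁ : ∀ {d} {u v : CV} → d ≡ zer ⊎ d ≡ δ → R₁ d u v → ∃ λ d′ → Conn O g b d′ (V u) (V v) ×
              ((d′ ≡ zer × R₂ d u v) ⊎ d′ ≡ δ₂)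
        cls₁ {d} {u , p , q} {v} h (moved {d₂} st eq _ st₃ st₄) with scale {d} {d₂}
              (subst (λ t → mul d t ≡ mul s d₂) q (subst (λ t → mul d (V (u , p , q) ! b) ≡ mul t d₂) p eq)) h
        ... | inj₁ (z , z′) = d₂ , one st , inj₁ (z , inj₁ (z′ , st₃ , st₄ z))
        ... | inj₂ z = d₂ , one st , inj₂ z
        cls₁ {d} {u , p , q} {v} h (fixed {d₃} {d₄} eq st₃ st₄ h₃ h₄) = zer , subst (Conn O g b zer
              (V (u , p , q))) eq none ,
          inj₁ (refl , inj₂ (d₃ , d₄ , st₃ , st₄ , h₃ , λ z → subst (λ t → mul d t ≡ mul s d₄) q
                (subst (λ t → mul d (V (u , p , q) ! b) ≡ mul t d₄) p (h₄ z))))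

        cls₂ : ∀ {d} {u v : CV} → d ≡ zer ⊎ d ≡ δ → R₂ d u v → ∃ λ d′ → Conn O a f d′ (D u) (D v) ×
              ((d′ ≡ zer × R₃ d u v) ⊎ d′ ≡ δ)
        cls₂ h (inj₁ (refl , st₃ , st₄)) = zer , one st₃ , inj₁ (refl , zer , st₄ , sym (mul-zerʳ s))
        cls₂ {d} {u} {v} h (inj₂ (d₃ , d₄ , st₃ , st₄ , h₃ , h₄)) = d₃ , one st₃ , go h₃ h
          where
          go : d₃ ≡ zer ⊎ d₃ ≡ d → d ≡ zer ⊎ d ≡ δ → (d₃ ≡ zer × R₃ d u v) ⊎ d₃ ≡ δ
          go (inj₁ z) _ = inj₁ (z , d₄ , st₄ , h₄ z)
          go (inj₂ z) (inj₁ z′) = inj₁ (trans z z′ , d₄ , st₄ , h₄ (trans z z′))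
          go (inj₂ z) (inj₂ z′) = inj₂ (trans z z′)

        cls₃ : ∀ {d} {u v : CV} → d ≡ zer ⊎ d ≡ δ → R₃ d u v → ∃ λ d′ → Conn O a b d′ (D u) (D v) ×
              ((d′ ≡ zer × d ≡ zer) ⊎ d′ ≡ δ₂)
        cls₃ h (d₄ , st , eq) = d₄ , one st , scale eq h

        slanted : ∀ {x y} → Star (Up R₁ δ) x y → R₁ δ y x → ⊥
        slanted w r with phase {S = R₂} nc g b δ₂≢ V (λ {_} {u} {v} → cls₁ {_} {u} {v}) w r
        ... | w₂ , r₂ with phase {S = R₃} nc a f δ≢ D (λ {_} {u} {v} → cls₂ {_} {u} {v}) w₂ r₂
        ... | w₃ , r₃ with phase {S = λ d _ _ → d ≡ zer} nc a b δ₂≢ D (λ {_} {u} {v} → cls₃ {_} {u} {v}) w₃ r₃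
        ... | _ , z = δ≢ z

    finite-acyclic : Acyclic FStep
    finite-acyclic {δ} δ≢ {x} {y} w r with phase {R = FStep} {S = GStep} nc g f δ≢ (λ u → φ (fk u)) cls w r
      where
      cls : ∀ {d u v} → d ≡ zer ⊎ d ≡ δ → FStep d u v → ∃ λ d′ → Conn O g f d′ (φ (fk u)) (φ (fk v)) ×
            ((d′ ≡ zer × GStep d u v) ⊎ d′ ≡ δ)
      cls {d} {u} {v} h E with collapses E (fk u) (fk v)
      ... | collapse d₀ c h₀ good = d₀ , c , go h₀ h
        where
        go : d₀ ≡ zer ⊎ d₀ ≡ d → d ≡ zer ⊎ d ≡ δ → (d₀ ≡ zer × GStep d u v) ⊎ d₀ ≡ δ
        go (inj₁ z) _ = inj₁ (z , good z)
        go (inj₂ z) (inj₁ z′) = inj₁ (trans z z′ , good (trans z z′))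
        go (inj₂ z) (inj₂ z′) = inj₂ (trans z z′)
    ... | w₁ , r₁ with constant {R = GStep} δ≢ (λ u → θ (fk u)) (λ {_} {u} {v} → Good-mono u v) w₁ r₁
    ... | w₂ , r₂ , eq = go (θ (fk x) ≟ₛ zer)
      where
      s : Sign
      s = θ (fk x)
      TStep : Sign → FVertex → FVertex → Set
      TStep d u v = GStep d u v × θ (fk u) ≡ θ (fk v)
      cmp : s ≢ zer → ∀ {d u v} → TStep d u v → θ (fk u) ≡ s →
        Compare g f d (limit (fk u)) (slope (fk u)) (limit (fk v)) (slope (fk v)) × limit (fk u) ! b ≢ zer ×
              limit (fk u) ! b ≡ limit (fk v) ! b
      cmp s≢ (fromZero p _ , _) h = ⊥-elim (s≢ (trans (sym h) p))
      cmp s≢ (toZero p _ , e) h = ⊥-elim (s≢ (trans (sym h) (trans e p)))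
      cmp s≢ (compared c nz e , _) h = c , nz , e
      go : Dec (s ≡ zer) → ⊥
      -- With all offsets zero there is no tie left to break, and the closing edge would be flat.
      go (yes z) = δ≢ (Good-flat y x r₁ (trans eq z) z)
      go (no s≢) = Slanted.slanted s≢ ν≢ δ≢ (gmap (λ u → u) (λ { {u} (d , h , t) → d , h , proj₁
            (cmp s≢ t (proj₁ (proj₂ u))) }) (proj₂ inC))
                     (proj₁ (cmp s≢ (r₂ , eq) (proj₁ (proj₁ inC))))
        where
        ν : Sign
        ν = limit (fk x) ! b
        last : _
        last = cmp s≢ {δ} {y} {x} (r₂ , eq) eq
        ν≢ : ν ≢ zer
        ν≢ h = proj₁ (proj₂ last) (trans (proj₂ (proj₂ last)) h)
        P : FVertex → Set
        P u = θ (fk u) ≡ s × limit (fk u) ! b ≡ ν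
        inC : ∃ λ (py : P y) → Star (Up (Restrict P TStep) δ) (x , refl , refl) (y , py)
        inC = restrict P (λ { (t , e) (p , q) → trans (sym e) p , trans
              (sym (proj₂ (proj₂ (cmp s≢ (t , e) p)))) q }) (refl , refl) w₂

module _ {n : ℕ} where

  CStep-swap : ∀ {O : OM n} {g f d X Y c t} → CStep O g f d X Y → X ! f ≡ c → Y ! f ≡ c → c ≢ zer → X ! g ≡ t
        →
    CStep O f g (opp (mul (mul t c) d)) X Y
  CStep-swap (s , r) refl q c≢ refl = swap s c≢ (sym q) , r

  -- The sign of f is monotone along a walk of the program (O,g,f), hence constant on a closed walk.
  f-constant : ∀ {O : OM n} {g f δ X Y} → δ ≢ zer → Star (Up (CStep O g f) δ) X Y → CStep O g f δ Y X →
    X ! f ≢ zer × Σ (Y ! f ≡ X ! f) λ _ → Star (Up (λ d U V → CStep O g f d U V × U ! f ≡ V ! f) δ) X Y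
  f-constant {O} {g} {f} {δ} {X} {Y} δ≢ w r with constant {R = CStep O g f} δ≢ (_! f)
      (λ h s → Diff-mono f (Step.dZ (proj₁ s)) (subst (λ t → t ≡ zer ⊎ t ≡ δ) (sym (Step.dir (proj₁ s))) h)) w
            r
  ... | w′ , (s , _) , eq = (λ z → δ≢ (trans (sym (Step.dir s)) (zz (Step.dZ s) f (trans eq z) z))) , eq , w′

-- Acyclicity of the extension, by the position of p among g and f

module LexAcyclic {n : ℕ} (O : OM n) (a : Fin n) (α : Sign) (b : Fin n) (β : Sign) (α≢ : α ≢ zer)
      (β≢ : β ≢ zer)
  (nc : NoCycle O) where

  open Lexicographic O a α b β α≢ β≢

  module _ (g f : Fin n) where

    open Program O a α b β α≢ β≢ g f

    escapes : ∀ {d s y s′ y′} → Edge d s y s′ y′ → (C : CData s y) → Finite s′ y′ → d ≡ opp (CData.V C ! f)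
    escapes {s′ = s′} E C (kO o) with s′ ≟ₛ zer
    ... | no s≢ = opp-inj (trans (sym (Edge.dir (Edge-rev E))) (trans (OldNew.out (Edge-rev E) s≢ o
          (CData.new C) (CData.Vg C)) (sym (opp-opp _))))
    ... | yes refl with CData.s≡ C
    ... | refl = trans (sym (Edge.dir E)) (escape f (CData.Vg C) (CData.Vf C) (λ h → ⊥-elim
          (Edge.g≢ E (trans (Edge.g≡ E) h))))
      where open OnPlane E (CData.on C) (oldOn o) (inj₁ (CData.a≢ C)) using (escape)
    escapes E C (kA A) with CData.s≡ C | AData.s≡ A
    ... | refl | refl = trans (sym (Edge.dir E)) (escape f (CData.Vg C) (CData.Vf C) (λ h → ⊥-elim
          (AData.Vg A h)))
      where open OnPlane E (CData.on C) (AData.on A) (inj₁ (CData.a≢ C)) using (escape)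
    escapes E C (kB B) with CData.s≡ C | BData.s≡ B
    ... | refl | refl = trans (sym (Edge.dir E)) (escape f (CData.Vg C) (CData.Vf C) (λ _ → BData.Vf B))
      where open OnPlane E (CData.on C) (BData.on B) (inj₁ (CData.a≢ C)) using (escape)

    Kind : SV (suc n) → Set
    Kind (s ∷ y) = Finite s y ⊎ CData s y

    KV : Set
    KV = Σ (SV (suc n)) Kind

    -- The sign of an infinite height, zero for a finite one. By `escapes`, vertices of infinite
    -- height lie above or below all finite ones; by conformality, adjacent infinite ones have the
    -- same sign.
    κ : KV → Sign
    κ (s ∷ y , inj₁ _) = zer
    κ (s ∷ y , inj₂ C) = CData.V C ! f

    KStep : Sign → KV → KV → Set
    KStep = Restrict Kind (CStep lex (fsuc g) (fsuc f))

    κ-mono : ∀ {d δ} (u v : KV) → d ≡ zer ⊎ d ≡ δ → KStep d u v → Le δ (κ u) (κ v)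
    κ-mono (s ∷ y , inj₁ _) (s′ ∷ y′ , inj₁ _) h r = inj₁ refl
    κ-mono (s ∷ y , inj₂ C) (s′ ∷ y′ , inj₁ k) (inj₁ refl) r = ⊥-elim
          (CData.Vf C (opp-zer⁻ (sym (escapes (toEdge r) C k))))
    κ-mono (s ∷ y , inj₂ C) (s′ ∷ y′ , inj₁ k) (inj₂ refl) r = inj₂ (inj₁ (trans (sym (opp-opp _))
          (cong opp (sym (escapes (toEdge r) C k)))))
    κ-mono (s ∷ y , inj₁ k) (s′ ∷ y′ , inj₂ C) (inj₁ refl) r = ⊥-elim
          (CData.Vf C (opp-zer⁻ (sym (escapes (Edge-rev (toEdge r)) C k))))
    κ-mono (s ∷ y , inj₁ k) (s′ ∷ y′ , inj₂ C) (inj₂ refl) r = inj₂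
          (inj₂ (opp-inj (sym (escapes (Edge-rev (toEdge r)) C k))))
    κ-mono (s ∷ y , inj₂ C) (s′ ∷ y′ , inj₂ C′) h r = inj₁ (trans (CData.Vg≡ C (CData.Vf C)) (trans
        (nosep⇒≡ (proj₁ (proj₂ r) (fsuc f)) (nz C) (nz C′)) (sym (CData.Vg≡ C′ (CData.Vf C′)))))
      where
      nz : ∀ {s y} (C : CData s y) → y ! f ≢ zer
      nz C h = CData.Vf C (CData.V⊑y C f h)

    kind-of : ∀ {d X Y} → CStep lex (fsuc g) (fsuc f) d X Y → Kind Y
    kind-of {Y = s ∷ y} (st , _) = kind s y (Step.cY st) (Step.hY st) (Step.gY st)

    toFinite : (u : KV) → κ u ≡ zer → FVertex
    toFinite (s ∷ y , inj₁ k) _ = record { fkind = k }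
    toFinite (s ∷ y , inj₂ C) h = ⊥-elim (CData.Vf C h)

    finite-step : ∀ {d} u v (p : κ u ≡ zer) (q : κ v ≡ zer) → KStep d u v → FStep d (toFinite u p)
          (toFinite v q)
    finite-step (s ∷ y , inj₁ _) (s′ ∷ y′ , inj₁ _) _ _ r = toEdge r
    finite-step (s ∷ y , inj₂ C) _ p _ _ = ⊥-elim (CData.Vf C p)
    finite-step (s ∷ y , inj₁ _) (s′ ∷ y′ , inj₂ C) _ q _ = ⊥-elim (CData.Vf C q)

  module _ (g f : Fin n) where

    private
      module GF = Program O a α b β α≢ β≢ g f
      module FG = Program O a α b β α≢ β≢ f g

    module Unbounded {c t δ : Sign} (c≢ : c ≢ zer) (t≢ : t ≢ zer) (δ≢ : δ ≢ zer) where

      P : KV g f → Set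
      P u = κ g f u ≡ c × proj₁ u ! fsuc g ≡ t

      -- After exchanging g and f the limit is an affine point.
      flip : (u : KV g f) → P u → FG.FVertex
      flip (s ∷ y , inj₁ k) (p , _) = ⊥-elim (c≢ (sym p))
      flip (s ∷ y , inj₂ C) _ = record { fkind = FG.kA (FG.affine (GF.CData.new C) (λ h → GF.CData.Vf C
            (GF.CData.V⊑y C f h)) (GF.CData.Vf C)) }

      f-entry : ∀ {s y} (C : GF.CData s y) → GF.CData.V C ! f ≡ c → y ! f ≡ c
      f-entry C h = trans (sym (GF.CData.Vg≡ C (GF.CData.Vf C))) h

      flip-step : ∀ {d} u v (p : P u) (q : P v) → KStep g f d u v → FG.FStep (opp (mul (mul t c) d))
            (flip u p) (flip v q)
      flip-step (s ∷ y , inj₁ _) _ (p , _) _ _ = ⊥-elim (c≢ (sym p))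
      flip-step (s ∷ y , inj₂ _) (s′ ∷ y′ , inj₁ _) _ (q , _) _ = ⊥-elim (c≢ (sym q))
      flip-step (s ∷ y , inj₂ C) (s′ ∷ y′ , inj₂ C′) (p , p′) (q , _) r =
        FG.toEdge (CStep-swap {X = s ∷ y} {s′ ∷ y′} r (f-entry C p) (f-entry C′ q) c≢ p′)

      acyclic : ∀ {x y} → Star (Up (Restrict P (KStep g f)) δ) x y → KStep g f δ (proj₁ y) (proj₁ x) → ⊥
      acyclic {x , px} {y , py} w r = FG.finite-acyclic nc (opp-nz (mul-nz (mul-nz t≢ c≢) δ≢))
        (gmap {U = Up FG.FStep (opp (mul (mul t c) δ))} (λ u → flip (proj₁ u) (proj₂ u))
          (λ { {u , pu} {v , pv} (d , h , s) → _ , swap-sign {mul t c} h , flip-step u v pu pv s }) w)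
        (flip-step y x py px r)

    acyclic-EE : Acyclic (CStep lex (fsuc g) (fsuc f))
    acyclic-EE {δ} δ≢ {X} {Y} w r with restrict {R = CStep lex (fsuc g) (fsuc f)} (Kind g f) (λ s _ → kind-of
          g f s) (kind-of g f r) w
    ... | kY , w′ with constant {R = KStep g f} δ≢ (κ g f) (λ {_} {u} {v} → κ-mono g f u v) w′ r
    ... | w₂ , r₂ , eq = go (κ g f x ≟ₛ zer)
      where
      x y : KV g f
      x = X , kind-of g f r
      y = Y , kY
      R : Sign → KV g f → KV g f → Set
      R d u v = KStep g f d u v × κ g f u ≡ κ g f v
      go : Dec (κ g f x ≡ zer) → ⊥
      go (yes z) with restrict {R = R} (λ u → κ g f u ≡ zer) (λ s p → trans (sym (proj₂ s)) p) z w₂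
      ... | q , w₃ = GF.finite-acyclic nc δ≢ (gmap {U = Up GF.FStep δ} (λ u → toFinite g f (proj₁ u)
            (proj₂ u))
              (λ { {u , pu} {v , pv} (d , h , s) → d , h , finite-step g f u v pu pv (proj₁ s) }) w₃)
                    (finite-step g f y x q z r)
      go (no z) with restrict {R = R} P (λ s p → trans (sym (proj₂ s)) (proj₁ p) , trans
            (sym (Step.gXY (proj₁ (proj₁ s)))) (proj₂ p)) (refl , refl) w₂
        where
        P : KV g f → Set
        P u = κ g f u ≡ κ g f x × proj₁ u ! fsuc g ≡ X ! fsuc g
      ... | q , w₃ = Unbounded.acyclic z (Step.gY (proj₁ r)) δ≢ (gmap (λ u → u) (λ { (d , h , s) → d , h ,
            proj₁ s }) w₃) r

  -- A constant nonzero sign at p keeps every vertex off p, so all are cocircuits of `O`. The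
  -- eliminant is a point of `O` too: a witness for it would vanish at a, where the eliminant does
  -- not, hence be zero. So its sign at p is the canonical one, decided by a and then by b.
  acyclic-Ep : ∀ g → Acyclic (CStep lex (fsuc g) fzero)
  acyclic-Ep g {δ} δ≢ {X} {Y} w r with f-constant δ≢ w r
  ... | c≢ , eq , w₁ = go
    where
    c : Sign
    c = X ! fzero
    P : SV (suc n) → Set
    P (s ∷ y) = s ≡ c × Old s y
    V : Set
    V = Σ (SV (suc n)) P
    tl : V → SV n
    tl (s ∷ y , _) = y
    R₁ R₂ : Sign → V → V → Set
    R₁ = Restrict P (λ d U V → CStep lex (fsuc g) fzero d U V × U ! fzero ≡ V ! fzero)
    R₂ d u v = ∃ λ d₂ → Step O g b d₂ (tl u) (tl v) × d ≡ mul β d₂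
    isOld : ∀ {d U} Y → CStep lex (fsuc g) fzero d U Y → Y ! fzero ≡ c → P Y
    isOld (s ∷ y) (st , _) h with classify s y (Step.cY st) (Step.hY st)
    ... | inj₁ o = h , o
    ... | inj₂ N = ⊥-elim (c≢ (trans (sym h) (New.s≡ N)))
    cls₁ : ∀ {d u v} → d ≡ zer ⊎ d ≡ δ → R₁ d u v → ∃ λ d′ → Conn O g a d′ (tl u) (tl v) ×
          ((d′ ≡ zer × R₂ d u v) ⊎ d′ ≡ mul α δ)
    cls₁ {d} {s ∷ y , s≡ , o} {s′ ∷ y′ , s′≡ , o′} h ((mkStep cX cY hX hY gX gXY ln (zp ∷ Z) cZ dZ dir , _) ,
          _) = Z ! a , one (st a) , pick (Z ! a ≟ₛ zer)
      where
      line : Ht O 2 (y ∘ᵛ y′)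
      line = Ht-old 2 {comp s s′} {y ∘ᵛ y′} (λ z → ⊥-elim (c≢ (trans (sym s≡) (proj₁ (comp-zer⁻ {s} z))))) ln
      dZ′ : Diff g y y′ Z
      dZ′ = mkDiff (at dZ) (λ e → off dZ (fsuc e)) (λ e → zz dZ (fsuc e))
      st : ∀ i → Step O g i (Z ! i) y y′
      st i = mkStep (Old.cy o) (Old.cy o′) (Old.hy o) (Old.hy o′) gX gXY line Z (proj₁ cZ) dZ′ refl
      hZ : Ht O 1 Z
      hZ = line Z (proj₁ cZ) (below dZ′) g (at dZ) (∘-nzˡ {X = y} {y′} gX)
      value : Val zp Z → zp ≡ canon Z
      value (inj₁ p) = p
      value (inj₂ w) = ⊥-elim (Wit.BV w (trans (cong (mul β) (hZ (Wit.V w) (Wit.cV w) (≼⇒⊑ {X = Wit.V w} {Z}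
            (Wit.V≼X w)) a
        (A-zer⁻ {Wit.V w} (Wit.AV w)) (Wit-nz w) b)) (mul-zerʳ β)))
      d≡ : d ≡ canon Z
      d≡ = trans (sym dir) (value (proj₂ cZ))
      pick : Dec (Z ! a ≡ zer) → (Z ! a ≡ zer × R₂ d (s ∷ y , s≡ , o) (s′ ∷ y′ , s′≡ , o′)) ⊎ Z ! a ≡ mul α δ
      pick (yes z) = inj₁ (z , Z ! b , st b , trans d≡ (cong (λ t → comp t (B Z)) (trans (cong (mul α) z)
            (mul-zerʳ α))))
      pick (no z) = inj₂ (trans (sym (mul-invˡ (Z ! a) α≢)) (cong (mul α) (trans (sym d≡A) (d≡δ h))))
        where
        d≡A : d ≡ A Z
        d≡A = trans d≡ (comp-nz (mul-nz α≢ z))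
        d≡δ : d ≡ zer ⊎ d ≡ δ → d ≡ δ
        d≡δ (inj₁ q) = ⊥-elim (mul-nz α≢ z (trans (sym d≡A) q))
        d≡δ (inj₂ q) = q
    cls₂ : ∀ {d u v} → d ≡ zer ⊎ d ≡ δ → R₂ d u v → ∃ λ d′ → Conn O g b d′ (tl u) (tl v) ×
          ((d′ ≡ zer × d ≡ zer) ⊎ d′ ≡ mul β δ)
    cls₂ (inj₁ refl) (d₂ , st , eq) = d₂ , one st , inj₁ (mul-zer⁻ (sym eq) β≢ , refl)
    cls₂ (inj₂ refl) (d₂ , st , eq) = d₂ , one st , inj₂ (trans (sym (mul-invˡ d₂ β≢)) (cong (mul β)
          (sym eq)))
    go : ⊥
    go with restrict {R = λ d U V → CStep lex (fsuc g) fzero d U V × U ! fzero ≡ V ! fzero} P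
              (λ {_} {U} {V} s p → isOld V (proj₁ s) (trans (sym (proj₂ s)) (sign U p))) (isOld X r refl) w₁
      where
      sign : ∀ U → P U → U ! fzero ≡ c
      sign (s ∷ y) (p , _) = p
    ... | pY , w₂ with phase {R = R₁} {S = R₂} nc g a (mul-nz α≢ δ≢) tl (λ {_} {u} {v} → cls₁ {_} {u} {v}) w₂
          (r , eq)
    ... | w₃ , r₃ with phase {R = R₂} {S = λ d _ _ → d ≡ zer} nc g b (mul-nz β≢ δ≢) tl (λ {_} {u} {v} → cls₂
          {_} {u} {v}) w₃ r₃
    ... | _ , z = δ≢ z

  acyclic-pE : ∀ f → Acyclic (CStep lex fzero (fsuc f))
  acyclic-pE f {δ} δ≢ {X} {Y} w r with f-constant δ≢ w r
  ... | c≢ , eq , w₁ with restrict {R = λ d U V → CStep lex fzero (fsuc f) d U V × U ! fsuc f ≡ V ! fsuc f}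
            (λ U → U ! fsuc f ≡ X ! fsuc f × U ! fzero ≡ X ! fzero)
            (λ s p → trans (sym (proj₂ s)) (proj₁ p) , trans (sym (Step.gXY (proj₁ (proj₁ s)))) (proj₂ p))
                  (refl , refl) w₁
  ... | (p , q) , w₂ = acyclic-Ep f (opp-nz (mul-nz (mul-nz (Step.gY (proj₁ r)) c≢) δ≢))
        (gmap {U = Up (CStep lex (fsuc f) fzero) (opp (mul (mul (X ! fzero) (X ! fsuc f)) δ))} proj₁
          (λ { {U , pU , qU} {V , pV , qV} (d , h , s , _) → _ , swap-sign {mul (X ! fzero) (X ! fsuc f)} h ,
                CStep-swap {X = U} {V} s pU pV c≢ qU }) w₂)
        (CStep-swap {X = Y} {X} r p refl c≢ q)

  lex-acyclic : NoConformalCycle lex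
  lex-acyclic fzero fzero δ≢ w (s , _) = δ≢ (trans (sym (Step.dir s)) (at (Step.dZ s)))
  lex-acyclic fzero (fsuc f) = acyclic-pE f
  lex-acyclic (fsuc g) fzero = acyclic-Ep g
  lex-acyclic (fsuc g) (fsuc f) = acyclic-EE g f

-- Cocircuits, flats and directed cycles

nonzero : ∀ {n} (X : SV n) → (∀ e → X ! e ≡ zer) ⊎ ∃ λ e → X ! e ≢ zer
nonzero X with any? (λ e → ¬? (X ! e ≟ₛ zer))
... | yes p = inj₂ p
... | no np = inj₁ zero′
  where
  zero′ : ∀ e → X ! e ≡ zer
  zero′ e with X ! e ≟ₛ zer
  ... | yes q = q
  ... | no q = ⊥-elim (np (e , q))

≢zeroV : ∀ {n} {X : SV n} → X ≢ zeroV → ∃ λ e → X ! e ≢ zer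
≢zeroV {X = X} ne with nonzero X
... | inj₂ p = p
... | inj₁ z = ⊥-elim (ne (ext λ e → trans (z e) (sym (zeroV! e))))

nz⇒≢zeroV : ∀ {n} {X : SV n} {e} → X ! e ≢ zer → X ≢ zeroV
nz⇒≢zeroV {e = e} nz refl = nz (zeroV! e)

module _ {n : ℕ} (O : OM n) where

  private
    ∉[] : ∀ {A : Set} {e : A} → ¬ (e List.∈ [])
    ∉[] ()

  -- Eliminating the separating elements one by one turns U into a covector conformal to X.
  cocircuit-unique : ∀ {X} → Cocircuit O X → ∀ {U u} (es : List (Fin n)) → Cov O U → U ⊑ X → U ! u ≢ zer →
    (∀ e → InSep X U e → e List.∈ es) → (∀ e → X ! e ≡ U ! e) ⊎ (∀ e → X ! e ≡ opp (U ! e))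
  cocircuit-unique {X} (cX , _ , min) {U} [] cU p nz sep =
    inj₁ λ e → cong (_! e) (sym (min U cU (nz⇒≢zeroV nz) conf))
    where
    conf : U ≼ X
    conf e with U ! e ≟ₛ zer
    ... | yes q = inj₁ q
    ... | no q = inj₂ (sym (nosep⇒≡ (λ o → ∉[] (sep e o)) (q ∘ p e) q))
  cocircuit-unique {X} cc@(cX , _ , _) {U} {u} (e ∷ es) cU p nz sep with Opposite? (X ! e) (U ! e)
  ... | no no′ = cocircuit-unique cc es cU p nz (λ i o → rest i o (sep i o))
    where
    rest : ∀ i → InSep X U i → i List.∈ e ∷ es → i List.∈ es
    rest i o (here refl) = ⊥-elim (no′ o)
    rest i o (there m) = m
  ... | yes o with L3 O e cX cU o
  ... | N , cN , Ne , offN with nonzero N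
  ... | inj₁ z = inj₂ opposed
    where
    opposed : ∀ i → X ! i ≡ opp (U ! i)
    opposed i with Opposite? (X ! i) (U ! i)
    ... | yes o′ = opposite⇒opp o′
    ... | no no′ = trans (⊑-∘ˡ X U i (trans (sym (offN i no′)) (z i)))
          (sym (cong opp (⊑-∘ʳ X U i (trans (sym (offN i no′)) (z i)))))
  ... | inj₂ (x , Nx) with cocircuit-unique cc {N} {x} es cN N⊑X Nx sepN
    where
    N⊑X : N ⊑ X
    N⊑X i h = trans (offN i (λ o′ → Opposite-nzˡ o′ h)) (∘-zer {X = X} {U} h (p i h))
    sepN : ∀ i → InSep X N i → i List.∈ es
    sepN i o′ with Opposite? (X ! i) (U ! i)
    ... | no no′ = ⊥-elim (Opposite-irrefl (sym (trans (offN i no′) (trans (∘! X U i)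
          (comp-nz (Opposite-nzˡ o′))))) o′)
    ... | yes o″ with sep i o″
    ... | here refl = ⊥-elim (Opposite-nzʳ o′ Ne)
    ... | there m = m
  ... | inj₁ eq = ⊥-elim (Opposite-nzˡ o (trans (eq e) Ne))
  ... | inj₂ eq = ⊥-elim (Opposite-nzˡ o (trans (eq e) (cong opp Ne)))

  cocircuit⇒Ht : ∀ {X} → Cocircuit O X → Ht O 1 X
  cocircuit⇒Ht {X} cc U cU p e Ue Xe with nonzero U
  ... | inj₁ z = z
  ... | inj₂ (u , nz) with cocircuit-unique cc (allFin n) cU p nz (λ i _ → ∈-allFin i)
  ... | inj₁ eq = ⊥-elim (Xe (trans (eq e) Ue))
  ... | inj₂ eq = ⊥-elim (Xe (trans (eq e) (cong opp Ue)))

  Ht⇒cocircuit : ∀ {X u} → Cov O X → X ! u ≢ zer → Ht O 1 X → Cocircuit O X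
  Ht⇒cocircuit {X} cX nz h = cX , nz⇒≢zeroV nz , min
    where
    min : ∀ Y → Cov O Y → Y ≢ zeroV → Y ≼ X → Y ≡ X
    min Y cY ne p = ext agree
      where
      agree : ∀ e → Y ! e ≡ X ! e
      agree e with p e
      ... | inj₂ q = q
      ... | inj₁ q with X ! e ≟ₛ zer
      ... | yes r = trans q (sym r)
      ... | no r = ⊥-elim (proj₂ (≢zeroV ne) (h Y cY (≼⇒⊑ {X = Y} {X} p) e q r _))

  ∈z : ∀ {X : SV n} {e} → X ! e ≡ zer → e ∈ z X
  ∈z {X} {e} h = lookup⇒[]= e (z X) (trans (lookup-map e isZero X) (cong isZero h))

  ∈z⁻ : ∀ {X : SV n} {e} → e ∈ z X → X ! e ≡ zer
  ∈z⁻ {X} {e} h = inside⁻ (X ! e) (trans (sym (lookup-map e isZero X)) ([]=⇒lookup h))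
    where
    inside⁻ : ∀ s → isZero s ≡ inside → s ≡ zer
    inside⁻ zer _ = refl

  z-⊂ : ∀ {U W : SV n} {e} → U ⊑ W → U ! e ≡ zer → W ! e ≢ zer → z W ⊂ z U
  z-⊂ {U} {W} {e} p u w = (λ {i} m → ∈z {U} (p i (∈z⁻ {W} m))) , e , ∈z {U} u , λ m → w (∈z⁻ {W} m)

  z-zeroV : z (zeroV {n}) ≡ full
  z-zeroV = map-replicate isZero zer n

  z-⊂full : ∀ {W : SV n} {e} → W ! e ≢ zer → z W ⊂ full
  z-⊂full {W} {e} w = (λ _ → ∈⊤) , e , ∈⊤ , λ m → w (∈z⁻ {W} m)

  full-flat : IsFlat O full
  full-flat = zeroV , L0 O , z-zeroV

  chain-++ : ∀ {F G H k m} → Chain O F G k → Chain O G H m → Chain O F H (k + m)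
  chain-++ (done _) d = d
  chain-++ (step f p c) d = step f p (chain-++ c d)

  chain-flat : ∀ {F G k} → Chain O F G k → IsFlat O F
  chain-flat (done f) = f
  chain-flat (step f _ _) = f

  -- Otherwise a chain of length `k` ending at the flat could be prolonged by three steps to the
  -- whole ground set, above the rank `2 + k`.
  comodular⇒Ht : ∀ {X Y} → Comodular O X Y → Ht O 2 (X ∘ᵛ Y)
  comodular⇒Ht {X} {Y} ((cX , _) , (cY , _) , _ , _ , k , (fF , (G , c) , _) , (_ , _ , bound)) U cU p e u w
        U₂ cU₂ p₂ e₂ u₂ w₂ x
    with U₂ ! x ≟ₛ zer
  ... | yes q = q
  ... | no q = ⊥-elim (1+n≰n (subst (_≤ 2 + k) (+-comm k 3) (bound G (k + 3) (chain-++ c long))))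
    where
    long : Chain O (z (X ∘ᵛ Y)) full 3
    long = step fF (z-⊂ {U} {X ∘ᵛ Y} p u w) (step (U , cU , refl) (z-⊂ {U₂} {U} p₂ u₂ w₂)
             (step (U₂ , cU₂ , refl) (z-⊂full {U₂} q) (done full-flat)))

module _ {n : ℕ} {O : OM n} {g f : Fin n} where

  -- `Elim` only bounds the signs of `Z`, so `Z` has to be identified with `N` on the line. At a
  -- zero `e` of `X` off `Y` it cannot vanish: it would be proportional to `X`, which is off g,
  -- while `Z` is on g and nonzero.
  edge⇒CStep : ∀ {d X Y Z} → Vertex O g f X → Vertex O g f Y → Adjacent O g f X Y → Elim O g (- X ᵛ) Y Z → Z !
        f ≡ d →
    CStep O g f d X Y
  edge⇒CStep {d} {X} {Y} {Z} (ccX , gX) (ccY , gY) (conf , cm@(_ , _ , ne , _)) ((cZ , Z≢ , _) , Zg , el) dir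
        =
      mkStep cX cY hX (cocircuit⇒Ht O ccY) nzg eqg line N (proj₁ kN) dN (trans (sym (same-Z f)) dir) , conf ,
            ne
    where
    cX = proj₁ ccX
    cY = proj₁ ccY
    hX = cocircuit⇒Ht O ccX
    eqg : X ! g ≡ Y ! g
    eqg = trans gX (sym gY)
    nzg : X ! g ≢ zer
    nzg h with trans (sym gX) h
    ... | ()
    line : Ht O 2 (X ∘ᵛ Y)
    line = comodular⇒Ht O cm
    K : OM n
    K = O ↓ (X ∘ᵛ Y)
    rk : Rank K 2
    rk = Rank-↓ O 2 (X ∘ᵛ Y) line
    kX : Cov K X
    kX = cX , ⊑-∘ˡ X Y
    kY : Cov K Y
    kY = cY , ⊑-∘ʳ X Y
    N′ = diff K g kX kY eqg nzg
    N = proj₁ N′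
    kN = proj₁ (proj₂ N′)
    dN = proj₂ (proj₂ N′)
    part : ∀ e → X ! e ≡ zer → Z ! e ≡ zer ⊎ Z ! e ≡ Y ! e
    part e h = go (Z ! e) refl
      where
      X₀ : (- X ᵛ) ! e ≡ zer
      X₀ = neg-⊑ X e h
      go : ∀ s → Z ! e ≡ s → Z ! e ≡ zer ⊎ Z ! e ≡ Y ! e
      go zer q = inj₁ q
      go pos q with proj₁ (el e) q
      ... | inj₁ r with trans (sym X₀) r
      ... | ()
      go pos q | inj₂ r = inj₂ (trans q (sym r))
      go neg q with proj₂ (el e) q
      ... | inj₁ r with trans (sym X₀) r
      ... | ()
      go neg q | inj₂ r = inj₂ (trans q (sym r))
    kZ : Cov K Z
    kZ = cZ , λ e h → zero′ e (part e (⊑-∘ˡ X Y e h)) (⊑-∘ʳ X Y e h)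
      where
      zero′ : ∀ e → Z ! e ≡ zer ⊎ Z ! e ≡ Y ! e → Y ! e ≡ zer → Z ! e ≡ zer
      zero′ e (inj₁ q) _ = q
      zero′ e (inj₂ q) r = trans q r
    same-Z : ∀ i → Z ! i ≡ N ! i
    same-Z with splitter O cX hX cY nzg eqg
    ... | inj₂ eq = ⊥-elim (ne (ext eq))
    ... | inj₁ (e , p , q) = line-same K rk kX nzg kZ Zg kN (at dN) (λ h → q (trans (sym (left dN e p)) h))
          (trans (Ze (part e p)) (sym (left dN e p)))
      where
      Ze : Z ! e ≡ zer ⊎ Z ! e ≡ Y ! e → Z ! e ≡ Y ! e
      Ze (inj₂ r) = r
      Ze (inj₁ r) with line-unique K rk kY q kZ r kX p nzg
      ... | τ , m = ⊥-elim (proj₂ (≢zeroV Z≢) (trans (m _) (cong (λ t → mul t (X ! proj₁ (≢zeroV Z≢)))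
            (mul-zer⁻ (trans (mul-comm (X ! g) τ) (trans (sym (m g)) Zg)) nzg))))

  CStep⇒edge : ∀ {d X Y} → X ! g ≡ pos → CStep O g f d X Y →
    Vertex O g f X × Vertex O g f Y × (∃ λ Z → Elim O g (- X ᵛ) Y Z × Z ! f ≡ d)
  CStep⇒edge {d} {X} {Y} gX (s , _ , ne) =
      (Ht⇒cocircuit O cX (Step.gX s) hX , gX) , (Ht⇒cocircuit O cY gY hY , trans (sym gXY) gX) , Z ,
      (Ht⇒cocircuit O cZ (proj₂ Z-nz) hZ , at dZ , λ i → sign i) , dir
    where
    open Step s hiding (gX)
    Z-nz : ∃ λ e → Z ! e ≢ zer
    Z-nz with Line.split s
    ... | inj₁ (e , p , q) = e , λ h → q (trans (sym (left dZ e p)) h)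
    ... | inj₂ eq = ⊥-elim (ne (ext eq))
    hZ : Ht O 1 Z
    hZ = line Z cZ (below dZ) g (at dZ) (∘-nzˡ {X = X} {Y} (Step.gX s))
    signs : ∀ x y {z} → (x ≢ y → z ≡ comp (opp x) y) → (x ≡ zer → y ≡ zer → z ≡ zer) →
      (z ≡ pos → opp x ≡ pos ⊎ y ≡ pos) × (z ≡ neg → opp x ≡ neg ⊎ y ≡ neg)
    signs pos pos _ _ = (λ _ → inj₂ refl) , (λ _ → inj₁ refl)
    signs neg neg _ _ = (λ _ → inj₁ refl) , (λ _ → inj₂ refl)
    signs zer zer _ h with h refl refl
    ... | refl = (λ ()) , (λ ())
    signs pos neg h _ with h (λ ())
    ... | refl = (λ ()) , (λ _ → inj₁ refl)
    signs pos zer h _ with h (λ ())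
    ... | refl = (λ ()) , (λ _ → inj₁ refl)
    signs neg pos h _ with h (λ ())
    ... | refl = (λ _ → inj₁ refl) , (λ ())
    signs neg zer h _ with h (λ ())
    ... | refl = (λ _ → inj₁ refl) , (λ ())
    signs zer pos h _ with h (λ ())
    ... | refl = (λ _ → inj₂ refl) , (λ ())
    signs zer neg h _ with h (λ ())
    ... | refl = (λ ()) , (λ _ → inj₂ refl)
    sign : ∀ i → (Z ! i ≡ pos → (- X ᵛ) ! i ≡ pos ⊎ Y ! i ≡ pos) × (Z ! i ≡ neg → (- X ᵛ) ! i ≡ neg ⊎ Y ! i ≡
          neg)
    sign i = subst (λ t → (Z ! i ≡ pos → t ≡ pos ⊎ Y ! i ≡ pos) × (Z ! i ≡ neg → t ≡ neg ⊎ Y ! i ≡ neg))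
          (sym (-! X i))
               (signs (X ! i) (Y ! i) (off dZ i) (zz dZ i))

closing : ∀ {A : Set} → A → A → List A → List (A × A)
closing x c [] = (c , x) ∷ []
closing x c (y ∷ ys) = (c , y) ∷ closing x y ys

-- The local function of cycleEdges cannot be named. Abstracting y ∷ ys makes its arguments
-- distinct variables, so that the left-hand side of closing-eq is found by unification.
mutual
  cycleEdges-closing : ∀ {A : Set} (x : A) xs → cycleEdges (x ∷ xs) ≡ closing x x xs
  cycleEdges-closing x [] = refl
  cycleEdges-closing x (y ∷ ys) with y ∷ ys
  ... | w = cong ((x , y) ∷_) (closing-eq x w y ys)

  closing-eq : ∀ {A : Set} (x : A) (xs : List A) (c : A) (l : List A) → _ ≡ closing x c l
  closing-eq x xs c [] = refl
  closing-eq x xs c (y ∷ l) = cong (_ ∷_) (closing-eq x xs y l)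

-- The cycle is rotated so that one of its forward edges becomes the closing strict step.
NoConformalCycle⇒Euclidean : ∀ {n} {O : OM n} → NoConformalCycle O → Euclidean O
NoConformalCycle⇒Euclidean ncc g f _ _ _ [] (_ , _ , _ , ())
NoConformalCycle⇒Euclidean {n} {O} ncc g f _ _ _ (x ∷ xs) (vx ∷ vxs , _ , es , fw) =
    finish (locate xs vx vxs (subst (All Edge) (cycleEdges-closing x xs) es) (subst (Any Fwd)
          (cycleEdges-closing x xs) fw))
  where
  Edge Fwd : SV n × SV n → Set
  Edge p = Adjacent O g f (proj₁ p) (proj₂ p) × (Forward O g f (proj₁ p) (proj₂ p) ⊎ Undirected O g f
        (proj₁ p) (proj₂ p))
  Fwd p = Forward O g f (proj₁ p) (proj₂ p)
  R : Sign → SV n → SV n → Set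
  R = CStep O g f
  up : ∀ {u v} → Vertex O g f u → Vertex O g f v → Edge (u , v) → Up R pos u v
  up vu vv (a , inj₁ (_ , e , d)) = pos , inj₂ refl , edge⇒CStep vu vv a e d
  up vu vv (a , inj₂ (_ , e , d)) = zer , inj₁ refl , edge⇒CStep vu vv a e d
  path : ∀ {c} l → Vertex O g f c → All (Vertex O g f) l → All Edge (closing x c l) → Star (Up R pos) c x
  path [] vc [] (e ∷ []) = up vc vx e ◅ ε
  path (y ∷ l) vc (vy ∷ vl) (e ∷ es) = up vc vy e ◅ path l vy vl es
  locate : ∀ {c} l → Vertex O g f c → All (Vertex O g f) l → All Edge (closing x c l) → Any Fwd (closing x c
        l) →
    ∃ λ u → ∃ λ v → Star (Up R pos) c u × R pos u v × Star (Up R pos) v x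
  locate [] vc [] ((a , _) ∷ []) (here (_ , e , d)) = _ , _ , ε , edge⇒CStep vc vx a e d , ε
  locate (y ∷ l) vc (vy ∷ vl) ((a , _) ∷ es) (here (_ , e , d)) = _ , _ , ε , edge⇒CStep vc vy a e d , path l
        vy vl es
  locate (y ∷ l) vc (vy ∷ vl) (e ∷ es) (there m) with locate l vy vl es m
  ... | u , v , p , r , q = u , v , up vc vy e ◅ p , r , q
  finish : (∃ λ u → ∃ λ v → Star (Up R pos) x u × R pos u v × Star (Up R pos) v x) → ⊥
  finish (u , v , p , r , q) = ncc g f (λ ()) (q ◅◅ p) r

-- Finite search, closures and the grading of the lattice of flats

anySV? : ∀ {n} {P : SV n → Set} → (∀ X → Dec (P X)) → Dec (∃ P)
anySV? {zero} P? with P? []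
... | yes p = yes ([] , p)
... | no np = no λ { ([] , p) → np p }
anySV? {suc n} P? with anySV? (λ X → P? (pos ∷ X)) | anySV? (λ X → P? (neg ∷ X)) | anySV? (λ X → P? (zer ∷ X))
... | yes (X , p) | _ | _ = yes (pos ∷ X , p)
... | no _ | yes (X , p) | _ = yes (neg ∷ X , p)
... | no _ | no _ | yes (X , p) = yes (zer ∷ X , p)
... | no p | no q | no r = no λ { (pos ∷ X , h) → p (X , h) ; (neg ∷ X , h) → q (X , h) ; (zer ∷ X , h) → r
      (X , h) }

⊑? : ∀ {n} (U W : SV n) → Dec (U ⊑ W)
⊑? U W with any? (λ e → (W ! e ≟ₛ zer) ×-dec ¬? (U ! e ≟ₛ zer))
... | yes (e , p , q) = no λ h → q (h e p)
... | no np = yes λ e p → go e p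
  where
  go : ∀ e → W ! e ≡ zer → U ! e ≡ zer
  go e p with U ! e ≟ₛ zer
  ... | yes q = q
  ... | no q = ⊥-elim (np (e , p , q))

module _ {n : ℕ} {P : SV n → Set} (P₀ : P zeroV) (P∘ : ∀ {X Y} → P X → P Y → P (X ∘ᵛ Y)) where

  compose : {A : Fin n → Set} → (∀ e → ∃ λ Q → P Q × (Q ! e ≡ zer → A e)) → ∃ λ R → P R × (∀ e → R ! e ≡ zer →
        A e)
  compose {A} h with go (allFin n)
    where
    go : (es : List (Fin n)) → ∃ λ R → P R × (∀ e → e List.∈ es → R ! e ≡ zer → A e)
    go [] = zeroV , P₀ , λ _ ()
    go (e ∷ es) with h e | go es
    ... | Q , pQ , hQ | R , pR , hR = Q ∘ᵛ R , P∘ pQ pR , λ { i (here refl) z → hQ (⊑-∘ˡ Q R i z) ; i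
          (there m) z → hR i m (⊑-∘ʳ Q R i z) }
  ... | R , pR , hR = R , pR , λ e → hR e (∈-allFin e)

  -- For every element a member that is nonzero there is picked, if one exists, and all of these are
  -- composed.
  largest : (∀ X → Dec (P X)) → ∃ λ R → P R × (∀ Q → P Q → Q ⊑ R)
  largest P? with compose {λ e → ∀ Q → P Q → Q ! e ≡ zer} pick
    where
    pick : ∀ e → ∃ λ Q → P Q × (Q ! e ≡ zer → ∀ Q → P Q → Q ! e ≡ zer)
    pick e with anySV? (λ Q → P? Q ×-dec ¬? (Q ! e ≟ₛ zer))
    ... | yes (Q , pQ , nz) = Q , pQ , λ h → ⊥-elim (nz h)
    ... | no np = zeroV , P₀ , λ _ Q pQ → vanish Q pQ
      where
      vanish : ∀ Q → P Q → Q ! e ≡ zer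
      vanish Q pQ with Q ! e ≟ₛ zer
      ... | yes z = z
      ... | no nz = ⊥-elim (np (Q , pQ , nz))
  ... | R , pR , h = R , pR , λ Q pQ e z → h e z Q pQ

module Graded {n : ℕ} (O : OM n) (Cov? : ∀ X → Dec (Cov O X)) where

  top : ∃ λ R → Cov O R × (∀ Q → Cov O Q → Q ⊑ R)
  top = largest (L0 O) (L2 O) Cov?

  -- z(R) is the closure of z(U) ∪ {e}.
  closure : ∀ U e → ∃ λ R → (Cov O R × R ⊑ U × R ! e ≡ zer) × (∀ Q → Cov O Q × Q ⊑ U × Q ! e ≡ zer → Q ⊑ R)
  closure U e = largest {P = λ Q → Cov O Q × Q ⊑ U × Q ! e ≡ zer} (L0 O , (λ i _ → zeroV! i) , zeroV! e)
    (λ { {X} {Y} (c , p , q) (c′ , p′ , q′) → L2 O c c′ , ∘-⊑ {X = X} {Y} {U} p p′ , ∘-zer {X = X} {Y} q q′ })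
    (λ Q → Cov? Q ×-dec (⊑? Q U ×-dec (Q ! e ≟ₛ zer)))

  -- Adding one element to a flat lowers its corank by at most one.
  Ht-closure : ∀ m {U W e} → Cov O U → U ! e ≢ zer → (∀ Q → Cov O Q → Q ⊑ U → Q ! e ≡ zer → Q ⊑ W) → Ht O m W
        → Ht O (suc m) U
  Ht-closure m {U} {W} {e} cU Ue max h Q cQ p x Qx Ux with Q ! e ≟ₛ zer
  ... | yes q = Ht-mono O m Q W (max Q cQ p q) h
  ... | no q = go m h
    where
    eliminate : ∃ λ N → Cov O N × N ⊑ U × N ! e ≡ zer × N ! x ≢ zer
    eliminate with cancel O e cQ cU q Ue
    ... | N , cN , Ne , left = N , cN , (λ i z → trans (left i (p i z)) z) , Ne , λ z → Ux
          (trans (sym (left x Qx)) z)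
    Wx : W ! x ≢ zer
    Wx z with eliminate
    ... | N , cN , pN , Ne , Nx = Nx (max N cN pN Ne x z)
    go : ∀ m → Ht O m W → Ht O m Q
    go zero h = ⊥-elim (Wx (h x))
    go (suc k) h with closure Q e
    ... | R , (cR , pR , Re) , maxR = Ht-closure k {Q} {R} cQ q (λ S cS pS Se → maxR S (cS , pS , Se))
            (h R cR (max R cR (λ i z → pR i (p i z)) Re) x (pR x Qx) Wx)

  -- The zeros of `W` are added to the flat of `U` one at a time. Each proper step lengthens the
  -- chain by one and, by `Ht-closure`, costs at most one in corank. So the same `k` is the length
  -- of a chain and, with the 2 for `W`, an upper bound for all chains.
  descend : ∀ {U W} (es : List (Fin n)) → Cov O U → Cov O W → W ⊑ U → Ht O 2 W →
    (∀ e → W ! e ≡ zer → U ! e ≢ zer → e List.∈ es) → ∃ λ k → Chain O (z U) (z W) k × Ht O (k + 2) U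
  descend {U} {W} [] cU cW p h all = 0 , subst (λ F → Chain O F (z W) 0) (cong-z zeros) (done (W , cW , refl))
        , Ht-mono O 2 U W U⊑W h
    where
    ∉[] : ∀ {e : Fin n} → ¬ (e List.∈ [])
    ∉[] ()
    U⊑W : U ⊑ W
    U⊑W e z with U ! e ≟ₛ zer
    ... | yes q = q
    ... | no q = ⊥-elim (∉[] (all e z q))
    zeros : ∀ e → isZero (W ! e) ≡ isZero (U ! e)
    zeros e with W ! e ≟ₛ zer | U ! e ≟ₛ zer
    ... | yes a | yes b = cong isZero (trans a (sym b))
    ... | yes a | no b = ⊥-elim (∉[] (all e a b))
    ... | no a | yes b = ⊥-elim (a (p e b))
    ... | no a | no b = trans (out a) (sym (out b))
      where
      out : ∀ {s} → s ≢ zer → isZero s ≡ outside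
      out {pos} _ = refl
      out {neg} _ = refl
      out {zer} h = ⊥-elim (h refl)
    cong-z : ∀ {m} {X Y : SV m} → (∀ e → isZero (X ! e) ≡ isZero (Y ! e)) → z X ≡ z Y
    cong-z {X = []} {[]} _ = refl
    cong-z {X = x ∷ X} {y ∷ Y} h = cong₂ _∷_ (h fzero) (cong-z (λ e → h (fsuc e)))
  descend {U} {W} (e ∷ es) cU cW p h all with W ! e ≟ₛ zer | U ! e ≟ₛ zer
  ... | yes We | no Ue with closure U e
  ... | R , (cR , pR , Re) , max with descend es cR cW (max W (cW , p , We)) h rest
    where
    rest : ∀ i → W ! i ≡ zer → R ! i ≢ zer → i List.∈ es
    rest i w r with all i w (λ u → r (pR i u))
    ... | here refl = ⊥-elim (r Re)
    ... | there m = m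
  ... | k , c , hR = suc k , step (U , cU , refl) (z-⊂ O {R} {U} pR Re Ue) c , Ht-closure (k + 2) {U} {R} cU
        Ue (λ Q cQ pQ Qe → max Q (cQ , pQ , Qe)) hR
  descend {U} {W} (e ∷ es) cU cW p h all | yes We | yes Ue = descend es cU cW p h rest
    where
    rest : ∀ i → W ! i ≡ zer → U ! i ≢ zer → i List.∈ es
    rest i w r with all i w r
    ... | here refl = ⊥-elim (r Ue)
    ... | there m = m
  descend {U} {W} (e ∷ es) cU cW p h all | no We | _ = descend es cU cW p h rest
    where
    rest : ∀ i → W ! i ≡ zer → U ! i ≢ zer → i List.∈ es
    rest i w r with all i w r
    ... | here refl = ⊥-elim (We w)
    ... | there m = m

  chain-bound : ∀ {F m} j {W} → Chain O F full m → z W ≡ F → Ht O j W → m ≤ j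
  chain-bound j (done _) _ _ = z≤n
  chain-bound zero {W} (step _ (_ , e , _ , e∉) _) refl h = ⊥-elim (e∉ (∈z O {W} (h e)))
  chain-bound (suc j) {W} (step _ (p , e , e∈ , e∉) c) refl h with chain-flat O c
  ... | U , cU , refl = s≤s (chain-bound j c refl (h U cU (λ i w → ∈z⁻ O {U} (p (∈z O {W} w))) e
        (∈z⁻ O {U} e∈) (λ w → e∉ (∈z O {W} w))))

  Ht⇒comodular : ∀ {g X Y} → Cov O X → Cov O Y → Ht O 1 X → Ht O 1 Y → X ! g ≢ zer → X ! g ≡ Y ! g → X ≢ Y →
    Ht O 2 (X ∘ᵛ Y) → Comodular O X Y
  Ht⇒comodular {g} {X} {Y} cX cY hX hY nz eq ne h =
      Ht⇒cocircuit O cX nz hX , Ht⇒cocircuit O cY (λ q → nz (trans eq q)) hY , ne , ne′ , k , rankF , rankTop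
    where
    ne′ : X ≢ - Y ᵛ
    ne′ q = nz (opp-fix (trans (cong (_! g) q) (trans (-! Y g) (cong opp (sym eq)))))
    T = X ∘ᵛ Y
    cT = L2 O cX cY
    d = descend (allFin n) (proj₁ (proj₂ top)) cT (proj₂ (proj₂ top) T cT) h (λ e _ _ → ∈-allFin e)
    k = proj₁ d
    bound : ∀ G m → Chain O G full m → m ≤ 2 + k
    bound G m c with chain-flat O c
    ... | U , cU , refl = subst (m ≤_) (+-comm k 2) (chain-bound (k + 2) c refl (Ht-mono O (k + 2) U
          (proj₁ top) (proj₂ (proj₂ top) U cU) (proj₂ (proj₂ d))))
    upper : Chain O (z T) full 2
    upper with splitter O cX hX cY nz eq
    ... | inj₂ q = ⊥-elim (ne (ext q))
    ... | inj₁ (e , p , q) = step (T , cT , refl) (z-⊂ O {X} {T} (⊑-∘ˡ X Y) p (∘-nzʳ {X = X} {Y} q))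
            (step (X , cX , refl) (z-⊂full O {X} nz) (done (full-flat O)))
    rankF : FlatRank O (z T) k
    rankF = (T , cT , refl) , (_ , proj₁ (proj₂ d)) , λ G m c →
      +-cancelˡ-≤ 2 m k (subst (_≤ 2 + k) (+-comm m 2) (bound G (m + 2) (chain-++ O c upper)))
    rankTop : FlatRank O full (2 + k)
    rankTop = full-flat O , (_ , subst (Chain O _ full) (+-comm k 2) (chain-++ O (proj₁ (proj₂ d)) upper)) ,
          bound

-- From the Euclidean property to closed walks

module _ {n : ℕ} {O : OM n} (Cov? : ∀ X → Dec (Cov O X)) (eu : Euclidean O) (g f : Fin n) where

  private
    E : SV n × SV n → Set
    E p = Adjacent O g f (proj₁ p) (proj₂ p) × (Forward O g f (proj₁ p) (proj₂ p) ⊎ Undirected O g f (proj₁ p)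
          (proj₂ p))

    Edge : SV n → SV n → Set
    Edge u v = E (u , v) × Vertex O g f u × Vertex O g f v

    data Path : SV n → List (SV n) → SV n → Set where
      stop : ∀ {y} → Path y [] y
      cons : ∀ {c v l y} → Edge c v → Path v l y → Path c (v ∷ l) y

    open DecList (≡-dec {n = n} _≟ₛ_) using (_∈?_)

    shortcut : ∀ {u c l y} → u List.∈ c ∷ l → Path c l y → Unique (c ∷ l) → ∃ λ l′ → Path u l′ y × Unique
          (u ∷ l′)
    shortcut (here refl) p q = _ , p , q
    shortcut (there m) (cons _ p) (_ ∷ q) = shortcut m p q

    -- Loop erasure, since a directed cycle must have distinct vertices. The strict edge that closes
    -- the walk is not part of the path and survives.
    simple : ∀ {x y} → Star Edge x y → ∃ λ l → Path x l y × Unique (x ∷ l)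
    simple ε = [] , stop , [] ∷ []
    simple {x} (_◅_ {j = v} e es) with simple es
    ... | l , p , q with x ∈? (v ∷ l)
    ... | yes m = shortcut m p q
    ... | no m = v ∷ l , cons e p , ¬Any⇒All¬ (v ∷ l) m ∷ q

    edges : ∀ {x c l y} → Path c l y → Edge y x → All E (closing x c l)
    edges stop (e , _) = e ∷ []
    edges (cons (e , _) p) r = e ∷ edges p r

    vertices : ∀ {x c l y} → Path c l y → Edge y x → All (Vertex O g f) (c ∷ l)
    vertices stop (_ , v , _) = v ∷ []
    vertices (cons (_ , v , _) p) r = v ∷ vertices p r

    forward : ∀ {x c l y} → Path c l y → Forward O g f y x → Any (λ p → Forward O g f (proj₁ p) (proj₂ p))
          (closing x c l)
    forward stop r = here r
    forward (cons _ p) r = there (forward p r)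

    toEdge : ∀ {d X Y} → X ! g ≡ pos → d ≡ zer ⊎ d ≡ pos → CStep O g f d X Y → Edge X Y
    toEdge {d} {X} {Y} gX h st@(s , conf , ne) with CStep⇒edge gX st
    ... | vX , vY , Z , el , dir = ((conf , Graded.Ht⇒comodular O Cov? cX cY hX hY (Step.gX s) gXY ne line) ,
          kind h) , vX , vY
      where
      open Step s hiding (gX; Z; dir)
      kind : d ≡ zer ⊎ d ≡ pos → Forward O g f X Y ⊎ Undirected O g f X Y
      kind (inj₁ q) = inj₂ (Z , el , trans dir q)
      kind (inj₂ q) = inj₁ (Z , el , trans dir q)

    pos-acyclic : ∀ {x y} → x ! g ≡ pos → Star (Up (CStep O g f) pos) x y → CStep O g f pos y x → ⊥
    pos-acyclic {x} {y} gx w r with restrict {R = CStep O g f} (λ u → u ! g ≡ pos) (λ s p → trans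
          (sym (Step.gXY (proj₁ s))) p) gx w
    ... | gy , w′ with simple (gmap {U = Edge} proj₁ (λ { {u , pu} (d , h , s) → toEdge pu h s }) w′) |
          CStep⇒edge gy r
    ... | l , p , u | vY , vX , Z , el , dir =
        eu g f g≢f (λ h → loop h) coloop (x ∷ l)
          (vertices p last , u , subst (All E) (sym (cycleEdges-closing x l)) (edges p last) ,
           subst (Any _) (sym (cycleEdges-closing x l)) (forward p (Z , el , dir)))
      where
      last : Edge y x
      last = toEdge gy (inj₂ refl) r
      s = proj₁ r
      pos≢zer : pos ≢ zer
      pos≢zer ()
      Zf : Step.Z s ! f ≢ zer
      Zf h = pos≢zer (trans (sym (Step.dir s)) h)
      g≢f : g ≢ f
      g≢f refl = Zf (at (Step.dZ s))
      loop : ¬ IsLoop O g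
      loop h = Step.gX s (h y (Step.cX s))
      -- A cocircuit supported on f alone would lie strictly below any vertex off f. So both ends
      -- would be on f, and the edge between them flat.
      coloop : ¬ IsColoop O f
      coloop (C , (cC , C≢ , _) , sup) = hit (y ! f ≟ₛ zer) (x ! f ≟ₛ zer)
        where
        Cf : C ! f ≢ zer
        Cf h with ≢zeroV C≢
        ... | i , nz = nz (subst (λ j → C ! j ≡ zer) (sym (sup i nz)) h)
        avoid : ∀ {V} → Cov O V → Ht O 1 V → V ! g ≢ zer → V ! f ≢ zer → ⊥
        avoid {V} cV hV Vg Vf = Cf (hV C cC C⊑V g Cg Vg f)
          where
          C⊑V : C ⊑ V
          C⊑V i z with C ! i ≟ₛ zer
          ... | yes q = q
          ... | no q = ⊥-elim (Vf (subst (λ j → V ! j ≡ zer) (sup i q) z))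
          Cg : C ! g ≡ zer
          Cg with C ! g ≟ₛ zer
          ... | yes q = q
          ... | no q = ⊥-elim (g≢f (sup g q))
        hit : Dec (y ! f ≡ zer) → Dec (x ! f ≡ zer) → ⊥
        hit (no p) _ = avoid (Step.cX s) (Step.hX s) (Step.gX s) p
        hit _ (no p) = avoid (Step.cY s) (Step.hY s) (Step.gY s) p
        hit (yes p) (yes q) = Zf (zz (Step.dZ s) f p q)

    CStep-rev : ∀ {d X Y} → CStep O g f d X Y → CStep O g f (opp d) Y X
    CStep-rev (s , c , ne) = Step-rev s , (λ e o → c e (opposite-sym o)) , ne ∘ sym

    CStep-neg : ∀ {d X Y} → CStep O g f d X Y → CStep O g f (opp d) (- X ᵛ) (- Y ᵛ)
    CStep-neg {d} {X} {Y} (s , c , ne) = Step-neg s , conf , λ q → ne (trans (sym (neg-neg X))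
          (trans (cong -_ᵛ q) (neg-neg Y)))
      where
      flip : ∀ {s t} → Opposite (opp s) (opp t) → Opposite s t
      flip {s} {t} o = opp⇒opposite (λ { refl → Opposite-nzˡ o refl }) (opp-inj (opposite⇒opp o))
      conf : Conformal (- X ᵛ) (- Y ᵛ)
      conf e o = c e (flip (subst (λ t → Opposite t (opp (Y ! e))) (-! X e) (subst (Opposite ((- X ᵛ) ! e))
            (-! Y e) o)))

    opp-up : ∀ {d δ} → d ≡ zer ⊎ d ≡ δ → opp d ≡ zer ⊎ opp d ≡ opp δ
    opp-up (inj₁ refl) = inj₁ refl
    opp-up (inj₂ refl) = inj₂ refl

    pos-acyclic± : ∀ {δ x y} → δ ≢ zer → x ! g ≡ pos → Star (Up (CStep O g f) δ) x y → CStep O g f δ y x → ⊥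
    pos-acyclic± {pos} _ gx w r = pos-acyclic gx w r
    pos-acyclic± {zer} δ≢ _ _ _ = δ≢ refl
    pos-acyclic± {neg} _ gx w r = pos-acyclic (trans (Step.gXY (proj₁ r)) gx)
      (reverse {U = Up (CStep O g f) pos} (λ { (d , h , s) → opp d , opp-up h , CStep-rev s }) w)
            (CStep-rev r)

  Euclidean⇒NoConformalCycle : Acyclic (CStep O g f)
  -- The graph uses only vertices positive at g and forward edges. Negating all covectors repairs
  -- the sign at g, and reversing the walk repairs the direction.
  Euclidean⇒NoConformalCycle {δ} δ≢ {x} {y} w r with x ! g in eq
  ... | pos = pos-acyclic± δ≢ eq w r
  ... | zer = ⊥-elim (Step.gY (proj₁ r) eq)
  ... | neg = pos-acyclic± (opp-nz δ≢) (trans (-! x g) (cong opp eq))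
      (gmap {U = Up (CStep O g f) (opp δ)} -_ᵛ (λ { (d , h , s) → opp d , opp-up h , CStep-neg s }) w)
            (CStep-neg r)

-- Deletion, and uniqueness of extensions

module Deletion {N M : ℕ} (O⁺ : OM N) (O⁻ : OM M) (ι : Fin M → Fin N) (q : Fin N)
  (cover : ∀ e → e ≡ q ⊎ ∃ λ i → e ≡ ι i) (rm : SV N → SV M) (rm! : ∀ X i → rm X ! i ≡ X ! ι i)
  (down : ∀ {X} → Cov O⁺ X → Cov O⁻ (rm X)) (up : ∀ {Y} → Cov O⁻ Y → ∃ λ X → Cov O⁺ X × rm X ≡ Y)
  (not-coloop : ∀ {X} → Cov O⁺ X → (∀ i → rm X ! i ≡ zer) → X ! q ≡ zer) where

  private
    rm-⊑ : ∀ {U X} → U ⊑ X → rm U ⊑ rm X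
    rm-⊑ {U} {X} p i h = trans (rm! U i) (p (ι i) (trans (sym (rm! X i)) h))

    eliminate : ∀ {U X} i → Cov O⁺ U → Cov O⁺ X → U ⊑ X → U ! ι i ≢ zer → U ! q ≡ zer →
      ∃ λ R → Cov O⁺ R × R ⊑ X × R ! ι i ≡ zer × R ! q ≡ X ! q
    eliminate {U} {X} i cU cX p nz Uq with cancel O⁺ (ι i) cU cX nz (λ h → nz (p (ι i) h))
    ... | R , cR , Ri , left = R , cR , (λ e h → trans (left e (p e h)) h) , Ri , left q Uq

  -- Deleting a non-coloop preserves corank. The delicate case is a drop from `X` to `U` visible
  -- only at `q`: eliminating a further element between them gives a covector `R` off `q`, and the
  -- drop at `q` is moved down to the one from `V ∘ᵛ R` to `V`, while the drop seen by the deletion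
  -- is now at the top.
  Ht-lift : ∀ m {X} → Cov O⁺ X → Ht O⁻ m (rm X) → Ht O⁺ m X
  Ht-lift zero {X} cX h e with cover e
  ... | inj₁ refl = not-coloop cX h
  ... | inj₂ (i , refl) = trans (sym (rm! X i)) (h i)
  Ht-lift (suc m) {X} cX h U cU p e Ue Xe with any? (λ i → (rm U ! i ≟ₛ zer) ×-dec ¬? (rm X ! i ≟ₛ zer))
  ... | yes (i , u , x) = Ht-lift m cU (h (rm U) (down cU) (rm-⊑ {U} {X} p) i u x)
  ... | no np = go m (Ht-lift m) h
    where
    at-q : e ≡ q
    at-q with cover e
    ... | inj₁ r = r
    ... | inj₂ (i , refl) = ⊥-elim (np (i , trans (rm! U i) Ue , λ z → Xe (trans (sym (rm! X i)) z)))
    Uq : U ! q ≡ zer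
    Uq = subst (λ j → U ! j ≡ zer) at-q Ue
    Xq : X ! q ≢ zer
    Xq z = Xe (subst (λ j → X ! j ≡ zer) (sym at-q) z)
    go : ∀ m → (∀ {X} → Cov O⁺ X → Ht O⁻ m (rm X) → Ht O⁺ m X) → Ht O⁻ (suc m) (rm X) → Ht O⁺ m U
    go zero lifted h with nonzero (rm U)
    ... | inj₁ z = lifted cU z
    ... | inj₂ (i , nz) with eliminate i cU cX p (λ z → nz (trans (rm! U i) z)) Uq
    ... | R , cR , pR , Ri , Rq = ⊥-elim (Xq (trans (sym Rq) (not-coloop cR
            (h (rm R) (down cR) (rm-⊑ {R} {X} pR) i (trans (rm! R i) Ri) (λ z → nz (rm-⊑ {U} {X} p i z))))))
    go (suc k) lifted h V cV pV x Vx Ux with cover x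
    ... | inj₁ refl = ⊥-elim (Ux Uq)
    ... | inj₂ (i , refl) with eliminate i cU cX p Ux Uq
    ... | R , cR , pR , Ri , Rq = lifted (L2 O⁺ cV cR)
            (h (rm (V ∘ᵛ R)) (down (L2 O⁺ cV cR)) (rm-⊑ {V ∘ᵛ R} {X} (∘-⊑ {X = V} {R} {X} (λ e z → pV e
                  (p e z)) pR)) i
              (trans (rm! (V ∘ᵛ R) i) (∘-zer {X = V} {R} Vx Ri)) (λ z → Ux (p (ι i) (trans (sym (rm! X i))
                    z))))
            V cV (⊑-∘ˡ V R) q (pV q Uq) (∘-nzʳ {X = V} {R} (λ z → Xq (trans (sym Rq) z)))

  Step-lift : ∀ {g f d X X′} → Cov O⁺ X → Cov O⁺ X′ → Step O⁻ g f d (rm X) (rm X′) → Step O⁺ (ι g) (ι f) d X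
        X′
  Step-lift {g} {f} {d} {X} {X′} cX cX′ s with diff O⁺ (ι g) cX cX′ eqg nzg
    where
    eqg : X ! ι g ≡ X′ ! ι g
    eqg = trans (sym (rm! X g)) (trans (Step.gXY s) (rm! X′ g))
    nzg : X ! ι g ≢ zer
    nzg z = Step.gX s (trans (rm! X g) z)
  ... | N′ , cN , dN = mkStep cX cX′ (Ht-lift 1 cX (Step.hX s)) (Ht-lift 1 cX′ (Step.hY s)) nzg eqg
          (Ht-lift 2 (L2 O⁺ cX cX′) (subst (Ht O⁻ 2) (sym rm-∘) (Step.line s))) N′ cN dN
          (trans (sym (rm! N′ f)) (Step-dir s (down cN) dN′))
    where
    eqg : X ! ι g ≡ X′ ! ι g
    eqg = trans (sym (rm! X g)) (trans (Step.gXY s) (rm! X′ g))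
    nzg : X ! ι g ≢ zer
    nzg z = Step.gX s (trans (rm! X g) z)
    rm-∘ : rm (X ∘ᵛ X′) ≡ rm X ∘ᵛ rm X′
    rm-∘ = ext λ i → trans (rm! (X ∘ᵛ X′) i) (trans (∘! X X′ (ι i)) (sym (trans (∘! (rm X) (rm X′) i)
          (cong₂ comp (rm! X i) (rm! X′ i)))))
    dN′ : Diff g (rm X) (rm X′) (rm N′)
    dN′ = mkDiff (trans (rm! N′ g) (at dN))
      (λ i ne → trans (rm! N′ i) (trans (off dN (ι i) (λ z → ne (trans (rm! X i) (trans z (sym (rm! X′ i))))))
        (sym (cong₂ (λ s t → comp (opp s) t) (rm! X i) (rm! X′ i)))))
      (λ i z z′ → trans (rm! N′ i) (zz dN (ι i) (trans (sym (rm! X i)) z) (trans (sym (rm! X′ i)) z′)))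

  -- A `Step` does not ask for conformality, so an edge lifts to any lifts of its ends. One lift per
  -- vertex is fixed first, which keeps the lifted walk connected and closed.
  deletion-acyclic : NoCycle O⁺ → NoCycle O⁻
  deletion-acyclic nc g f {δ} δ≢ {x} {y} w r with restrict {R = Step O⁻ g f} P (λ s _ → up (Step.cY s))
        (up (Step.cY r)) w
    where
    P : SV M → Set
    P Y = ∃ λ X → Cov O⁺ X × rm X ≡ Y
  ... | py , w′ = nc (ι g) (ι f) δ≢ (gmap {U = Up (Step O⁺ (ι g) (ι f)) δ} (λ u → proj₁ (proj₂ u))
                    (λ { {u} {v} (d , h , s) → d , h , lifted (proj₂ u) (proj₂ v) s }) w′)
                          (lifted py (up (Step.cY r)) r)
    where
    lifted : ∀ {d Y Y′} (p : ∃ λ X → Cov O⁺ X × rm X ≡ Y) (p′ : ∃ λ X → Cov O⁺ X × rm X ≡ Y′) →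
      Step O⁻ g f d Y Y′ → Step O⁺ (ι g) (ι f) d (proj₁ p) (proj₁ p′)
    lifted (X , cX , refl) (X′ , cX′ , refl) s = Step-lift cX cX′ s

module _ {n : ℕ} {O₁ O₂ : OM n} (to : ∀ {X} → Cov O₁ X → Cov O₂ X) (from : ∀ {X} → Cov O₂ X → Cov O₁ X) where

  private
    Ht-from : ∀ m {X} → Ht O₁ m X → Ht O₂ m X
    Ht-from zero h = h
    Ht-from (suc m) h U cU p e u w = Ht-from m (h U (from cU) p e u w)

  transport-acyclic : NoCycle O₂ → NoCycle O₁
  transport-acyclic nc g f δ≢ w r = nc g f δ≢ (gmap (λ X → X) (λ { (d , h , s) → d , h , moved s }) w)
        (moved r)
    where
    moved : ∀ {d X Y} → Step O₁ g f d X Y → Step O₂ g f d X Y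
    moved {X = X} {Y} (mkStep cX cY hX hY gX gXY line Z cZ dZ dir) =
      mkStep (to cX) (to cY) (Ht-from 1 {X} hX) (Ht-from 1 {Y} hY) gX gXY (Ht-from 2 {X ∘ᵛ Y} line) Z (to cZ)
            dZ dir

-- Extension by a loop, deletion, and the iterated construction

loopExtension : ∀ {n} → OM n → OM (suc n)
loopExtension {n} O = record
  { Cov = Cov₀
  ; L0 = refl , L0 O
  ; L1 = λ { {_ ∷ X} (refl , c) → refl , L1 O c }
  ; L2 = λ { {_ ∷ X} {_ ∷ Y} (refl , c) (refl , c′) → refl , L2 O c c′ }
  ; L3 = λ { {_ ∷ X} {_ ∷ Y} e (p , c) (p′ , c′) o → l3 e p c p′ c′ o } }
  where
  Cov₀ : SV (suc n) → Set
  Cov₀ (s ∷ X) = s ≡ zer × Cov O X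
  l3 : ∀ {s t X Y} e → s ≡ zer → Cov O X → t ≡ zer → Cov O Y → InSep (s ∷ X) (t ∷ Y) e →
    ∃ λ Z → Cov₀ Z × Z ! e ≡ zer × (∀ f → ¬ InSep (s ∷ X) (t ∷ Y) f → Z ! f ≡ ((s ∷ X) ∘ᵛ (t ∷ Y)) ! f)
  l3 fzero refl c refl c′ o = ⊥-elim (Opposite-nzˡ o refl)
  l3 (fsuc e) refl c refl c′ o with L3 O e c c′ o
  ... | Z , cZ , Ze , h = zer ∷ Z , (refl , cZ) , Ze , λ { fzero _ → refl ; (fsuc f) ns → h f ns }

loop-acyclic : ∀ {n} {O : OM n} → NoCycle O → NoCycle (loopExtension O)
loop-acyclic {n} {O} nc g fzero δ≢ w r = δ≢ (trans (sym (Step.dir r)) (head-zero (Step.Z r) (Step.cZ r)))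
  where
  head-zero : ∀ X → Cov (loopExtension O) X → X ! fzero ≡ zer
  head-zero (_ ∷ _) (p , _) = p
loop-acyclic {n} {O} nc fzero (fsuc f) δ≢ {x} w r = Step.gY r (head-zero x (Step.cY r))
  where
  head-zero : ∀ X → Cov (loopExtension O) X → X ! fzero ≡ zer
  head-zero (_ ∷ _) (p , _) = p
loop-acyclic {n} {O} nc (fsuc g) (fsuc f) {δ} δ≢ w r =
    nc g f δ≢ (gmap {U = Up (Step O g f) δ} tail (λ { {X} {Y} (d , h , s) → d , h , tails X Y s }) w)
          (tails _ _ r)
  where
  Ht-tail : ∀ m {s X} → Ht (loopExtension O) m (s ∷ X) → Ht O m X
  Ht-tail zero h e = h (fsuc e)
  Ht-tail (suc m) {s} {X} h U cU p e u v = Ht-tail m (h (zer ∷ U) (refl , cU) (λ { fzero _ → refl ; (fsuc i) z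
        → p i z }) (fsuc e) u v)
  tails : ∀ {d} X Y → Step (loopExtension O) (fsuc g) (fsuc f) d X Y → Step O g f d (tail X) (tail Y)
  tails (s ∷ X) (t ∷ Y) (mkStep cX cY hX hY gX gXY line (_ ∷ Z) cZ dZ dir) =
    mkStep (proj₂ cX) (proj₂ cY) (Ht-tail 1 {s} hX) (Ht-tail 1 {t} hY) gX gXY (Ht-tail 2 {comp s t} line) Z
          (proj₂ cZ)
      (mkDiff (at dZ) (λ e → off dZ (fsuc e)) (λ e → zz dZ (fsuc e))) dir

-- The deleted element is 1; the extension elements p and q are 0 and 1.
delete : ∀ {n} → OM (suc (suc n)) → OM (suc n)
delete {n} O = record
  { Cov = Cov₁
  ; L0 = zer , L0 O
  ; L1 = λ { {_ ∷ X} (t , c) → opp t , L1 O c }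
  ; L2 = λ { {_ ∷ X} {_ ∷ Y} (t , c) (t′ , c′) → comp t t′ , L2 O c c′ }
  ; L3 = λ { {_ ∷ X} {_ ∷ Y} e (t , c) (t′ , c′) o → l3 e t c t′ c′ o } }
  where
  Cov₁ : SV (suc n) → Set
  Cov₁ (s ∷ X) = ∃ λ t → Cov O (s ∷ t ∷ X)
  l3 : ∀ {s s′ X Y} e t → Cov O (s ∷ t ∷ X) → ∀ t′ → Cov O (s′ ∷ t′ ∷ Y) → InSep (s ∷ X) (s′ ∷ Y) e →
    ∃ λ Z → Cov₁ Z × Z ! e ≡ zer × (∀ f → ¬ InSep (s ∷ X) (s′ ∷ Y) f → Z ! f ≡ ((s ∷ X) ∘ᵛ (s′ ∷ Y)) ! f)
  l3 fzero t c t′ c′ o with L3 O fzero c c′ o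
  ... | r ∷ u ∷ Z , cZ , Ze , h = r ∷ Z , (u , cZ) , Ze , λ { fzero ns → h fzero ns ; (fsuc f) ns → h
        (fsuc (fsuc f)) ns }
  l3 (fsuc e) t c t′ c′ o with L3 O (fsuc (fsuc e)) c c′ o
  ... | r ∷ u ∷ Z , cZ , Ze , h = r ∷ Z , (u , cZ) , Ze , λ { fzero ns → h fzero ns ; (fsuc f) ns → h
        (fsuc (fsuc f)) ns }

delete-acyclic : ∀ {n} {O : OM (suc (suc n))} → (∀ {s t X} → Cov O (s ∷ t ∷ X) → s ≡ zer → (∀ e → X ! e ≡ zer)
      → t ≡ zer) →
  NoCycle O → NoCycle (delete O)
delete-acyclic {n} {O} nco = Deletion.deletion-acyclic O (delete O) ι (fsuc fzero) cover rm rm! (λ {X} → down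
      X) (λ {Y} → up Y) (λ {X} → not-coloop X)
  where
  ι : Fin (suc n) → Fin (suc (suc n))
  ι fzero = fzero
  ι (fsuc i) = fsuc (fsuc i)
  cover : ∀ e → e ≡ fsuc fzero ⊎ ∃ λ i → e ≡ ι i
  cover fzero = inj₂ (fzero , refl)
  cover (fsuc fzero) = inj₁ refl
  cover (fsuc (fsuc i)) = inj₂ (fsuc i , refl)
  rm : SV (suc (suc n)) → SV (suc n)
  rm (s ∷ t ∷ X) = s ∷ X
  rm! : ∀ X i → rm X ! i ≡ X ! ι i
  rm! (s ∷ t ∷ X) fzero = refl
  rm! (s ∷ t ∷ X) (fsuc i) = refl
  down : ∀ X → Cov O X → Cov (delete O) (rm X)
  down (s ∷ t ∷ X) c = t , c
  up : ∀ Y → Cov (delete O) Y → ∃ λ X → Cov O X × rm X ≡ Y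
  up (s ∷ Y) (t , c) = s ∷ t ∷ Y , c , refl
  not-coloop : ∀ X → Cov O X → (∀ i → rm X ! i ≡ zer) → X ! fsuc fzero ≡ zer
  not-coloop (s ∷ t ∷ X) c h = nco c (h fzero) (λ e → h (fsuc e))

record Extends {n : ℕ} (O : OM n) (O′ : OM (suc n)) (σ : SV n → Sign) : Set where
  field
    lifts      : ∀ {X} → Cov O X → ∃ λ s → Cov O′ (s ∷ X)
    restricts  : ∀ {s X} → Cov O′ (s ∷ X) → Cov O X
    not-coloop : ∀ {s X} → Cov O′ (s ∷ X) → (∀ e → X ! e ≡ zer) → s ≡ zer
    localizes  : ∀ {Y} → Cocircuit O Y → Cov O′ (σ Y ∷ Y)

IsExtension⇒Extends : ∀ {n} {O : OM n} {O′ σ} → IsExtension O O′ σ → Extends O O′ σ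
IsExtension⇒Extends {n} {O} {O′} (lf , rs , nco , lc) = record
  { lifts = λ {X} → lf X ; restricts = λ {s} {X} → rs X s ; not-coloop = λ {s} {X} → not-coloop s X ;
        localizes = λ {Y} → lc Y }
  where
  not-coloop : ∀ s X → Cov O′ (s ∷ X) → (∀ e → X ! e ≡ zer) → s ≡ zer
  not-coloop s X c h with s ≟ₛ zer
  ... | yes p = p
  ... | no p = ⊥-elim (nco (s ∷ X , Ht⇒cocircuit O′ {u = fzero} c p point , support))
    where
    point : Ht O′ 1 (s ∷ X)
    point U cU q fzero u w fzero = u
    point U cU q fzero u w (fsuc i) = q (fsuc i) (h i)
    point U cU q (fsuc e) u w = ⊥-elim (w (h e))
    support : ∀ f → (s ∷ X) ! f ≢ zer → f ≡ fzero
    support fzero _ = refl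
    support (fsuc f) nz = ⊥-elim (nz (h f))

-- The lexicographic extension [e^α, es] is [e^α, q^+] followed by the deletion of q, where q = [es].
build : ∀ {n} → OM n → List (Fin n × Sign) → OM (suc n)
build O [] = loopExtension O
build O ((e , α) ∷ es) = delete (LexExtension.lex (build O es) (fsuc e) α fzero pos)

lexσ-cons : ∀ {n} {e : Fin n} {α es} (Y : SV n) → α ≢ zer → lexσ ((e , α) ∷ es) Y ≡ comp (mul α (Y ! e))
      (lexσ es Y)
lexσ-cons {e = e} {α} Y α≢ with lookup Y e
... | zer = cong (λ t → comp t _) (sym (mul-zerʳ α))
... | pos = sym (comp-nz (mul-nz α≢ λ ()))
... | neg = sym (comp-nz (mul-nz α≢ λ ()))

build-extends : ∀ {n} (O : OM n) es → All (λ p → proj₂ p ≢ zer) es → Extends O (build O es) (lexσ es)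
build-extends O [] [] = record
  { lifts = λ c → zer , refl , c ; restricts = proj₂ ; not-coloop = λ c _ → proj₁ c ; localizes = λ c → refl ,
        proj₁ c }
build-extends {n} O ((e , α) ∷ es) (α≢ ∷ nz) = record
  { lifts = λ c → _ , proj₁ (lifts c) , lift (proj₂ (lifts c))
  ; restricts = λ { (t , c , _) → restricts c }
  ; not-coloop = λ { {s} {X} (t , c , v) h → zero′ v (not-coloop c h) h }
  ; localizes = λ {Y} cc → lexσ es Y , subst (λ t → Cov′ (t ∷ lexσ es Y ∷ Y)) (sym (lexσ-cons {e = e} {α} {es}
        Y α≢)) (lift (localizes cc)) }
  where
  open Extends (build-extends O es nz)
  open Lexicographic (build O es) (fsuc e) α fzero pos α≢ (λ ()) using (lift; Cov′; Val; Wit-nz; canon-zer)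
  zero′ : ∀ {s t X} → Val s (t ∷ X) → t ≡ zer → (∀ i → X ! i ≡ zer) → s ≡ zer
  zero′ {t = t} {X} (inj₁ p) q h = trans p (canon-zer {t ∷ X} (h e) q)
  zero′ (inj₂ w) q h = ⊥-elim (Wit-nz w (h e))

build-acyclic : ∀ {n} (O : OM n) es → All (λ p → proj₂ p ≢ zer) es → NoCycle O → NoCycle (build O es)
build-acyclic O [] [] nc = loop-acyclic nc
build-acyclic O ((e , α) ∷ es) (α≢ ∷ nz) nc =
  delete-acyclic (λ { (c , _) _ h → Extends.not-coloop (build-extends O es nz) c h })
    (NoConformalCycle⇒NoCycle (LexAcyclic.lex-acyclic (build O es) (fsuc e) α fzero pos α≢ (λ ())
          (build-acyclic O es nz nc)))

-- Conformal decomposition and uniqueness of the extension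

module Decompose {n : ℕ} (O : OM n) (Cov? : ∀ X → Dec (Cov O X)) where

  private
    Shrunk : SV n → Fin n → Set
    Shrunk X x = ∃ λ N → Cov O N × N ≼ X × N ! x ≡ X ! x × ∃ λ h → N ! h ≡ zer × X ! h ≢ zer

    -- Every elimination is made against `X` itself. It keeps the common entry at `x`, creates no
    -- new separation, and leaves a zero off the zeros of `X`, so the final conformal covector is
    -- still strictly smaller.
    conform : ∀ {X N x h} (es : List (Fin n)) → Cov O X → Cov O N → N ⊑ X → N ! x ≡ X ! x → N ! h ≡ zer → X !
          h ≢ zer →
      (∀ e → InSep X N e → e List.∈ es) → Shrunk X x
    conform {X} {N} {x} {h} [] cX cN p Nx Nh Xh sep = N , cN , below′ , Nx , h , Nh , Xh
      where
      ∉[] : ∀ {e : Fin n} → ¬ (e List.∈ [])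
      ∉[] ()
      below′ : N ≼ X
      below′ e with N ! e ≟ₛ zer
      ... | yes q = inj₁ q
      ... | no q = inj₂ (sym (nosep⇒≡ (λ o → ∉[] (sep e o)) (λ z → q (p e z)) q))
    conform {X} {N} {x} {h} (e ∷ es) cX cN p Nx Nh Xh sep with Opposite? (X ! e) (N ! e)
    ... | no no′ = conform es cX cN p Nx Nh Xh (λ i o → rest i o (sep i o))
      where
      rest : ∀ i → InSep X N i → i List.∈ e ∷ es → i List.∈ es
      rest i o (here refl) = ⊥-elim (no′ o)
      rest i o (there m) = m
    ... | yes o with L3 O e cX cN o
    ... | Q , cQ , Qe , offQ = conform {X} {Q} {x} {e} es cX cQ Q⊑X Qx Qe (Opposite-nzˡ o) sepQ
      where
      Q⊑X : Q ⊑ X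
      Q⊑X i z = trans (offQ i (λ o′ → Opposite-nzˡ o′ z)) (∘-zer {X = X} {N} z (p i z))
      Qx : Q ! x ≡ X ! x
      Qx = trans (offQ x (Opposite-irrefl (sym Nx))) (trans (∘! X N x) (trans (cong (comp (X ! x)) Nx)
            (comp-idem _)))
      sepQ : ∀ i → InSep X Q i → i List.∈ es
      sepQ i o′ with Opposite? (X ! i) (N ! i)
      ... | no no′ = ⊥-elim (Opposite-irrefl (sym (trans (offQ i no′) (trans (∘! X N i)
            (comp-nz (Opposite-nzˡ o′))))) o′)
      ... | yes o″ with sep i o″
      ... | here refl = ⊥-elim (Opposite-nzʳ o′ Qe)
      ... | there m = m

    shrink : ∀ {X U x u e} → Cov O X → Cov O U → U ⊑ X → U ! e ≡ zer → X ! e ≢ zer → U ! u ≢ zer → X ! x ≢ zer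
          → Shrunk X x
    shrink {X} {U} {x} {u} {e} cX cU p Ue Xe Uu Xx with U ! x ≟ₛ zer
    shrink {X} {U} {x} {u} {e} cX cU p Ue Xe Uu Xx | yes Ux with cancel O u cU cX Uu (λ z → Uu (p u z))
    ... | N , cN , Nu , left = conform {h = u} (allFin n) cX cN (λ i z → trans (left i (p i z)) z) (left x Ux)
          Nu (λ z → Uu (p u z)) (λ i _ → ∈-allFin i)
    shrink {X} {U} {x} {u} {e} cX cU p Ue Xe Uu Xx | no Ux with ±-split Ux Xx
    ... | inj₁ eq = conform {h = e} (allFin n) cX cU p eq Ue Xe (λ i _ → ∈-allFin i)
    ... | inj₂ eq = conform {h = e} (allFin n) cX (L1 O cU) (λ i z → neg-⊑ U i (p i z)) (trans (-! U x)
          (trans (cong opp eq) (opp-opp _)))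
            (neg-⊑ U e Ue) Xe (λ i _ → ∈-allFin i)

  -- The number `k` is fuel: each shrinking adds a zero, and at `k` equal to zero there would be
  -- more than `n` of them.
  decompose : ∀ k {X x} → n < k + ∣ z X ∣ → Cov O X → X ! x ≢ zer → ∃ λ C → Cov O C × Ht O 1 C × C ≼ X × C ! x
        ≢ zer
  decompose zero {X} sz _ _ = ⊥-elim (<⇒≱ sz (∣p∣≤n (z X)))
  decompose (suc k) {X} {x} sz cX Xx
    with anySV? (λ U → Cov? U ×-dec (⊑? U X ×-dec (any? (λ e → (U ! e ≟ₛ zer) ×-dec ¬? (X ! e ≟ₛ zer)) ×-dec
          any? (λ u → ¬? (U ! u ≟ₛ zer)))))
  ... | no np = X , cX , point , (λ _ → inj₂ refl) , Xx
    where
    point : Ht O 1 X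
    point U cU p e u w with nonzero U
    ... | inj₁ z = z
    ... | inj₂ nz = ⊥-elim (np (U , cU , p , (e , u , w) , nz))
  ... | yes (U , cU , p , (e , Ue , Xe) , (u , Uu)) with shrink cX cU p Ue Xe Uu Xx
  ... | N , cN , N≼X , Nx , h , Nh , Xh
    with decompose k {N} {x} (<-≤-trans sz (subst (_≤ k + ∣ z N ∣) (+-suc k ∣ z X ∣) (+-monoʳ-≤ k (p⊂q⇒∣p∣<∣q∣
          (z-⊂ O {N} {X} (≼⇒⊑ {X = N} {X} N≼X) Nh Xh))))) cN (λ z → Xx (trans (sym Nx) z))
  ... | C , cC , hC , C≼N , Cx = C , cC , hC , C≼X , Cx
    where
    C≼X : C ≼ X
    C≼X i with C≼N i
    ... | inj₁ q = inj₁ q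
    ... | inj₂ q with N≼X i
    ... | inj₁ r = inj₁ (trans q r)
    ... | inj₂ r = inj₂ (trans q r)

module Unique-extension {n : ℕ} {O : OM n} {O₁ O₂ : OM (suc n)} {σ : SV n → Sign} (E₁ : Extends O O₁ σ)
      (E₂ : Extends O O₂ σ)
  (Cov? : ∀ X → Dec (Cov O X)) (Cov₁? : ∀ X → Dec (Cov O₁ X)) where

  private
    module E₁ = Extends E₁
    module E₂ = Extends E₂

    minimal : ∀ {y x} → Cov O y → y ! x ≢ zer → ∃ λ C → Cov O C × Ht O 1 C × C ≼ y × C ! x ≢ zer
    minimal {y} c nz = Decompose.decompose O Cov? (suc n) {y} (m≤m+n (suc n) _) c nz

    -- Eliminating `x` between the two lifts leaves a covector that vanishes on the old elements and
    -- hence at p, which is not a coloop; so the lifts do not differ at p.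
    unique-lift : ∀ {s t y x} → Ht O 1 y → y ! x ≢ zer → Cov O₁ (s ∷ y) → Cov O₁ (t ∷ y) → s ≡ t
    unique-lift {s} {t} {y} {x} hy nz c c′ with diff O₁ (fsuc x) c c′ refl nz
    ... | r ∷ N , cN , dN = same dN fzero (E₁.not-coloop cN (hy N (E₁.restricts cN) (λ i z → zz dN (fsuc i) z
          z) x (at dN) nz))

    strict : ∀ {X Y : SV n} → X ≼ Y → X ≢ Y → ∃ λ h → X ! h ≡ zer × Y ! h ≢ zer
    strict {X} {Y} p ne with any? (λ h → (X ! h ≟ₛ zer) ×-dec ¬? (Y ! h ≟ₛ zer))
    ... | yes q = q
    ... | no nq = ⊥-elim (ne (ext agree))
      where
      agree : ∀ e → X ! e ≡ Y ! e
      agree e with p e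
      ... | inj₂ q = q
      ... | inj₁ q with Y ! e ≟ₛ zer
      ... | yes r = trans q (sym r)
      ... | no r = ⊥-elim (nq (e , q , r))

    cons-⊑′ : ∀ {X Y : SV n} {s t} → (t ≡ zer → s ≡ zer) → X ≼ Y → s ∷ X ⊑ t ∷ Y
    cons-⊑′ h p fzero = h
    cons-⊑′ {X} {Y} h p (fsuc e) = ≼⇒⊑ {X = X} {Y} p e

    -- A cocircuit on p that is not a cocircuit of O is the p-elimination of two cocircuits of O.
    module Between {s y V₁ V₂ h x} (cs : Cov O₁ (s ∷ y)) (hs : Ht O₁ 1 (s ∷ y))
      (c₁ : Cov O V₁) (h₁ : Ht O 1 V₁) (p₁ : V₁ ≼ y) (x₁ : V₁ ! x ≢ zer)
      (c₂ : Cov O V₂) (h₂ : Ht O 1 V₂) (p₂ : V₂ ≼ y) (x₂ : V₂ ! h ≢ zer)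
      (V₁h : V₁ ! h ≡ zer) (yh : y ! h ≢ zer) where

      s₁ s₂ : Sign
      s₁ = σ V₁
      s₂ = σ V₂

      l₁ : Cov O₁ (s₁ ∷ V₁)
      l₁ = E₁.localizes (Ht⇒cocircuit O c₁ x₁ h₁)

      l₂ : Cov O₁ (s₂ ∷ V₂)
      l₂ = E₁.localizes (Ht⇒cocircuit O c₂ x₂ h₂)

      s≡ : s ≡ zer
      s≡ with s ≟ₛ zer
      ... | yes p = p
      ... | no p = ⊥-elim (x₁ (hs (s₁ ∷ V₁) l₁ (cons-⊑′ {V₁} {y} (λ z → ⊥-elim (p z)) p₁) (fsuc h) V₁h yh
            (fsuc x)))

      s₁≢ : s₁ ≢ zer
      s₁≢ z = x₁ (hs (s₁ ∷ V₁) l₁ (cons-⊑′ {V₁} {y} (λ _ → z) p₁) (fsuc h) V₁h yh (fsuc x))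

      s₂≢ : s₂ ≢ zer
      s₂≢ z with ≡-dec _≟ₛ_ V₂ y
      ... | yes refl = x₁ (h₂ V₁ c₁ (≼⇒⊑ {X = V₁} {V₂} p₁) h V₁h x₂ x)
      ... | no ne with strict p₂ ne
      ... | i , p , q = x₂ (hs (s₂ ∷ V₂) l₂ (cons-⊑′ {V₂} {y} (λ _ → z) p₂) (fsuc i) p q (fsuc h))

      conf : ∀ e → ¬ InSep V₁ V₂ e
      conf e o = Opposite-irrefl (trans (≼-nz {X = V₁} {y} p₁ (Opposite-nzˡ o)) (sym (≼-nz {X = V₂} {y} p₂
            (Opposite-nzʳ o)))) o

      -- With equal signs, eliminating p would give a covector below the cocircuit `s ∷ y`, hence a
      -- multiple of it. At `h` the multiple is positive, while at a zero `e` of `V₂` off `V₁` it is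
      -- negative.
      apart : s₁ ≢ s₂
      apart eq with diff O₁ fzero l₁ l₂ eq s₁≢ | separate O c₂ h₂ c₁ x₂
      ... | _ | inj₂ (τ , m) = x₁ (trans (m x) (cong (λ t → mul t (V₂ ! x))
            (mul-zer⁻ (trans (mul-comm (V₂ ! h) τ) (trans (sym (m h)) V₁h)) x₂)))
      ... | N , cN , dN | inj₁ (e , p , q) with point-unique O₁ {s ∷ y} {N} {s ∷ y} {fsuc h} hs cN N⊑ cs
            (λ _ z → z) yh
        where
        N⊑ : N ⊑ s ∷ y
        N⊑ fzero _ = at dN
        N⊑ (fsuc i) z = zz dN (fsuc i) (≼⇒⊑ {X = V₁} {y} p₁ i z) (≼⇒⊑ {X = V₂} {y} p₂ i z)
      ... | τ , m with mul-fix {τ} yh (trans (sym (≼-nz {X = V₂} {y} p₂ x₂))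
            (trans (sym (left dN (fsuc h) V₁h)) (m (fsuc h))))
      ... | refl = q (opp-fix (trans (≼-nz {X = V₁} {y} p₁ q) (trans (sym (m (fsuc e))) (right dN (fsuc e)
            p))))

      opposed : Opposite s₁ s₂
      opposed with ±-split s₁≢ s₂≢
      ... | inj₁ eq = ⊥-elim (apart eq)
      ... | inj₂ eq = opp⇒opposite s₁≢ eq

      spans : V₁ ∘ᵛ V₂ ≡ y
      spans with L3 O₁ fzero l₁ l₂ opposed
      ... | r ∷ N , cN , r≡ , offN = ext agree
        where
        V≼y : (V₁ ∘ᵛ V₂) ≼ y
        V≼y i with V₁ ! i ≟ₛ zer
        ... | no q = inj₂ (trans (∘! V₁ V₂ i) (trans (comp-nz q) (≼-nz {X = V₁} {y} p₁ q)))
        ... | yes q with p₂ i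
        ... | inj₁ r = inj₁ (∘-zer {X = V₁} {V₂} q r)
        ... | inj₂ r = inj₂ (trans (∘-left {X = V₁} {V₂} q) r)
        N≡ : ∀ i → N ! i ≡ (V₁ ∘ᵛ V₂) ! i
        N≡ i = offN (fsuc i) (conf i)
        agree : ∀ i → (V₁ ∘ᵛ V₂) ! i ≡ y ! i
        agree i with V≼y i
        ... | inj₂ q = q
        ... | inj₁ q with y ! i ≟ₛ zer
        ... | yes z = trans q (sym z)
        ... | no z = ⊥-elim (∘-nzʳ {X = V₁} {V₂} x₂ (trans (sym (N≡ h)) (hs (r ∷ N) cN below′ (fsuc i)
              (trans (N≡ i) q) z (fsuc h))))
          where
          below′ : r ∷ N ⊑ s ∷ y
          below′ fzero _ = r≡
          below′ (fsuc j) w = trans (N≡ j) (≼⇒⊑ {X = V₁ ∘ᵛ V₂} {y} V≼y j w)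

      between : Cov O₂ (s ∷ y)
      between with L3 O₂ fzero (E₂.localizes (Ht⇒cocircuit O c₁ x₁ h₁)) (E₂.localizes (Ht⇒cocircuit O c₂ x₂
            h₂)) opposed
      ... | r ∷ N , cN , r≡ , offN = subst (Cov O₂) (cong₂ _∷_ (trans r≡ (sym s≡))
              (ext λ i → trans (offN (fsuc i) (conf i)) (cong (_! i) spans))) cN

    point : ∀ {s y} → Cov O₁ (s ∷ y) → Ht O₁ 1 (s ∷ y) → (s ∷ y) ≢ zeroV → Cov O₂ (s ∷ y)
    point {s} {y} cs hs ne with nonzero y
    ... | inj₁ z = ⊥-elim (ne (ext λ { fzero → E₁.not-coloop cs z ; (fsuc e) → trans (z e) (sym (zeroV! e))
          }))
    ... | inj₂ (x , yx) with minimal (E₁.restricts cs) yx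
    ... | V₁ , c₁ , h₁ , p₁ , x₁ with ≡-dec _≟ₛ_ V₁ y
    ... | yes refl = subst (λ t → Cov O₂ (t ∷ y)) (unique-lift h₁ x₁ (E₁.localizes cc) cs) (E₂.localizes cc)
      where cc = Ht⇒cocircuit O c₁ x₁ h₁
    ... | no V≢ with strict p₁ V≢
    ... | h , V₁h , yh with minimal (E₁.restricts cs) yh
    ... | V₂ , c₂ , h₂ , p₂ , x₂ = Between.between cs hs c₁ h₁ p₁ x₁ c₂ h₂ p₂ x₂ V₁h yh

  -- A covector is the composition of the cocircuits conformally below it. Those of `O` are lifted
  -- according to `σ`, and the remaining ones are recovered in the other extension by `Between`.
  extension-⊆ : ∀ {X} → Cov O₁ X → Cov O₂ X
  extension-⊆ {X} cX with compose {P = λ Q → Cov O₂ Q × Q ≼ X} (L0 O₂ , λ e → inj₁ (zeroV! e)) comp≼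
        {λ e → X ! e ≡ zer} pick
    where
    comp≼ : ∀ {Q R} → Cov O₂ Q × Q ≼ X → Cov O₂ R × R ≼ X → Cov O₂ (Q ∘ᵛ R) × (Q ∘ᵛ R) ≼ X
    comp≼ {Q} {R} (c , p) (c′ , p′) = L2 O₂ c c′ , both
      where
      both : (Q ∘ᵛ R) ≼ X
      both i with Q ! i ≟ₛ zer
      ... | no q = inj₂ (trans (∘! Q R i) (trans (comp-nz q) (≼-nz {X = Q} {X} p q)))
      ... | yes q with p′ i
      ... | inj₁ r = inj₁ (∘-zer {X = Q} {R} q r)
      ... | inj₂ r = inj₂ (trans (∘-left {X = Q} {R} q) r)
    pick : ∀ e → ∃ λ Q → (Cov O₂ Q × Q ≼ X) × (Q ! e ≡ zer → X ! e ≡ zer)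
    pick e with X ! e ≟ₛ zer
    ... | yes z = zeroV , (L0 O₂ , λ i → inj₁ (zeroV! i)) , λ _ → z
    ... | no z with Decompose.decompose O₁ Cov₁? (suc (suc n)) {X} (m≤m+n (suc (suc n)) _) cX z
    ... | s ∷ y , cC , hC , C≼X , Ce = s ∷ y , (point cC hC (nz⇒≢zeroV {e = e} Ce) , C≼X) , λ q → ⊥-elim
          (Ce q)
  ... | R , (cR , R≼X) , h = subst (Cov O₂) (ext agree) cR
    where
    agree : ∀ e → R ! e ≡ X ! e
    agree e with R≼X e
    ... | inj₂ q = q
    ... | inj₁ q = trans q (sym (h e q))

¬¬-decidable : ∀ {n} (P : SV n → Set) → ¬ ¬ (∀ X → Dec (P X))
¬¬-decidable {zero} P k = k λ { [] → no λ p → k λ { [] → yes p } }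
¬¬-decidable {suc n} P k =
  ¬¬-decidable (P ∘ (pos ∷_)) λ p → ¬¬-decidable (P ∘ (neg ∷_)) λ q → ¬¬-decidable (P ∘ (zer ∷_)) λ r →
  k λ { (pos ∷ X) → p X ; (neg ∷ X) → q X ; (zer ∷ X) → r X }

theorem1p2 : ∀ (n : ℕ) (O : OM n) (es : List (Fin n × Sign)) (O' : OM (suc n)) →
    Euclidean O → IsLexExtension O es O' → Euclidean O'
theorem1p2 n O es O' eu (_ , nz , ext') g f g≢f nl ncl vs cycle =
  ¬¬-decidable (Cov O) λ D → ¬¬-decidable (Cov O') λ D' → ¬¬-decidable (Cov (build O es)) λ D* →
  let E' = IsExtension⇒Extends {O = O} {O'} {lexσ es} ext'
      E* = build-extends O es nz
      ncO' = transport-acyclic {O₁ = O'} {build O es} (Unique-extension.extension-⊆ E' E* D D')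
            (Unique-extension.extension-⊆ E* E' D D*)
               (build-acyclic O es nz (NoConformalCycle⇒NoCycle (Euclidean⇒NoConformalCycle D eu)))
  in NoConformalCycle⇒Euclidean (λ g f δ≢ w r → ncO' g f δ≢ (gmap (λ X → X) (λ { (d , h , s) → d , h , proj₁ s
        }) w) (proj₁ r))
       g f g≢f nl ncl vs cycle
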